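{- There exists an algorithm for distributed asynchronous collective tree exploration (DACTE) with $k$ robots that explores any tree with $n$ nodes and depth $D$ in at most $2n+\mathcal{O}(k^2 2^k D)$ moves, and a variant of this algorithm that explores any tree with $n$ nodes and depth $D$ in at most $\mathcal{O}(k/\log k)(n+kD)$ moves. (The constants in $\mathcal{O}(\cdot)$ are absolute, independent of $k,n,D$.)
   Context: DACTE model. An unknown finite rooted tree $T$ is to be explored by $k$ robots (agents), all initially located at the root. Nodes are identified by the sequence of port numbers leading from the root to them. Every node carries a whiteboard of unbounded size; each robot has unbounded internal memory and unbounded computational power; initially all whiteboards and memories are empty. Exploration proceeds in rounds $t=1,2,\dots$. At each round an omniscient adversary (knowing the algorithm, the tree, and all memories and positions) selects one robot, which performs the following consecutive instantaneous steps: (1) it reads the whiteboard at its current node; (2) it observes the list of nodes adjacent to its position; (3) it writes on the whiteboard at its position and updates its internal memory; (4) it moves along an edge to a neighbour of its choice (robots do not read or write at their destination). Each round counts as one move. A node is visited once the adversary has activated a robot located at it; exploration finishes at the first round at which every node of $T$ has been visited. An algorithm explores a tree in at most $M$ moves if, against every adversary, exploration finishes within $M$ rounds. The depth of $T$ is the maximum distance (number of edges) from the root to a node. -}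

module Defs where

open import Data.Nat using (ℕ; zero; suc; _+_; _*_; _⊔_)
open import Data.List using (List; []; _∷_; _++_; [_]; map; length; upTo; lookup)
open import Data.List.Properties using (≡-dec)
open import Data.Fin using (Fin)
open import Data.Fin.Properties using () renaming (_≟_ to _≟F_)
open import Data.Maybe using (Maybe; just; nothing; maybe)
open import Data.Product using (Σ; _×_; _,_; ∃)
open import Data.Unit using (⊤)
open import Relation.Nullary using (yes; no)
open import Relation.Binary.PropositionalEquality using (_≡_)
import Data.Nat as N

-- Finite rooted (ordered) trees.  The children of a node are reached
-- through ports 0, 1, ..., c-1 (in list order).

data Tree : Set where
  node : List Tree → Tree

-- A node is identified by the sequence of ports leading from the root.
Address : Set
Address = List ℕ

mutual
  subtree : Tree → Address → Maybe Tree
  subtree t [] = just t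
  subtree (node ts) (i ∷ a) = subtreeL ts i a

  subtreeL : List Tree → ℕ → Address → Maybe Tree
  subtreeL [] _ _ = nothing
  subtreeL (t ∷ ts) zero a = subtree t a
  subtreeL (t ∷ ts) (suc i) a = subtreeL ts i a

IsNode : Tree → Address → Set
IsNode T a = ∃ λ t → subtree T a ≡ just t

mutual
  size : Tree → ℕ
  size (node ts) = suc (sizeL ts)

  sizeL : List Tree → ℕ
  sizeL [] = 0
  sizeL (t ∷ ts) = size t + sizeL ts

mutual
  depth : Tree → ℕ
  depth (node []) = 0
  depth (node (t ∷ ts)) = suc (depthL (t ∷ ts))

  depthL : List Tree → ℕ
  depthL [] = 0
  depthL (t ∷ ts) = depth t ⊔ depthL ts

numChildren : Tree → Address → ℕ
numChildren T a = maybe (λ { (node ts) → length ts }) 0 (subtree T a)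

dropLast : Address → Address
dropLast [] = []
dropLast (x ∷ []) = []
dropLast (x ∷ y ∷ a) = x ∷ dropLast (y ∷ a)

parentList : Address → List Address
parentList [] = []
parentList (x ∷ a) = [ dropLast (x ∷ a) ]

neighbours : Tree → Address → List Address
neighbours T a = parentList a ++ map (λ i → a ++ [ i ]) (upTo (numChildren T a))

-- Algorithms.  A move is the choice of one of the listed neighbours;
-- when there is no neighbour (single-node tree) there is nothing to choose.

Choice : ℕ → Set
Choice zero = ⊤
Choice (suc m) = Fin (suc m)

destination : (nbrs : List Address) → Choice (length nbrs) → Address → Address
destination [] _ a = a
destination (x ∷ xs) i a = lookup (x ∷ xs) i

-- An algorithm (identical for all robots): arbitrary (unbounded) memory
-- and whiteboard contents with an "empty" initial value, and an arbitrary
-- (unbounded computational power) local rule which, given the robot's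
-- memory, the whiteboard content at its node, its node and the list of
-- adjacent nodes, produces the new memory, the new whiteboard content
-- and the chosen neighbour to move to.
record Algorithm : Set₁ where
  field
    Mem  : Set
    WB   : Set
    mem₀ : Mem
    wb₀  : WB
    step : Mem → WB → (here : Address) → (nbrs : List Address) →
           Mem × WB × Choice (length nbrs)

module Execution (A : Algorithm) (k : ℕ) (T : Tree) where
  open Algorithm A

  record Config : Set where
    field
      pos : Fin k → Address
      mem : Fin k → Mem
      wb  : Address → WB
  open Config public

  initial : Config
  initial = record { pos = λ _ → []; mem = λ _ → mem₀; wb = λ _ → wb₀ }

  updR : {X : Set} → (Fin k → X) → Fin k → X → Fin k → X
  updR f r x r' with r' ≟F r
  ... | yes _ = x
  ... | no  _ = f r'

  updA : {X : Set} → (Address → X) → Address → X → Address → X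
  updA f a x a' with ≡-dec N._≟_ a' a
  ... | yes _ = x
  ... | no  _ = f a'

  activate : Config → Fin k → Config
  activate c r with pos c r
  ... | a with step (mem c r) (wb c a) a (neighbours T a)
  ... | m' , w' , ch = record
    { pos = updR (pos c) r (destination (neighbours T a) ch a)
    ; mem = updR (mem c) r m'
    ; wb  = updA (wb c) a w' }

  -- Since the algorithm is deterministic, an (omniscient, adaptive)
  -- adversary is equivalent to a sequence of robot choices σ;
  -- σ t is the robot activated at round t+1.
  config : (ℕ → Fin k) → ℕ → Config
  config σ zero = initial
  config σ (suc t) = activate (config σ t) (σ t)

  visitedAt : (ℕ → Fin k) → ℕ → Address
  visitedAt σ t = pos (config σ t) (σ t)

  ExploredWithin : (ℕ → Fin k) → ℕ → Set
  ExploredWithin σ M = ∀ a → IsNode T a → Σ ℕ λ t → t N.< M × visitedAt σ t ≡ a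

ExploresIn : Algorithm → (k : ℕ) → Tree → ℕ → Set
ExploresIn A k T M = ∀ (σ : ℕ → Fin k) → Execution.ExploredWithin A k T σ M

{-# OPTIONS --safe #-}
module Submission where

-- Robots are enrolled, at their first activation, into G groups of at most κ; each group keeps its own records
-- on the whiteboards and explores the tree regardless of the others.  A robot enters a child that is new to its
-- group whenever there is one, and leaves a finished subtree upwards, which together takes at most 2 G (n - 1)
-- moves.  Otherwise it must choose among children that other robots are still exploring.  It does so on the basis
-- of a private map, whose nodes carry values as in layered graph traversal: the values of the branches of a fork
-- are combined by a function g, the robot heads for branches of small value, and it turns around as soon as its
-- own branch has become 1 + 1/κ times as valuable as another.  The unfinished branches off a robot's path contain
-- distinct other robots of the group, so there are fewer than κ of them, and each fork damps the gain in value by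
-- a factor of about 1/2.  Since the value of the map is bounded by the depth D, a potential argument limits each
-- robot to O(κ 2^κ D) moves along known edges down the tree.  This gives 2 G n + O(k κ 2^κ D) moves in all;
-- take G = 1 and κ = k for the first bound, and κ about (log₂ k) / 2 for the second.

-- Three events change a map, and each quantity answers one of them (`k` in the modules below is κ).
-- Turning around starts a new descent, whose length is bounded by the value ahead; `on` and `off`
-- are chosen so that the potential then falls by that value divided by `k`. Removing a finished
-- branch may raise the potential although no value has been gained; `off` limits the rise to a
-- share `1 / k` of the remaining value plus `W`, and the load of the edges that remain, which
-- shrinks at a removal, pays for it. Examining a leaf is the only event paid from outside. It
-- raises the value of the hole by `W = M ^ k`, of which at least `2 * k ^ k * 2 ^ q` reaches the
-- root if the leaf has `q` unfinished children, because these, the robot itself and the open forks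
-- number at most `k` together. So a credit of `2 ^ q` can be granted, which covers a cost linear in
-- `q`, and all credits together are O(2^k D). The delicate case is a leaf without such room: then
-- some branch still listed in the map has been finished by others, and the robot climbs to find and
-- remove it.

open import Defs
open import Data.Bool using (Bool; true; false; _∧_; _∨_; T; if_then_else_)
open import Data.Empty using (⊥; ⊥-elim)
open import Data.Fin using (Fin; zero; suc)
open import Data.Fin.Properties using () renaming (_≟_ to _≟F_)
open import Data.List using (List; []; _∷_; _++_; [_]; length; map; upTo; applyUpTo; lookup)
open import Data.List.Properties using (≡-dec; length-map; length-upTo; ++-assoc; ++-identityʳ; ++-cancelˡ; ∷-injectiveˡ; ∷-injectiveʳ)
open import Data.List.Membership.Propositional using (_∈_)
open import Data.List.Relation.Unary.All as All using (All; []; _∷_)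
open import Data.List.Relation.Unary.AllPairs using ([]; _∷_)
open import Data.List.Relation.Unary.Any using (here; there)
open import Data.List.Relation.Unary.Unique.Propositional using (Unique)
open import Data.Maybe as Maybe using (Maybe; just; nothing; maybe)
open import Data.Maybe.Properties using (just-injective)
open import Data.Nat
open import Data.Nat.DivMod using (/-monoˡ-≤; m%n<n; m%n≤n; m*n/n≡m; m/n*n≤m; m≡m%n+[m/n]*n)
open import Data.Nat.Induction using (Acc; acc; <-wellFounded)
open import Data.Nat.Logarithm using (⌊log₂_⌋)
open import Data.Nat.Logarithm.Core using (⌊log2⌋)
open import Data.Nat.Properties
open import Data.Nat.Tactic.RingSolver using (solve-∀)
open import Data.Product using (Σ; _×_; _,_; proj₁; proj₂; ∃)
open import Data.Sum using (_⊎_; inj₁; inj₂)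
open import Data.Unit using (⊤; tt)
open import Function using (id; _∘_)
open import Relation.Binary.Definitions using (tri<; tri≈; tri>)
open import Relation.Binary.PropositionalEquality hiding ([_])
open import Relation.Nullary using (yes; no)

-- Every linear estimate below is reduced by this to a semiring identity, s being the slack.
lin : ∀ {L R a b} s → a ≤ b → L + b + s ≡ R + a → L ≤ R
lin {L} {R} {a} {b} s a≤b e = +-cancelʳ-≤ b L R (begin
  L + b     ≤⟨ m≤m+n (L + b) s ⟩
  L + b + s ≡⟨ e ⟩
  R + a     ≤⟨ +-monoʳ-≤ R a≤b ⟩
  R + b     ∎)
  where open ≤-Reasoning

<ᵇ-false : ∀ m n → (m <ᵇ n) ≡ false → n ≤ m
<ᵇ-false m n e = ≮⇒≥ λ m<n → subst T e (<⇒<ᵇ m<n)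

<ᵇ-true : ∀ m n → (m <ᵇ n) ≡ true → m < n
<ᵇ-true m n e = <ᵇ⇒< m n (subst T (sym e) tt)

≤ᵇ-true : ∀ m n → (m ≤ᵇ n) ≡ true → m ≤ n
≤ᵇ-true m n e = ≤ᵇ⇒≤ m n (subst T (sym e) tt)

≤ᵇ-false : ∀ m n → (m ≤ᵇ n) ≡ false → n ≤ m
≤ᵇ-false m n e with ≤-total m n
... | inj₁ m≤n = ⊥-elim (subst T e (≤⇒≤ᵇ m≤n))
... | inj₂ n≤m = n≤m

∨-false₁ : ∀ a b → (a ∨ b) ≡ false → a ≡ false
∨-false₁ false b e = refl

∨-false₂ : ∀ a b → (a ∨ b) ≡ false → b ≡ false
∨-false₂ false b e = e

-- Multiplying `j` by `1 + 1/2k` adds at most 1 because `j ≤ 2 * k`, and `n` such steps lead to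
-- `2 * k`. In fractions: `(1 + 1/2k)^n ≤ 2k / (2k - n)`.
pow-bound : ∀ k n j → n + j ≡ 2 * k → suc (2 * k) ^ n * j ≤ (2 * k) ^ suc n
pow-bound k zero j e = ≤-reflexive (trans (*-identityˡ j) (trans e (sym (*-identityʳ (2 * k)))))
pow-bound k (suc n) j e = begin
  suc (2 * k) * suc (2 * k) ^ n * j   ≡⟨ e₁ (suc (2 * k)) (suc (2 * k) ^ n) j ⟩
  suc (2 * k) ^ n * (suc (2 * k) * j) ≤⟨ *-monoʳ-≤ (suc (2 * k) ^ n) (+-monoˡ-≤ (2 * k * j) j≤) ⟩
  suc (2 * k) ^ n * (2 * k + 2 * k * j) ≡⟨ e₂ (suc (2 * k) ^ n) (2 * k) j ⟩
  2 * k * (suc (2 * k) ^ n * suc j)   ≤⟨ *-monoʳ-≤ (2 * k) (pow-bound k n (suc j) (trans (+-suc n j) e)) ⟩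
  2 * k * (2 * k) ^ suc n             ∎
  where
  open ≤-Reasoning
  e₁ : ∀ a b c → a * b * c ≡ b * (a * c)
  e₁ = solve-∀
  e₂ : ∀ a b c → a * (b + b * c) ≡ b * (a * suc c)
  e₂ = solve-∀
  j≤ : j ≤ 2 * k
  j≤ = ≤-trans (m≤n+m j (suc n)) (≤-reflexive e)

pow-ratio : ∀ k n .{{_ : NonZero k}} → n ≤ k → suc (2 * k) ^ n ≤ 2 * (2 * k) ^ n
pow-ratio k n n≤k = *-cancelʳ-≤ _ _ k (begin
  suc (2 * k) ^ n * k             ≤⟨ *-monoʳ-≤ (suc (2 * k) ^ n) k≤ ⟩
  suc (2 * k) ^ n * (2 * k ∸ n)   ≤⟨ pow-bound k n (2 * k ∸ n) (m+[n∸m]≡n (≤-trans n≤k (m≤m+n k (k + 0)))) ⟩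
  2 * k * (2 * k) ^ n             ≡⟨ e k ((2 * k) ^ n) ⟩
  2 * (2 * k) ^ n * k             ∎)
  where
  open ≤-Reasoning
  e : ∀ a b → 2 * a * b ≡ 2 * b * a
  e = solve-∀
  k≤ : k ≤ 2 * k ∸ n
  k≤ = m+n≤o⇒m≤o∸n k (begin
    k + n ≤⟨ +-monoʳ-≤ k n≤k ⟩
    k + k ≡⟨ cong (k +_) (sym (+-identityʳ k)) ⟩
    2 * k ∎)

-- The value of a fork with two branches.

module Fork (k : ℕ) .{{_ : NonZero k}} (W : ℕ) (1≤W : 1 ≤ W) where

  M : ℕ
  M = suc (2 * k)

  -- g a b is the value of a fork into two branches of values a and b.  off a b is what is reserved for
  -- later visits of the fork by a robot that is in neither branch, and on h a by one in the branch of value h.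
  g : ℕ → ℕ → ℕ
  g a b = a ⊓ b ⊓ (k * (a + b ∸ W) / M)

  off : ℕ → ℕ → ℕ
  off a b = (a ⊓ b) ⊔ (a ⊔ b ∸ (a ⊓ b / k + W))

  on : ℕ → ℕ → ℕ
  on h a = h ⊔ off h a

  -- The branch h has become so much more valuable than its sibling a (by a factor 1 + 1/k) that switching pays.
  over : ℕ → ℕ → Bool
  over h a = suc k * a <ᵇ k * h

  g≤ˡ : ∀ a b → g a b ≤ a
  g≤ˡ a b = ≤-trans (m⊓n≤m (a ⊓ b) _) (m⊓n≤m a b)

  g≤ʳ : ∀ a b → g a b ≤ b
  g≤ʳ a b = ≤-trans (m⊓n≤m (a ⊓ b) _) (m⊓n≤n a b)

  g≤off : ∀ a b → g a b ≤ off a b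
  g≤off a b = ≤-trans (m⊓n≤m (a ⊓ b) _) (m≤m⊔n (a ⊓ b) _)

  g-comm : ∀ a b → g a b ≡ g b a
  g-comm a b rewrite ⊓-comm a b | +-comm a b = refl

  off-comm : ∀ a b → off a b ≡ off b a
  off-comm a b rewrite ⊓-comm a b | ⊔-comm a b = refl

  g-mono : ∀ {a a′ b b′} → a ≤ a′ → b ≤ b′ → g a b ≤ g a′ b′
  g-mono p q = ⊓-mono-≤ (⊓-mono-≤ p q) (/-monoˡ-≤ M (*-monoʳ-≤ k (∸-monoˡ-≤ W (+-mono-≤ p q))))

  h≤on : ∀ h a → h ≤ on h a
  h≤on h a = m≤m⊔n h _

  off≤on : ∀ h a → off h a ≤ on h a
  off≤on h a = m≤n⊔m h _

  g≤on : ∀ h a → g h a ≤ on h a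
  g≤on h a = ≤-trans (g≤off h a) (off≤on h a)

  -- For this reason entering the less valuable branch leaves the potential unchanged.
  on≡off : ∀ h a → h ≤ a → on h a ≡ off h a
  on≡off h a h≤a = m≤n⇒m⊔n≡n (≤-trans (≤-reflexive (sym (m≤n⇒m⊓n≡m h≤a))) (m≤m⊔n (h ⊓ a) _))

  +∸≤ : ∀ m d n → m + d ∸ n ≤ (m ∸ n) + d
  +∸≤ m d n = m≤n+o⇒m∸n≤o (m + d) n (begin
    m + d             ≤⟨ +-monoˡ-≤ d (m≤n+m∸n m n) ⟩
    n + (m ∸ n) + d   ≡⟨ +-assoc n (m ∸ n) d ⟩
    n + (m ∸ n + d)   ∎)
    where open ≤-Reasoning

  -- Raising both arguments by `d` shifts `⊓` and `⊔` by `d`, while the term that is subtracted can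
  -- only grow.
  off-lip : ∀ h d a → off (h + d) a ≤ off h a + d
  off-lip h d a = ⊔-lub
    (begin
      (h + d) ⊓ a           ≤⟨ ⊓-monoʳ-≤ (h + d) (m≤m+n a d) ⟩
      (h + d) ⊓ (a + d)     ≡⟨ sym (+-distribʳ-⊓ d h a) ⟩
      (h ⊓ a) + d           ≤⟨ +-monoˡ-≤ d (m≤m⊔n (h ⊓ a) _) ⟩
      off h a + d           ∎)
    (begin
      (h + d) ⊔ a ∸ ((h + d) ⊓ a / k + W)  ≤⟨ ∸-monoˡ-≤ ((h + d) ⊓ a / k + W) (⊔-monoʳ-≤ (h + d) (m≤m+n a d)) ⟩
      (h + d) ⊔ (a + d) ∸ ((h + d) ⊓ a / k + W)  ≡⟨ cong (_∸ ((h + d) ⊓ a / k + W)) (sym (+-distribʳ-⊔ d h a)) ⟩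
      (h ⊔ a) + d ∸ ((h + d) ⊓ a / k + W)  ≤⟨ ∸-monoʳ-≤ ((h ⊔ a) + d) (+-monoˡ-≤ W (/-monoˡ-≤ k (⊓-monoˡ-≤ a (m≤m+n h d)))) ⟩
      (h ⊔ a) + d ∸ (h ⊓ a / k + W)  ≤⟨ +∸≤ (h ⊔ a) d (h ⊓ a / k + W) ⟩
      (h ⊔ a ∸ (h ⊓ a / k + W)) + d  ≤⟨ +-monoˡ-≤ d (m≤n⊔m (h ⊓ a) _) ⟩
      off h a + d ∎)
    where open ≤-Reasoning

  off-lip′ : ∀ a h d → off a (h + d) ≤ off a h + d
  off-lip′ a h d = subst₂ (λ x y → x ≤ y + d) (off-comm (h + d) a) (off-comm h a) (off-lip h d a)

  on-lip : ∀ h d a → on (h + d) a ≤ on h a + d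
  on-lip h d a = ⊔-lub (+-monoˡ-≤ d (h≤on h a)) (≤-trans (off-lip h d a) (+-monoˡ-≤ d (off≤on h a)))

  off≤⊔ : ∀ a b → off a b ≤ a ⊔ b
  off≤⊔ a b = ⊔-lub (≤-trans (m⊓n≤m a b) (m≤m⊔n a b)) (m∸n≤m (a ⊔ b) (a ⊓ b / k + W))

  -- This is the purpose of the second term of `off`: when the branch of value `a` is removed, what
  -- was reserved as `off a b` becomes `b`, a rise of at most `b / k + W`.
  off-slack : ∀ a b → k * b ≤ k * off a b + b + k * W
  off-slack a b with ≤-total a b
  ... | inj₂ b≤a = begin
      k * b ≤⟨ *-monoʳ-≤ k (≤-trans (≤-reflexive (sym (m≥n⇒m⊓n≡n b≤a))) (m≤m⊔n (a ⊓ b) _)) ⟩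
      k * off a b ≤⟨ m≤m+n _ b ⟩
      k * off a b + b ≤⟨ m≤m+n _ (k * W) ⟩
      k * off a b + b + k * W ∎
    where open ≤-Reasoning
  ... | inj₁ a≤b = begin
      k * b                                   ≤⟨ *-monoʳ-≤ k (m≤n+m∸n b (a ⊓ b / k + W)) ⟩
      k * ((a ⊓ b / k + W) + (b ∸ (a ⊓ b / k + W)))  ≡⟨ e k (a ⊓ b / k) W _ ⟩
      k * (b ∸ (a ⊓ b / k + W)) + a ⊓ b / k * k + k * W  ≤⟨ +-monoˡ-≤ (k * W) (+-mono-≤ (*-monoʳ-≤ k le₁) (≤-trans (m/n*n≤m (a ⊓ b) k) (m⊓n≤n a b))) ⟩
      k * off a b + b + k * W                 ∎
    where
    open ≤-Reasoning
    e : ∀ k x W y → k * ((x + W) + y) ≡ k * y + x * k + k * W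
    e = solve-∀
    le₁ : b ∸ (a ⊓ b / k + W) ≤ off a b
    le₁ = ≤-trans (∸-monoˡ-≤ (a ⊓ b / k + W) (m≤n⊔m a b)) (m≤n⊔m (a ⊓ b) _)

  over⇒≤ : ∀ h a → over h a ≡ true → a ≤ h
  over⇒≤ h a ov = *-cancelˡ-≤ k (≤-trans (m≤n+m (k * a) a) (<⇒≤ (<ᵇ-true _ _ ov)))

  -- Leaving the branch `h` for its sibling releases `a / k`: by `over`, `h` exceeds `a` by that
  -- much, and it exceeds the other term of `off` by `a / k + W`, where `W ≥ 1` makes up for the
  -- rounding.
  over-drop : ∀ h a → over h a ≡ true → k * off h a + a ≤ k * on h a
  over-drop h a ov = ≤-trans (+-monoˡ-≤ a (≤-reflexive (cong (k *_) eqoff))) (≤-trans main (*-monoʳ-≤ k (h≤on h a)))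
    where
    open ≤-Reasoning
    a≤h = over⇒≤ h a ov
    x = a / k + W
    eqoff : off h a ≡ a ⊔ (h ∸ x)
    eqoff rewrite m≥n⇒m⊓n≡n a≤h | m≥n⇒m⊔n≡m a≤h = refl
    a≤kx : a ≤ k * x
    a≤kx = begin
      a                     ≡⟨ m≡m%n+[m/n]*n a k ⟩
      a % k + a / k * k     ≤⟨ +-monoˡ-≤ (a / k * k) (m%n≤n a k) ⟩
      k + a / k * k         ≤⟨ +-monoˡ-≤ (a / k * k) (≤-trans (≤-reflexive (sym (*-identityʳ k))) (*-monoʳ-≤ k 1≤W)) ⟩
      k * W + a / k * k     ≡⟨ e k W (a / k) ⟩
      k * x                 ∎
      where e : ∀ k W y → k * W + y * k ≡ k * (y + W)
            e = solve-∀
    sa≤ : a + k * a ≤ k * h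
    sa≤ = <⇒≤ (<ᵇ-true _ _ ov)
    main : k * (a ⊔ (h ∸ x)) + a ≤ k * h
    main with ≤-total a (h ∸ x)
    ... | inj₂ q rewrite m≥n⇒m⊔n≡m q = ≤-trans (≤-reflexive (+-comm (k * a) a)) sa≤
    ... | inj₁ q rewrite m≤n⇒m⊔n≡n q with ≤-total x h
    ...   | inj₁ x≤h = begin
            k * (h ∸ x) + a       ≤⟨ +-monoʳ-≤ _ a≤kx ⟩
            k * (h ∸ x) + k * x   ≡⟨ sym (*-distribˡ-+ k (h ∸ x) x) ⟩
            k * (h ∸ x + x)       ≡⟨ cong (k *_) (m∸n+n≡m x≤h) ⟩
            k * h ∎
    ...   | inj₂ h≤x rewrite m≤n⇒m∸n≡0 h≤x | *-zeroʳ k = ≤-trans (m≤m+n a (k * a)) sa≤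

  -- Without the subtracted `W`, the quotient in `g` would reach `a` exactly at the switching point
  -- `h = (1 + 1/k) a`. Before that point the `W` leaves room for a gain of up to `W`, so `a` does
  -- not become the minimum, and the quotient grows by `k` for every `M`.
  g-slope : ∀ h h′ a e → over h a ≡ false → W ≤ h + a → M * e ≤ W → h + M * e ≤ h′ →
            g h a + k * e ≤ g h′ a
  g-slope h h′ a e nov W≤ e≤W h≤ = ≤-trans (⊓-glb (⊓-glb c₁ c₂) c₃) (g-mono h≤ ≤-refl)
    where
    open ≤-Reasoning
    q = k * (h + a ∸ W)
    g≤q : g h a ≤ q / M
    g≤q = m⊓n≤n (h ⊓ a) _
    c₁ : g h a + k * e ≤ h + M * e
    c₁ = +-mono-≤ (g≤ˡ h a) (*-monoˡ-≤ e (≤-trans (m≤m+n k (k + 0)) (n≤1+n (2 * k))))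
    qM : (q / M + k * e) * M ≤ q + k * (M * e)
    qM = begin
      (q / M + k * e) * M       ≡⟨ e₁ (q / M) k e M ⟩
      q / M * M + k * (M * e)   ≤⟨ +-monoˡ-≤ _ (m/n*n≤m q M) ⟩
      q + k * (M * e)           ∎
      where e₁ : ∀ x k e m → (x + k * e) * m ≡ x * m + k * (m * e)
            e₁ = solve-∀
    c₂ : g h a + k * e ≤ a
    c₂ = ≤-trans (+-monoˡ-≤ (k * e) g≤q) (*-cancelʳ-≤ _ _ M (begin
      (q / M + k * e) * M           ≤⟨ qM ⟩
      q + k * (M * e)               ≤⟨ +-monoʳ-≤ q (*-monoʳ-≤ k e≤W) ⟩
      k * (h + a ∸ W) + k * W       ≡⟨ sym (*-distribˡ-+ k (h + a ∸ W) W) ⟩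
      k * (h + a ∸ W + W)           ≡⟨ cong (k *_) (m∸n+n≡m W≤) ⟩
      k * (h + a)                   ≡⟨ *-distribˡ-+ k h a ⟩
      k * h + k * a                 ≤⟨ +-monoˡ-≤ (k * a) (<ᵇ-false _ _ nov) ⟩
      suc k * a + k * a             ≡⟨ e₂ k a ⟩
      a * M                         ∎))
      where e₂ : ∀ k a → suc k * a + k * a ≡ a * suc (2 * k)
            e₂ = solve-∀
    c₃ : g h a + k * e ≤ k * (h + M * e + a ∸ W) / M
    c₃ = begin
      g h a + k * e               ≤⟨ +-monoˡ-≤ (k * e) g≤q ⟩
      q / M + k * e               ≡⟨ sym (m*n/n≡m (q / M + k * e) M) ⟩
      (q / M + k * e) * M / M     ≤⟨ /-monoˡ-≤ M qM ⟩
      (q + k * (M * e)) / M       ≡⟨ cong (_/ M) eq ⟩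
      k * (h + M * e + a ∸ W) / M ∎
      where
      eq : q + k * (M * e) ≡ k * (h + M * e + a ∸ W)
      eq = trans (sym (*-distribˡ-+ k (h + a ∸ W) (M * e))) (cong (k *_)
             (trans (sym (+-∸-comm (M * e) W≤)) (cong (_∸ W) (e₃ h a (M * e)))))
        where e₃ : ∀ h a x → h + a + x ≡ h + x + a
              e₃ = solve-∀

  -- Since `a + b` is at least twice the minimum, a fork is worth its lesser branch up to the factor
  -- `1 + 1/2k` and a term `W`; `2 ≤ W` absorbs the rounding.
  min-bound : ∀ a b → 2 ≤ W → 2 * k * (a ⊓ b) ≤ M * (g a b + W)
  min-bound a b 2≤W with ⊓-sel (a ⊓ b) (k * (a + b ∸ W) / M)
  ... | inj₁ e = begin
      2 * k * (a ⊓ b)       ≤⟨ *-monoˡ-≤ (a ⊓ b) (n≤1+n (2 * k)) ⟩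
      M * (a ⊓ b)           ≡⟨ cong (M *_) (sym e) ⟩
      M * g a b             ≤⟨ *-monoʳ-≤ M (m≤m+n _ W) ⟩
      M * (g a b + W)       ∎
    where open ≤-Reasoning
  ... | inj₂ e = begin
      2 * k * (a ⊓ b)       ≡⟨ e₁ k (a ⊓ b) ⟩
      k * (a ⊓ b + a ⊓ b)   ≤⟨ *-monoʳ-≤ k (+-mono-≤ (m⊓n≤m a b) (m⊓n≤n a b)) ⟩
      k * (a + b)           ≤⟨ *-monoʳ-≤ k (m≤n+m∸n (a + b) W) ⟩
      k * (W + (a + b ∸ W)) ≡⟨ *-distribˡ-+ k W _ ⟩
      k * W + q             ≡⟨ cong (k * W +_) (m≡m%n+[m/n]*n q M) ⟩
      k * W + (q % M + q / M * M) ≤⟨ +-monoʳ-≤ (k * W) (+-monoˡ-≤ (q / M * M) (m%n≤n q M)) ⟩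
      k * W + (M + q / M * M)     ≡⟨ cong (λ z → k * W + (M + z * M)) (sym e) ⟩
      k * W + (M + g a b * M)     ≡⟨ e₂ (k * W) M (g a b) ⟩
      M * g a b + (k * W + M)     ≤⟨ +-monoʳ-≤ (M * g a b) le ⟩
      M * g a b + M * W           ≡⟨ sym (*-distribˡ-+ M (g a b) W) ⟩
      M * (g a b + W)       ∎
    where
    open ≤-Reasoning
    q = k * (a + b ∸ W)
    e₁ : ∀ k m → 2 * k * m ≡ k * (m + m)
    e₁ = solve-∀
    e₂ : ∀ x m y → x + (m + y * m) ≡ m * y + (x + m)
    e₂ = solve-∀
    le : k * W + M ≤ M * W
    le = *-cancelˡ-≤ 2 (begin
      2 * (k * W + M)       ≡⟨ e₃ k W ⟩
      2 * k * W + M * 2     ≤⟨ +-mono-≤ (*-monoˡ-≤ W (n≤1+n (2 * k))) (*-monoʳ-≤ M 2≤W) ⟩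
      M * W + M * W         ≡⟨ e₄ (M * W) ⟩
      2 * (M * W) ∎)
      where
      e₃ : ∀ k W → 2 * (k * W + suc (2 * k)) ≡ 2 * k * W + suc (2 * k) * 2
      e₃ = solve-∀
      e₄ : ∀ x → x + x ≡ 2 * x
      e₄ = solve-∀

-- Private maps and their zippers.

-- A robot's private map of the unfinished part of the tree: a leaf is a node the robot has not yet
-- examined, nd w F a node with bonus w whose unfinished children are listed in F with their ports.
-- CtxT and CtxF are the contexts of the corresponding zipper.
data MapT : Set
data MapF : Set

data MapT where
  leaf : MapT
  nd   : ℕ → MapF → MapT

data MapF where
  one  : ℕ → MapT → MapF
  more : ℕ → MapT → MapF → MapF

data CtxT : Set
data CtxF : Set

data CtxT where
  top    : CtxT
  inOne  : ℕ → CtxF → CtxT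
  inMore : ℕ → MapF → CtxF → CtxT

data CtxF where
  inNd   : ℕ → CtxT → CtxF
  inTail : ℕ → MapT → CtxF → CtxF

plugT : CtxT → MapT → MapT
plugF : CtxF → MapF → MapT
plugT top s = s
plugT (inOne i c) s = plugF c (one i s)
plugT (inMore i F c) s = plugF c (more i s F)
plugF (inNd w c) F = plugT c (nd w F)
plugF (inTail j t c) F = plugF c (more j t F)

ports : MapF → List ℕ
ports (one i t) = i ∷ []
ports (more i t F) = i ∷ ports F

-- Children are read as a chain of binary forks, each setting the first branch against the rest.
forks : MapF → ℕ
forks (one i t) = 0
forks (more i t F) = suc (forks F)

len-ports : ∀ F → length (ports F) ≡ suc (forks F)
len-ports (one i t) = refl
len-ports (more i t F) = cong suc (len-ports F)

addrT : CtxT → Address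
addrF : CtxF → Address
addrT top = []
addrT (inOne i c) = addrF c ++ [ i ]
addrT (inMore i F c) = addrF c ++ [ i ]
addrF (inNd w c) = addrT c
addrF (inTail j t c) = addrF c

-- The number of branches hanging off the path from the root to the hole, i.e. of forks still open.
sibT : CtxT → ℕ
sibF : CtxF → ℕ → ℕ
sibT top = 0
sibT (inOne i c) = sibF c 0
sibT (inMore i F c) = sibF c (suc (forks F))
sibF (inNd w c) n = sibT c + n
sibF (inTail j t c) n = sibF c (suc n)

closeC : CtxF → CtxT
closeC (inNd w c) = c
closeC (inTail j t c) = closeC c

closeL : CtxF → MapF → MapF
closeL (inNd w c) F = F
closeL (inTail j t c) F = closeL c (more j t F)

closeW : CtxF → ℕ
closeW (inNd w c) = w
closeW (inTail j t c) = closeW c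

closeT : CtxF → MapF → MapT
closeT c F = nd (closeW c) (closeL c F)

plug-close : ∀ c F → plugT (closeC c) (closeT c F) ≡ plugF c F
plug-close (inNd w c) F = refl
plug-close (inTail j t c) F = plug-close c (more j t F)

addr-close : ∀ c → addrT (closeC c) ≡ addrF c
addr-close (inNd w c) = refl
addr-close (inTail j t c) = addr-close c

upC : CtxT → CtxT
upC top = top
upC (inOne i c) = closeC c
upC (inMore i F c) = closeC c

upS : CtxT → MapT → MapT
upS top s = s
upS (inOne i c) s = closeT c (one i s)
upS (inMore i F c) s = closeT c (more i s F)

plug-up : ∀ c s → plugT (upC c) (upS c s) ≡ plugT c s
plug-up top s = refl
plug-up (inOne i c) s = plug-close c (one i s)
plug-up (inMore i F c) s = plug-close c (more i s F)

edgesT : MapT → ℕ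
edgesF : MapF → ℕ
edgesT leaf = 0
edgesT (nd w F) = edgesF F
edgesF (one i t) = suc (edgesT t)
edgesF (more i t F) = suc (edgesT t + edgesF F)

-- Each edge weighs m plus the number of siblings of the edges up to and including itself, so that removing a branch
-- releases at least one unit for every edge that remains beside it.
loadT : ℕ → MapT → ℕ
loadF : ℕ → MapF → ℕ
loadT m leaf = 0
loadT m (nd w F) = loadF (m + forks F) F
loadF m (one i t) = m + loadT m t
loadF m (more i t F) = m + loadT m t + loadF m F

Qd-suc : ∀ m t → loadT (suc m) t ≡ loadT m t + edgesT t
QF-suc : ∀ m F → loadF (suc m) F ≡ loadF m F + edgesF F
Qd-suc m leaf = refl
Qd-suc m (nd w F) = QF-suc (m + forks F) F
QF-suc m (one i t) = trans (cong (suc m +_) (Qd-suc m t)) (e m (loadT m t) (edgesT t))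
  where e : ∀ m q x → suc m + (q + x) ≡ m + q + suc x
        e = solve-∀
QF-suc m (more i t F) = trans (cong₂ (λ x y → suc m + x + y) (Qd-suc m t) (QF-suc m F)) (e m (loadT m t) (edgesT t) (loadF m F) (edgesF F))
  where e : ∀ m q x r y → suc m + (q + x) + (r + y) ≡ m + q + r + suc (x + y)
        e = solve-∀

-- The edges outside the hole weigh the same for either filling. In `QdF-diff` this needs equal
-- numbers of forks, as these enter the weights of the sibling edges too. The additive form avoids
-- truncated subtraction.
QdT-diff : ∀ m c s s′ → loadT m (plugT c s) + loadT (m + sibT c) s′ ≡ loadT m (plugT c s′) + loadT (m + sibT c) s
QdF-diff : ∀ m c F F′ → forks F ≡ forks F′ →
  loadT m (plugF c F) + loadF (m + sibF c (forks F)) F′ ≡ loadT m (plugF c F′) + loadF (m + sibF c (forks F)) F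
QdT-diff m top s s′ rewrite +-identityʳ m = +-comm (loadT m s) (loadT m s′)
QdT-diff m (inOne i c) s s′ = +-cancelʳ-≡ x _ _ (begin
    loadT m (plugF c (one i s)) + loadT x s′ + x   ≡⟨ e (loadT m (plugF c (one i s))) (loadT x s′) x ⟩
    loadT m (plugF c (one i s)) + (x + loadT x s′) ≡⟨ QdF-diff m c (one i s) (one i s′) refl ⟩
    loadT m (plugF c (one i s′)) + (x + loadT x s) ≡⟨ sym (e (loadT m (plugF c (one i s′))) (loadT x s) x) ⟩
    loadT m (plugF c (one i s′)) + loadT x s + x   ∎)
  where
  open ≡-Reasoning
  x = m + sibF c 0
  e : ∀ a b x → a + b + x ≡ a + (x + b)
  e = solve-∀
QdT-diff m (inMore i F c) s s′ = +-cancelʳ-≡ (x + loadF x F) _ _ (begin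
    loadT m (plugF c (more i s F)) + loadT x s′ + (x + loadF x F)   ≡⟨ e (loadT m (plugF c (more i s F))) (loadT x s′) x (loadF x F) ⟩
    loadT m (plugF c (more i s F)) + (x + loadT x s′ + loadF x F) ≡⟨ QdF-diff m c (more i s F) (more i s′ F) refl ⟩
    loadT m (plugF c (more i s′ F)) + (x + loadT x s + loadF x F) ≡⟨ sym (e (loadT m (plugF c (more i s′ F))) (loadT x s) x (loadF x F)) ⟩
    loadT m (plugF c (more i s′ F)) + loadT x s + (x + loadF x F)   ∎)
  where
  open ≡-Reasoning
  x = m + sibF c (suc (forks F))
  e : ∀ a b x y → a + b + (x + y) ≡ a + (x + b + y)
  e = solve-∀
QdF-diff m (inNd w c) F F′ eq = begin
    loadT m (plugT c (nd w F)) + loadF (m + (sibT c + forks F)) F′ ≡⟨ cong (λ z → loadT m (plugT c (nd w F)) + loadF z F′) (trans (sym (+-assoc m (sibT c) (forks F))) (cong (m + sibT c +_) eq)) ⟩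
    loadT m (plugT c (nd w F)) + loadF (m + sibT c + forks F′) F′ ≡⟨ QdT-diff m c (nd w F) (nd w F′) ⟩
    loadT m (plugT c (nd w F′)) + loadF (m + sibT c + forks F) F ≡⟨ cong (λ z → loadT m (plugT c (nd w F′)) + loadF z F) (+-assoc m (sibT c) (forks F)) ⟩
    loadT m (plugT c (nd w F′)) + loadF (m + (sibT c + forks F)) F ∎
  where open ≡-Reasoning
QdF-diff m (inTail j t c) F F′ eq = +-cancelʳ-≡ (x + loadT x t) _ _ (begin
    loadT m (plugF c (more j t F)) + loadF x F′ + (x + loadT x t)   ≡⟨ e (loadT m (plugF c (more j t F))) (loadF x F′) (x + loadT x t) ⟩
    loadT m (plugF c (more j t F)) + (x + loadT x t + loadF x F′) ≡⟨ QdF-diff m c (more j t F) (more j t F′) (cong suc eq) ⟩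
    loadT m (plugF c (more j t F′)) + (x + loadT x t + loadF x F) ≡⟨ sym (e (loadT m (plugF c (more j t F′))) (loadF x F) (x + loadT x t)) ⟩
    loadT m (plugF c (more j t F′)) + loadF x F + (x + loadT x t)   ∎)
  where
  open ≡-Reasoning
  x = m + sibF c (suc (forks F))
  e : ∀ a b x → a + b + x ≡ a + (x + b)
  e = solve-∀

-- Child lists are never empty, so taking away the final entry needs its own constructor `last`, and
-- an only branch cannot be removed.
data Removal : MapF → ℕ → MapF → Set where
  hd   : ∀ {i t R} → Removal (more i t R) i R
  last : ∀ {j t i s} → Removal (more j t (one i s)) i (one j t)
  tl   : ∀ {j t R i R′} → Removal R i R′ → Removal (more j t R) i (more j t R′)

fk-Rem : ∀ {F i F′} → Removal F i F′ → forks F ≡ suc (forks F′)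
fk-Rem hd = refl
fk-Rem last = refl
fk-Rem (tl r) = cong suc (fk-Rem r)

-- Passing from `suc m` to `m` releases one unit for each remaining edge, by `QF-suc`, and the
-- removed edge itself releases `m` more.
QF-Rem : ∀ m {F i F′} → Removal F i F′ → loadF m F′ + edgesF F′ + m ≤ loadF (suc m) F
QF-Rem m (hd {i} {t} {R}) = begin
  loadF m R + edgesF R + m                  ≡⟨ cong (_+ m) (sym (QF-suc m R)) ⟩
  loadF (suc m) R + m                    ≤⟨ lin (suc (loadT (suc m) t)) (≤-refl {0}) (e (loadF (suc m) R) m (loadT (suc m) t)) ⟩
  suc m + loadT (suc m) t + loadF (suc m) R ∎
  where
  open ≤-Reasoning
  e : ∀ r m q → r + m + 0 + suc q ≡ suc m + q + r + 0
  e = solve-∀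
QF-Rem m (last {j} {t} {i} {s}) = begin
  m + loadT m t + suc (edgesT t) + m ≤⟨ lin (suc (loadT (suc m) s)) (≤-refl {0}) (e m (loadT m t) (edgesT t) (loadT (suc m) s)) ⟩
  suc m + (loadT m t + edgesT t) + (suc m + loadT (suc m) s) ≡⟨ cong (λ z → suc m + z + (suc m + loadT (suc m) s)) (sym (Qd-suc m t)) ⟩
  suc m + loadT (suc m) t + (suc m + loadT (suc m) s) ∎
  where
  open ≤-Reasoning
  e : ∀ m q x y → m + q + suc x + m + 0 + suc y ≡ suc m + (q + x) + (suc m + y) + 0
  e = solve-∀
QF-Rem m (tl {j} {t} {R} {i} {R′} r) = begin
  m + loadT m t + loadF m R′ + suc (edgesT t + edgesF R′) + m ≤⟨ lin 0 (QF-Rem m r) (e m (loadT m t) (loadF m R′) (edgesT t) (edgesF R′) (loadF (suc m) R)) ⟩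
  suc m + (loadT m t + edgesT t) + loadF (suc m) R ≡⟨ cong (λ z → suc m + z + loadF (suc m) R) (sym (Qd-suc m t)) ⟩
  suc m + loadT (suc m) t + loadF (suc m) R ∎
  where
  open ≤-Reasoning
  e : ∀ m q r x y z → m + q + r + suc (x + y) + m + z + 0 ≡ suc m + (q + x) + z + (r + y + m)
  e = solve-∀

-- N a n ps is required of every node of the map with address a, child ports ps and n open forks above it.
module Good (N : Address → ℕ → List ℕ → Set) where

  GoodT : Address → ℕ → MapT → Set
  GoodF : Address → ℕ → MapF → Set
  GoodT a n leaf = ⊤
  GoodT a n (nd w F) = N a n (ports F) × GoodF a (n + forks F) F
  GoodF a n (one i t) = GoodT (a ++ [ i ]) n t
  GoodF a n (more i t F) = GoodT (a ++ [ i ]) n t × GoodF a n F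

  Gd-in : ∀ c s → GoodT [] 0 (plugT c s) → GoodT (addrT c) (sibT c) s
  GF-in : ∀ c F → GoodT [] 0 (plugF c F) → GoodF (addrF c) (sibF c (forks F)) F
  Gd-in top s h = h
  Gd-in (inOne i c) s h = GF-in c (one i s) h
  Gd-in (inMore i F c) s h = proj₁ (GF-in c (more i s F) h)
  GF-in (inNd w c) F h = proj₂ (Gd-in c (nd w F) h)
  GF-in (inTail j t c) F h = proj₂ (GF-in c (more j t F) h)

  Gd-re : ∀ c s s′ → GoodT [] 0 (plugT c s) → GoodT (addrT c) (sibT c) s′ → GoodT [] 0 (plugT c s′)
  GF-re : ∀ c F F′ → ports F ≡ ports F′ → forks F ≡ forks F′ → GoodT [] 0 (plugF c F) →
          GoodF (addrF c) (sibF c (forks F)) F′ → GoodT [] 0 (plugF c F′)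
  Gd-re top s s′ h h′ = h′
  Gd-re (inOne i c) s s′ h h′ = GF-re c (one i s) (one i s′) refl refl h h′
  Gd-re (inMore i F c) s s′ h h′ =
    GF-re c (more i s F) (more i s′ F) refl refl h (h′ , proj₂ (GF-in c (more i s F) h))
  GF-re (inNd w c) F F′ pe fe h h′ = Gd-re c (nd w F) (nd w F′) h
    (subst (N (addrT c) (sibT c)) pe (proj₁ (Gd-in c (nd w F) h)) , subst (λ z → GoodF (addrT c) (sibT c + z) F′) fe h′)
  GF-re (inTail j t c) F F′ pe fe h h′ = GF-re c (more j t F) (more j t F′) (cong (j ∷_) pe) (cong suc fe) h
    (proj₁ (GF-in c (more j t F) h) , h′)

-- Value and potential of a map, and the length of greedy paths.

module Pot (k : ℕ) .{{_ : NonZero k}} (W : ℕ) (2≤W : 2 ≤ W) where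

  open Fork k W (≤-trans (s≤s z≤n) 2≤W) public

  -- The bonus w makes up for the value that is lost when a leaf turns into a fork: see fresh.
  V : MapT → ℕ
  VF : MapF → ℕ
  V leaf = W
  V (nd w F) = W + (w ⊓ W) + VF F
  VF (one i t) = V t
  VF (more i t F) = g (V t) (VF F)

  -- The potential of the part of the map that the robot is not in; potT below is that of the context it is in.
  P : MapT → ℕ
  PF : MapF → ℕ
  P leaf = 0
  P (nd w F) = PF F
  PF (one i t) = P t
  PF (more i t F) = P t + PF F + (off (V t) (VF F) ∸ g (V t) (VF F))

  -- The length of the path that always enters the less valuable branch.
  greedyT : MapT → ℕ
  greedyF : MapF → ℕ
  greedyT leaf = 0
  greedyT (nd w F) = greedyF F
  greedyF (one i t) = suc (greedyT t)
  greedyF (more i t F) = if V t ≤ᵇ VF F then suc (greedyT t) else greedyF F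

  valT : CtxT → ℕ → ℕ
  valF : CtxF → ℕ → ℕ
  valT top v = v
  valT (inOne i c) v = valF c v
  valT (inMore i F c) v = valF c (g v (VF F))
  valF (inNd w c) v = valT c (W + (w ⊓ W) + v)
  valF (inTail j t c) v = valF c (g (V t) v)

  potT : CtxT → ℕ → ℕ
  potF : CtxF → ℕ → ℕ
  potT top v = 0
  potT (inOne i c) v = potF c v
  potT (inMore i F c) v = PF F + (on v (VF F) ∸ g v (VF F)) + potF c (g v (VF F))
  potF (inNd w c) v = potT c (W + (w ⊓ W) + v)
  potF (inTail j t c) v = P t + (on v (V t) ∸ g (V t) v) + potF c (g (V t) v)

  -- The robot should leave its position: it is in the too valuable branch of some fork on its path.
  exhT : CtxT → ℕ → Bool
  exhF : CtxF → ℕ → Bool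
  exhT top v = false
  exhT (inOne i c) v = exhF c v
  exhT (inMore i F c) v = over v (VF F) ∨ exhF c (g v (VF F))
  exhF (inNd w c) v = exhT c (W + (w ⊓ W) + v)
  exhF (inTail j t c) v = over v (V t) ∨ exhF c (g (V t) v)

  -- Only the binary forks through which the path itself runs: a hole in the first branch of a
  -- `more` passes one fork, however many siblings follow. Each of these damps a gain, while `sibT`
  -- counts all siblings.
  forT : CtxT → ℕ
  forF : CtxF → ℕ
  forT top = 0
  forT (inOne i c) = forF c
  forT (inMore i F c) = suc (forF c)
  forF (inNd w c) = forT c
  forF (inTail j t c) = suc (forF c)

  val-plug : ∀ c s → V (plugT c s) ≡ valT c (V s)
  valF-plug : ∀ c F → V (plugF c F) ≡ valF c (VF F)
  val-plug top s = refl
  val-plug (inOne i c) s = valF-plug c (one i s)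
  val-plug (inMore i F c) s = valF-plug c (more i s F)
  valF-plug (inNd w c) F = val-plug c (nd w F)
  valF-plug (inTail j t c) F = valF-plug c (more j t F)

  forT≤sib : ∀ c → forT c ≤ sibT c
  forF≤sib : ∀ c n → n + forF c ≤ sibF c n
  forT≤sib top = z≤n
  forT≤sib (inOne i c) = forF≤sib c 0
  forT≤sib (inMore i F c) = ≤-trans (s≤s (m≤n+m (forF c) (forks F))) (forF≤sib c (suc (forks F)))
  forF≤sib (inNd w c) n = ≤-trans (≤-reflexive (+-comm n (forT c))) (+-monoˡ-≤ n (forT≤sib c))
  forF≤sib (inTail j t c) n = ≤-trans (≤-reflexive (+-suc n (forF c))) (forF≤sib c (suc n))

  W≤V : ∀ t → W ≤ V t
  W≤V leaf = ≤-refl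
  W≤V (nd w F) = ≤-trans (m≤m+n W (w ⊓ W)) (m≤m+n _ (VF F))

  -- Converts a loss proportional to a value into one proportional to the edges, which the load can
  -- pay.
  V-ed : ∀ t → V t ≤ W + 2 * W * edgesT t
  VF-ed : ∀ F → VF F + W ≤ 2 * W * edgesF F
  V-ed leaf = m≤m+n W _
  V-ed (nd w F) = begin
    W + (w ⊓ W) + VF F   ≤⟨ +-monoˡ-≤ (VF F) (+-monoʳ-≤ W (m⊓n≤n w W)) ⟩
    W + W + VF F         ≡⟨ e W (VF F) ⟩
    W + (VF F + W)       ≤⟨ +-monoʳ-≤ W (VF-ed F) ⟩
    W + 2 * W * edgesF F    ∎
    where
    open ≤-Reasoning
    e : ∀ w x → w + w + x ≡ w + (x + w)
    e = solve-∀
  VF-ed (one i t) = ≤-trans (+-monoˡ-≤ W (V-ed t)) (≤-reflexive (e W (edgesT t)))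
    where e : ∀ w x → w + 2 * w * x + w ≡ 2 * w * suc x
          e = solve-∀
  VF-ed (more i t F) = begin
    g (V t) (VF F) + W            ≤⟨ +-monoˡ-≤ W (g≤ˡ (V t) (VF F)) ⟩
    V t + W                       ≤⟨ +-monoˡ-≤ W (V-ed t) ⟩
    W + 2 * W * edgesT t + W         ≡⟨ e W (edgesT t) ⟩
    2 * W * suc (edgesT t)           ≤⟨ *-monoʳ-≤ (2 * W) (s≤s (m≤m+n (edgesT t) (edgesF F))) ⟩
    2 * W * suc (edgesT t + edgesF F)   ∎
    where
    open ≤-Reasoning
    e : ∀ w x → w + 2 * w * x + w ≡ 2 * w * suc x
    e = solve-∀

  lam≤edT : ∀ t → greedyT t ≤ edgesT t
  lam≤edF : ∀ F → greedyF F ≤ edgesF F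
  lam≤edT leaf = z≤n
  lam≤edT (nd w F) = lam≤edF F
  lam≤edF (one i t) = s≤s (lam≤edT t)
  lam≤edF (more i t F) with V t ≤ᵇ VF F
  ... | true = s≤s (≤-trans (lam≤edT t) (m≤m+n _ (edgesF F)))
  ... | false = ≤-trans (lam≤edF F) (≤-trans (m≤n+m (edgesF F) (edgesT t)) (n≤1+n _))

  val-mono : ∀ c {v v′} → v ≤ v′ → valT c v ≤ valT c v′
  valF-mono : ∀ c {v v′} → v ≤ v′ → valF c v ≤ valF c v′
  val-mono top le = le
  val-mono (inOne i c) le = valF-mono c le
  val-mono (inMore i F c) le = valF-mono c (g-mono le ≤-refl)
  valF-mono (inNd w c) le = val-mono c (+-monoʳ-≤ (W + (w ⊓ W)) le)
  valF-mono (inTail j t c) le = valF-mono c (g-mono ≤-refl le)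

  on-lip₂ : ∀ {v v′} a → v ≤ v′ → on v′ a + v ≤ on v a + v′
  on-lip₂ {v} {v′} a le = begin
    on v′ a + v              ≡⟨ cong (λ z → on z a + v) (sym (m+[n∸m]≡n le)) ⟩
    on (v + (v′ ∸ v)) a + v  ≤⟨ +-monoˡ-≤ v (on-lip v (v′ ∸ v) a) ⟩
    on v a + (v′ ∸ v) + v    ≡⟨ +-assoc (on v a) (v′ ∸ v) v ⟩
    on v a + (v′ ∸ v + v)    ≡⟨ cong (on v a +_) (m∸n+n≡m le) ⟩
    on v a + v′              ∎
    where open ≤-Reasoning

  fork-step : ∀ {o o′ x x′ G G′ p p′ l l′ v v′} q → x + G ≡ o → x′ + G′ ≡ o′ →
    o′ + v ≤ o + v′ → p′ + l′ + G ≤ p + l + G′ → q + x′ + p′ + l′ + v ≤ q + x + p + l + v′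
  fork-step {x = x} {x′} {G} {G′} {p} {p′} {l} {l′} {v} {v′} q refl refl h₁ h₂ =
    lin 0 (+-mono-≤ h₁ h₂) (e q x x′ G G′ p p′ l l′ v v′)
    where
    e : ∀ q x x′ G G′ p p′ l l′ v v′ →
      q + x′ + p′ + l′ + v + (x + G + v′ + (p + l + G′)) + 0 ≡ q + x + p + l + v′ + (x′ + G′ + v + (p′ + l′ + G))
    e = solve-∀

  -- Potential and value are added because the sum telescopes along the path: a fork contributes
  -- `on` minus `g`, and this `g` is the argument passed on to the next fork. What remains at each
  -- fork is that `on` is 1-Lipschitz.
  pot-lip : ∀ c {v v′} → v ≤ v′ → potT c v′ + valT c v′ + v ≤ potT c v + valT c v + v′
  potF-lip : ∀ c {v v′} → v ≤ v′ → potF c v′ + valF c v′ + v ≤ potF c v + valF c v + v′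
  pot-lip top {v} {v′} le = ≤-reflexive (+-comm v′ v)
  pot-lip (inOne i c) le = potF-lip c le
  pot-lip (inMore i F c) {v} {v′} le = fork-step (PF F) (m∸n+n≡m (g≤on v (VF F))) (m∸n+n≡m (g≤on v′ (VF F)))
    (on-lip₂ (VF F) le) (potF-lip c (g-mono le ≤-refl))
  potF-lip (inNd w c) {v} {v′} le = lin 0 (pot-lip c (+-monoʳ-≤ (W + (w ⊓ W)) le))
    (e (potT c (W + (w ⊓ W) + v′)) (valT c (W + (w ⊓ W) + v′)) (potT c (W + (w ⊓ W) + v)) (valT c (W + (w ⊓ W) + v)) (W + (w ⊓ W)) v v′)
    where
    e : ∀ p′ l′ p l b v v′ → p′ + l′ + v + (p + l + (b + v′)) + 0 ≡ p + l + v′ + (p′ + l′ + (b + v))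
    e = solve-∀
  potF-lip (inTail j t c) {v} {v′} le = fork-step (P t)
    (m∸n+n≡m (subst (_≤ on v (V t)) (g-comm v (V t)) (g≤on v (V t))))
    (m∸n+n≡m (subst (_≤ on v′ (V t)) (g-comm v′ (V t)) (g≤on v′ (V t))))
    (on-lip₂ (V t) le) (potF-lip c (g-mono ≤-refl le))

  pot-lip′ : ∀ c {v v′} → v ≤ v′ → potT c v′ + v ≤ potT c v + v′
  pot-lip′ c {v} {v′} le = lin 0 (+-mono-≤ (pot-lip c le) (val-mono c le))
    (e (potT c v′) (valT c v′) (potT c v) (valT c v) v v′)
    where
    e : ∀ p′ l′ p l v v′ → p′ + v + (p + l + v′ + l′) + 0 ≡ p + v′ + (p′ + l′ + v + l)
    e = solve-∀

  VF-Rem : ∀ {F i F′} → Removal F i F′ → VF F ≤ VF F′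
  VF-Rem hd = g≤ʳ _ _
  VF-Rem last = g≤ˡ _ _
  VF-Rem (tl r) = g-mono ≤-refl (VF-Rem r)

  -- In the sum `PF + VF` of a `more` the value `g` cancels and `off` is left. Then `off-slack`
  -- bounds the rise where the branch disappears, `VF-ed` turns the value into edges, and `off-lip′`
  -- carries the rise through the forks before it.
  PF-Rem : ∀ {F i F′} → Removal F i F′ → k * (PF F′ + VF F′) ≤ k * (PF F + VF F) + 2 * W * edgesF F′ + k * W
  PF-Rem (hd {i} {t} {R}) = begin
    k * (PF R + VF R)  ≡⟨ *-distribˡ-+ k (PF R) (VF R) ⟩
    k * PF R + k * VF R ≤⟨ +-monoʳ-≤ (k * PF R) (off-slack (V t) (VF R)) ⟩
    k * PF R + (k * off (V t) (VF R) + VF R + k * W) ≤⟨ +-monoʳ-≤ (k * PF R) (+-monoˡ-≤ (k * W) (+-monoʳ-≤ (k * off (V t) (VF R)) (≤-trans (m≤m+n (VF R) W) (VF-ed R)))) ⟩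
    k * PF R + (k * off (V t) (VF R) + 2 * W * edgesF R + k * W) ≤⟨ lin (k * P t) (≤-refl {0}) (e k (PF R) (P t) (off (V t) (VF R)) (2 * W * edgesF R) (k * W)) ⟩
    k * (P t + PF R + off (V t) (VF R)) + 2 * W * edgesF R + k * W ≡⟨ cong (λ z → k * z + 2 * W * edgesF R + k * W) (trans (cong (P t + PF R +_) (sym (m∸n+n≡m (g≤off (V t) (VF R))))) (sym (+-assoc (P t + PF R) _ _))) ⟩
    k * (P t + PF R + (off (V t) (VF R) ∸ g (V t) (VF R)) + g (V t) (VF R)) + 2 * W * edgesF R + k * W ∎
    where
    open ≤-Reasoning
    e : ∀ k r p o x y → k * r + (k * o + x + y) + 0 + k * p ≡ k * (p + r + o) + x + y + 0
    e = solve-∀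
  PF-Rem (last {j} {t} {i} {s}) = begin
    k * (P t + V t)  ≡⟨ *-distribˡ-+ k (P t) (V t) ⟩
    k * P t + k * V t ≤⟨ +-monoʳ-≤ (k * P t) (off-slack (V s) (V t)) ⟩
    k * P t + (k * off (V s) (V t) + V t + k * W) ≤⟨ +-monoʳ-≤ (k * P t) (+-monoˡ-≤ (k * W) (+-monoʳ-≤ (k * off (V s) (V t)) (≤-trans (m≤m+n (V t) W) (VF-ed (one j t))))) ⟩
    k * P t + (k * off (V s) (V t) + 2 * W * suc (edgesT t) + k * W) ≡⟨ cong (λ z → k * P t + (k * z + 2 * W * suc (edgesT t) + k * W)) (off-comm (V s) (V t)) ⟩
    k * P t + (k * off (V t) (V s) + 2 * W * suc (edgesT t) + k * W) ≤⟨ lin (k * P s) (≤-refl {0}) (e k (P s) (P t) (off (V t) (V s)) (2 * W * suc (edgesT t)) (k * W)) ⟩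
    k * (P t + P s + off (V t) (V s)) + 2 * W * suc (edgesT t) + k * W ≡⟨ cong (λ z → k * z + 2 * W * suc (edgesT t) + k * W) (trans (cong (P t + P s +_) (sym (m∸n+n≡m (g≤off (V t) (V s))))) (sym (+-assoc (P t + P s) _ _))) ⟩
    k * (P t + P s + (off (V t) (V s) ∸ g (V t) (V s)) + g (V t) (V s)) + 2 * W * suc (edgesT t) + k * W ∎
    where
    open ≤-Reasoning
    e : ∀ k s p o x y → k * p + (k * o + x + y) + 0 + k * s ≡ k * (p + s + o) + x + y + 0
    e = solve-∀
  PF-Rem (tl {j} {t} {R} {i} {R′} r) = subst₂ (λ z z′ → k * z′ ≤ k * z + 2 * W * edgesF (more j t R′) + k * W) (eq R) (eq R′)
    (lin (2 * W * suc (edgesT t)) (+-mono-≤ (PF-Rem r) (*-monoʳ-≤ k off≤)) (e k (P t) (PF R) (PF R′) (VF R) (VF R′) (off (V t) (VF R)) (off (V t) (VF R′)) (2 * W) (edgesT t) (edgesF R′) (k * W)))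
    where
    eq : ∀ R → P t + PF R + off (V t) (VF R) ≡ PF (more j t R) + VF (more j t R)
    eq R = trans (cong (P t + PF R +_) (sym (m∸n+n≡m (g≤off (V t) (VF R))))) (sym (+-assoc (P t + PF R) _ _))
    off≤ : off (V t) (VF R′) + VF R ≤ off (V t) (VF R) + VF R′
    off≤ = begin
      off (V t) (VF R′) + VF R                     ≡⟨ cong (λ z → off (V t) z + VF R) (sym (m+[n∸m]≡n (VF-Rem r))) ⟩
      off (V t) (VF R + (VF R′ ∸ VF R)) + VF R     ≤⟨ +-monoˡ-≤ (VF R) (off-lip′ (V t) (VF R) (VF R′ ∸ VF R)) ⟩
      off (V t) (VF R) + (VF R′ ∸ VF R) + VF R     ≡⟨ +-assoc (off (V t) (VF R)) _ _ ⟩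
      off (V t) (VF R) + (VF R′ ∸ VF R + VF R)     ≡⟨ cong (off (V t) (VF R) +_) (m∸n+n≡m (VF-Rem r)) ⟩
      off (V t) (VF R) + VF R′                     ∎
      where open ≤-Reasoning
    e : ∀ k t r r′ v v′ o o′ w x y z →
      k * (t + r′ + o′) + (k * (r + v) + w * y + z + k * (o + v′)) + w * suc x ≡
      k * (t + r + o) + w * suc (x + y) + z + (k * (r′ + v′) + k * (o′ + v))
    e = solve-∀

  Pt : CtxT → MapT → ℕ
  Pt c s = P s + potT c (V s)

  Pt-Rem : ∀ c w {F i F′} → Removal F i F′ → k * Pt c (nd w F′) ≤ k * Pt c (nd w F) + 2 * W * edgesF F′ + k * W
  Pt-Rem c w {F} {i} {F′} r = lin 0 (+-mono-≤ (PF-Rem r) (*-monoʳ-≤ k (pot-lip′ c (+-monoʳ-≤ (W + (w ⊓ W)) (VF-Rem r)))))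
    (e k (PF F) (PF F′) (VF F) (VF F′) (potT c (V (nd w F))) (potT c (V (nd w F′))) (W + (w ⊓ W)) (2 * W * edgesF F′) (k * W))
    where
    e : ∀ k p p′ v v′ q q′ b x y →
      k * (p′ + q′) + (k * (p + v) + x + y + k * (q + (b + v′))) + 0 ≡ k * (p + q) + x + y + (k * (p′ + v′) + k * (q′ + (b + v)))
    e = solve-∀

  -- A gain at the hole reaches the root damped by the factor k / M at each of the open forks.
  slopeT : ∀ c v v′ x z → x + (forT c + z) ≡ k → W ≡ M ^ k → exhT c v ≡ false → W ≤ v →
    v + k ^ x * M ^ (forT c + z) ≤ v′ → valT c v + k ^ (x + forT c) * M ^ z ≤ valT c v′
  slopeF : ∀ c v v′ x z → x + (forF c + z) ≡ k → W ≡ M ^ k → exhF c v ≡ false →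
    v + k ^ x * M ^ (forF c + z) ≤ v′ → valF c v + k ^ (x + forF c) * M ^ z ≤ valF c v′

  private
    shift : ∀ x n → k ^ x * M ^ suc n ≡ M * (k ^ x * M ^ n)
    shift x n = e (k ^ x) M (M ^ n)
      where e : ∀ a b c → a * (b * c) ≡ b * (a * c)
            e = solve-∀
    small : ∀ x y → x + y ≡ k → W ≡ M ^ k → k ^ x * M ^ y ≤ W
    small x y e eW = begin
      k ^ x * M ^ y ≤⟨ *-monoˡ-≤ (M ^ y) (^-monoˡ-≤ x (≤-trans (m≤m+n k (k + 0)) (n≤1+n (2 * k)))) ⟩
      M ^ x * M ^ y ≡⟨ sym (^-distribˡ-+-* M x y) ⟩
      M ^ (x + y)   ≡⟨ cong (M ^_) e ⟩
      M ^ k         ≡⟨ sym eW ⟩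
      W ∎
      where open ≤-Reasoning

  -- A fork exchanges one factor `M` of the gain for a factor `k`. As the exponents add up to `k`,
  -- the gain is divisible by `M` here and is at most `M ^ k = W`, as `g-slope` requires.
  fork-slope : ∀ h h′ a x n → x + suc n ≡ k → W ≡ M ^ k → over h a ≡ false → W ≤ h + a →
    h + k ^ x * M ^ suc n ≤ h′ → g h a + k ^ suc x * M ^ n ≤ g h′ a
  fork-slope h h′ a x n e eW nov W≤ h≤ = subst (λ z → g h a + z ≤ g h′ a) (sym (*-assoc k (k ^ x) (M ^ n)))
    (g-slope h h′ a (k ^ x * M ^ n) nov W≤ (subst (_≤ W) (shift x n) (small x (suc n) e eW)) (subst (λ z → h + z ≤ h′) (shift x n) h≤))

  slopeT top v v′ x z e eW nex W≤v le rewrite +-identityʳ x = le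
  slopeT (inOne i c) v v′ x z e eW nex W≤v le = slopeF c v v′ x z e eW nex le
  slopeT (inMore i F c) v v′ x z e eW nex W≤v le =
    subst (λ y → valF c (g v (VF F)) + k ^ y * M ^ z ≤ valF c (g v′ (VF F))) (sym (+-suc x (forF c)))
      (slopeF c (g v (VF F)) (g v′ (VF F)) (suc x) z (trans (sym (+-suc x (forF c + z))) e) eW (∨-false₂ (over v (VF F)) _ nex)
        (fork-slope v v′ (VF F) x (forF c + z) e eW (∨-false₁ (over v (VF F)) _ nex) (≤-trans W≤v (m≤m+n v (VF F))) le))
  slopeF (inNd w c) v v′ x z e eW nex le =
    slopeT c (W + (w ⊓ W) + v) (W + (w ⊓ W) + v′) x z e eW nex (≤-trans (m≤m+n W (w ⊓ W)) (m≤m+n _ v))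
      (≤-trans (≤-reflexive (+-assoc (W + (w ⊓ W)) v _)) (+-monoʳ-≤ (W + (w ⊓ W)) le))
  slopeF (inTail j t c) v v′ x z e eW nex le =
    subst (λ y → valF c (g (V t) v) + k ^ y * M ^ z ≤ valF c (g (V t) v′)) (sym (+-suc x (forF c)))
      (slopeF c (g (V t) v) (g (V t) v′) (suc x) z (trans (sym (+-suc x (forF c + z))) e) eW (∨-false₂ (over v (V t)) _ nex)
        (subst₂ (λ p q → p + k ^ suc x * M ^ (forF c + z) ≤ q) (g-comm v (V t)) (g-comm v′ (V t))
          (fork-slope v v′ (V t) x (forF c + z) e eW (∨-false₁ (over v (V t)) _ nex) (≤-trans (W≤V t) (m≤n+m (V t) v)) le)))

  -- The invariant of an induction along the greedy path: after r forks its length l is bounded by the value v up to the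
  -- factor (1 + 1/2k)^r ≤ 2.
  PathBound : ℕ → ℕ → ℕ → Set
  PathBound r l v = (2 * k) ^ r * (W * l) ≤ M ^ r * (v + r * W)

  Bd-fork : ∀ r l v v′ → 2 * k * v ≤ M * (v′ + W) → PathBound r l v → PathBound (suc r) l v′
  Bd-fork r l v v′ h b = begin
    2 * k * (2 * k) ^ r * (W * l)             ≡⟨ *-assoc (2 * k) ((2 * k) ^ r) (W * l) ⟩
    2 * k * ((2 * k) ^ r * (W * l))           ≤⟨ *-monoʳ-≤ (2 * k) b ⟩
    2 * k * (M ^ r * (v + r * W))             ≡⟨ e₁ (2 * k) (M ^ r) v (r * W) ⟩
    M ^ r * (2 * k * v + 2 * k * (r * W))     ≤⟨ *-monoʳ-≤ (M ^ r) (+-mono-≤ h (*-monoˡ-≤ (r * W) (n≤1+n (2 * k)))) ⟩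
    M ^ r * (M * (v′ + W) + M * (r * W))      ≡⟨ e₂ (M ^ r) M v′ W (r * W) ⟩
    M * M ^ r * (v′ + (W + r * W))            ∎
    where
    open ≤-Reasoning
    e₁ : ∀ a b c d → a * (b * (c + d)) ≡ b * (a * c + a * d)
    e₁ = solve-∀
    e₂ : ∀ p m v w x → p * (m * (v + w) + m * x) ≡ m * p * (v + (w + x))
    e₂ = solve-∀

  -- Supplies the forks that a path into the first branch bypasses, so that both choices at a `more`
  -- end with the same exponent.
  Bd-pad : ∀ n r l v → PathBound r l v → PathBound (n + r) l v
  Bd-pad zero r l v b = b
  Bd-pad (suc n) r l v b = Bd-fork (n + r) l v v (≤-trans (*-monoˡ-≤ v (n≤1+n (2 * k))) (*-monoʳ-≤ M (m≤m+n v W))) (Bd-pad n r l v b)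

  -- A node is worth at least `W` more than its child list, which pays for the edge leading to it.
  Bd-edge : ∀ r l v v′ → v + W ≤ v′ → PathBound r l v → PathBound r (suc l) v′
  Bd-edge r l v v′ le b = begin
    (2 * k) ^ r * (W * suc l)                    ≡⟨ e₁ ((2 * k) ^ r) W l ⟩
    (2 * k) ^ r * (W * l) + (2 * k) ^ r * W      ≤⟨ +-mono-≤ b (*-monoˡ-≤ W (^-monoˡ-≤ r (n≤1+n (2 * k)))) ⟩
    M ^ r * (v + r * W) + M ^ r * W              ≡⟨ e₂ (M ^ r) v (r * W) W ⟩
    M ^ r * (v + W + r * W)                      ≤⟨ *-monoʳ-≤ (M ^ r) (+-monoˡ-≤ (r * W) le) ⟩
    M ^ r * (v′ + r * W)                         ∎
    where
    open ≤-Reasoning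
    e₁ : ∀ a w l → a * (w * suc l) ≡ a * (w * l) + a * w
    e₁ = solve-∀
    e₂ : ∀ p v x w → p * (v + x) + p * w ≡ p * (v + w + x)
    e₂ = solve-∀

  Bd-final : ∀ r l v → r ≤ k → PathBound r l v → W * l ≤ 2 * v + 2 * k * W
  Bd-final r l v r≤k b = *-cancelˡ-≤ ((2 * k) ^ r) {{m^n≢0 (2 * k) r {{m*n≢0 2 k}}}} (begin
    (2 * k) ^ r * (W * l)                ≤⟨ b ⟩
    M ^ r * (v + r * W)                  ≤⟨ *-mono-≤ (pow-ratio k r r≤k) (+-monoʳ-≤ v (*-monoˡ-≤ W r≤k)) ⟩
    2 * (2 * k) ^ r * (v + k * W)        ≡⟨ e ((2 * k) ^ r) v k W ⟩
    (2 * k) ^ r * (2 * v + 2 * k * W)    ∎)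
    where
    open ≤-Reasoning
    e : ∀ p v k w → 2 * p * (v + k * w) ≡ p * (2 * v + 2 * k * w)
    e = solve-∀

  module Lam (N : Address → ℕ → List ℕ → Set) (capN : ∀ {a n ps} → N a n ps → n + length ps ≤ k) where
    open Good N

    -- Here `r` is the number of forks that may still follow after `n` open ones. Fixing it by
    -- `n + r ≡ k`, and not by the shape of `t`, makes the exponents agree across branches; the
    -- `suc` counts the edge into `t`.
    lamT-Bd : ∀ t a n r → n + r ≡ k → GoodT a n t → PathBound r (suc (greedyT t)) (V t)
    lamF-Bd : ∀ F a n r → n + r ≡ k → GoodF a n F → PathBound (forks F + r) (greedyF F) (VF F)
    lamT-Bd leaf a n r e h = Bd-edge r 0 0 W ≤-refl (≤-trans (≤-reflexive (trans (cong ((2 * k) ^ r *_) (*-zeroʳ W)) (*-zeroʳ ((2 * k) ^ r)))) z≤n)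
    lamT-Bd (nd w F) a n r e (h , hF) = Bd-edge r (greedyF F) (VF F) (V (nd w F))
      (≤-trans (≤-reflexive (+-comm (VF F) W)) (+-monoˡ-≤ (VF F) (m≤m+n W (w ⊓ W))))
      (subst (λ z → PathBound z (greedyF F) (VF F)) eq (lamF-Bd F a (n + forks F) (k ∸ (n + forks F)) (m+[n∸m]≡n le) hF))
      where
      le : n + forks F ≤ k
      le = ≤-trans (+-monoʳ-≤ n (≤-trans (n≤1+n (forks F)) (≤-reflexive (sym (len-ports F))))) (capN h)
      eq : forks F + (k ∸ (n + forks F)) ≡ r
      eq = +-cancelˡ-≡ n _ _ (trans (sym (+-assoc n (forks F) _)) (trans (m+[n∸m]≡n le) (sym e)))
    lamF-Bd (one i t) a n r e h = lamT-Bd t (a ++ [ i ]) n r e h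
    lamF-Bd (more i t F) a n r e (h , hF) with V t ≤ᵇ VF F in eq
    ... | true = Bd-fork (forks F + r) (suc (greedyT t)) (V t) (g (V t) (VF F))
            (subst (λ z → 2 * k * z ≤ M * (g (V t) (VF F) + W)) (m≤n⇒m⊓n≡m (≤ᵇ-true _ _ eq)) (min-bound (V t) (VF F) 2≤W))
            (Bd-pad (forks F) r (suc (greedyT t)) (V t) (lamT-Bd t (a ++ [ i ]) n r e h))
    ... | false = Bd-fork (forks F + r) (greedyF F) (VF F) (g (V t) (VF F))
            (subst (λ z → 2 * k * z ≤ M * (g (V t) (VF F) + W)) (m≥n⇒m⊓n≡n (≤ᵇ-false _ _ eq)) (min-bound (V t) (VF F) 2≤W))
            (lamF-Bd F a n r e hF)

    lam-bound : ∀ w F a n → GoodT a n (nd w F) → W * greedyF F ≤ 2 * VF F + 2 * k * W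
    lam-bound w F a n (h , hF) = Bd-final (forks F + (k ∸ (n + forks F))) (greedyF F) (VF F) r≤k
      (lamF-Bd F a (n + forks F) (k ∸ (n + forks F)) (m+[n∸m]≡n le) hF)
      where
      le : n + forks F ≤ k
      le = ≤-trans (+-monoʳ-≤ n (≤-trans (n≤1+n (forks F)) (≤-reflexive (sym (len-ports F))))) (capN h)
      r≤k : forks F + (k ∸ (n + forks F)) ≤ k
      r≤k = ≤-trans (m≤n+m _ n) (≤-reflexive (trans (sym (+-assoc n (forks F) _)) (m+[n∸m]≡n le)))

leaves : ℕ → List ℕ → MapF
leaves i [] = one i leaf
leaves i (j ∷ js) = more i leaf (leaves j js)

ports-leaves : ∀ i js → ports (leaves i js) ≡ i ∷ js
ports-leaves i [] = refl
ports-leaves i (j ∷ js) = cong (i ∷_) (ports-leaves j js)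

fk-leaves : ∀ i js → forks (leaves i js) ≡ length js
fk-leaves i [] = refl
fk-leaves i (j ∷ js) = cong suc (fk-leaves j js)

ed-leaves : ∀ i js → edgesF (leaves i js) ≡ suc (length js)
ed-leaves i [] = refl
ed-leaves i (j ∷ js) = cong suc (ed-leaves j js)

QF-leaves : ∀ m i js → loadF m (leaves i js) ≡ suc (length js) * m
QF-leaves m i [] = refl
QF-leaves m i (j ∷ js) = cong₂ _+_ (+-identityʳ m) (QF-leaves m j js)

n<2^n : ∀ n → suc n ≤ 2 ^ n
n<2^n zero = ≤-refl
n<2^n (suc n) = begin
  suc (suc n)          ≤⟨ s≤s (m≤n+m (suc n) n) ⟩
  suc n + suc n        ≤⟨ +-mono-≤ (n<2^n n) (n<2^n n) ⟩
  2 ^ n + 2 ^ n        ≡⟨ cong (2 ^ n +_) (sym (+-identityʳ (2 ^ n))) ⟩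
  2 * 2 ^ n            ∎
  where open ≤-Reasoning

^-distribʳ-* : ∀ n a b → (a * b) ^ n ≡ a ^ n * b ^ n
^-distribʳ-* zero a b = refl
^-distribʳ-* (suc n) a b = trans (cong (a * b *_) (^-distribʳ-* n a b)) (e a b (a ^ n) (b ^ n))
  where e : ∀ a b x y → a * b * (x * y) ≡ a * x * (b * y)
        e = solve-∀

-- What each change of a robot's map or position costs.

module Steps (k : ℕ) .{{_ : NonZero k}} (W : ℕ) (2≤W : 2 ≤ W) where

  open Pot k W 2≤W public

  1≤k : 1 ≤ k
  1≤k = n≢0⇒n>0 (≢-nonZero⁻¹ k)

  descF : CtxF → MapF → CtxT × MapT
  descF c (one i t) = inOne i c , t
  descF c (more i t F) = if V t ≤ᵇ VF F then (inMore i F c , t) else descF (inTail i t c) F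

  descC : CtxF → MapF → CtxT
  descC c F = proj₁ (descF c F)

  descS : CtxF → MapF → MapT
  descS c F = proj₂ (descF c F)

  desc-plug : ∀ c F → plugT (descC c F) (descS c F) ≡ plugF c F
  desc-plug c (one i t) = refl
  desc-plug c (more i t F) with V t ≤ᵇ VF F
  ... | true = refl
  ... | false = desc-plug (inTail i t c) F

  desc-addr : ∀ c F → Σ ℕ λ i → i ∈ ports F × addrT (descC c F) ≡ addrF c ++ [ i ]
  desc-addr c (one i t) = i , here refl , refl
  desc-addr c (more i t F) with V t ≤ᵇ VF F
  ... | true = i , here refl , refl
  ... | false = let (j , j∈ , e) = desc-addr (inTail i t c) F in j , there j∈ , e

  desc-lam : ∀ c F → greedyF F ≡ suc (greedyT (descS c F))
  desc-lam c (one i t) = refl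
  desc-lam c (more i t F) with V t ≤ᵇ VF F
  ... | true = refl
  ... | false = desc-lam (inTail i t c) F

  over-false : ∀ h a → h ≤ a → over h a ≡ false
  over-false h a h≤a with over h a in e
  ... | false = refl
  ... | true = ⊥-elim (<⇒≱ (<ᵇ-true (suc k * a) (k * h) e) (≤-trans (*-monoʳ-≤ k h≤a) (m≤n+m (k * a) a)))

  -- At each fork passed the lesser branch is taken, so none of these forks can be `over`.
  desc-ex : ∀ c F → exhF c (VF F) ≡ false → exhT (descC c F) (V (descS c F)) ≡ false
  desc-ex c (one i t) e = e
  desc-ex c (more i t F) e with V t ≤ᵇ VF F in le
  ... | true rewrite over-false (V t) (VF F) (≤ᵇ-true (V t) (VF F) le) = e
  ... | false = desc-ex (inTail i t c) F (trans (cong (_∨ exhF c (g (V t) (VF F))) (over-false (VF F) (V t) (≤ᵇ-false (V t) (VF F) le))) e)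

  desc-pot : ∀ c F → Pt (descC c F) (descS c F) ≡ PF F + potF c (VF F)
  desc-pot c (one i t) = refl
  desc-pot c (more i t F) with V t ≤ᵇ VF F in le
  ... | true rewrite on≡off (V t) (VF F) (≤ᵇ-true (V t) (VF F) le) =
        e (P t) (PF F) (off (V t) (VF F) ∸ g (V t) (VF F)) (potF c (g (V t) (VF F)))
    where e : ∀ a b c d → a + (b + c + d) ≡ a + b + c + d
          e = solve-∀
  ... | false = trans (desc-pot (inTail i t c) F) (trans
        (cong (λ z → PF F + (P t + (z ∸ g (V t) (VF F)) + potF c (g (V t) (VF F))))
          (trans (on≡off (VF F) (V t) (≤ᵇ-false (V t) (VF F) le)) (off-comm (VF F) (V t))))
        (e (P t) (PF F) (off (V t) (VF F) ∸ g (V t) (VF F)) (potF c (g (V t) (VF F)))))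
    where e : ∀ a b c d → b + (a + c + d) ≡ a + b + c + d
          e = solve-∀

  close-pot : ∀ c F → Pt (closeC c) (closeT c F) ≤ PF F + potF c (VF F)
  close-pot (inNd w c) F = ≤-refl
  close-pot (inTail j t c) F = ≤-trans (close-pot c (more j t F))
    (lin 0 (∸-monoˡ-≤ (g (V t) (VF F)) (≤-trans (≤-reflexive (off-comm (V t) (VF F))) (off≤on (VF F) (V t))))
      (e (P t) (PF F) (off (V t) (VF F) ∸ g (V t) (VF F)) (on (VF F) (V t) ∸ g (V t) (VF F)) (potF c (g (V t) (VF F)))))
    where e : ∀ a b x y d → a + b + x + d + y + 0 ≡ b + (a + y + d) + x
          e = solve-∀

  close-val : ∀ c F → VF (closeL c F) ≤ VF F
  close-val (inNd w c) F = ≤-refl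
  close-val (inTail j t c) F = ≤-trans (close-val c (more j t F)) (g≤ʳ (V t) (VF F))

  -- As no reason to leave remains above, a fork that is `over` lies at the node just reached. There
  -- `over-drop` releases the value of the sibling, which is at least that of the whole child list.
  close-drop : ∀ c F → exhF c (VF F) ≡ true → exhT (closeC c) (V (closeT c F)) ≡ false →
    k * Pt (closeC c) (closeT c F) + VF (closeL c F) ≤ k * (PF F + potF c (VF F))
  close-drop (inNd w c) F e₁ e₂ with trans (sym e₁) e₂
  ... | ()
  close-drop (inTail j t c) F e₁ e₂ with over (VF F) (V t) in ov
  ... | true = begin
      k * Pt (closeC c) (closeT c (more j t F)) + VF (closeL c (more j t F))
        ≤⟨ +-mono-≤ (*-monoʳ-≤ k (close-pot c (more j t F))) (≤-trans (close-val c (more j t F)) (g≤ˡ (V t) (VF F))) ⟩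
      k * (P t + PF F + x + d) + V t
        ≤⟨ lin 0 (over-drop (VF F) (V t) ov) (trans (cong (λ z → k * (P t + PF F + x + d) + V t + k * z + 0) (sym (m∸n+n≡m g≤on′)))
             (trans (e k (P t) (PF F) x y d (g (V t) (VF F)) (V t))
               (cong (λ z → k * (PF F + (P t + y + d)) + (k * z + V t)) (trans (m∸n+n≡m (g≤off (V t) (VF F))) (off-comm (V t) (VF F)))))) ⟩
      k * (PF F + (P t + y + d)) ∎
    where
    open ≤-Reasoning
    x = off (V t) (VF F) ∸ g (V t) (VF F)
    y = on (VF F) (V t) ∸ g (V t) (VF F)
    d = potF c (g (V t) (VF F))
    g≤on′ : g (V t) (VF F) ≤ on (VF F) (V t)
    g≤on′ = subst (_≤ on (VF F) (V t)) (g-comm (VF F) (V t)) (g≤on (VF F) (V t))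
    e : ∀ k a b x y d g v → k * (a + b + x + d) + v + k * (y + g) + 0 ≡ k * (b + (a + y + d)) + (k * (x + g) + v)
    e = solve-∀
  ... | false = ≤-trans (close-drop c (more j t F) e₁ e₂) (*-monoʳ-≤ k
    (lin 0 (∸-monoˡ-≤ (g (V t) (VF F)) (≤-trans (≤-reflexive (off-comm (V t) (VF F))) (off≤on (VF F) (V t))))
      (e (P t) (PF F) (off (V t) (VF F) ∸ g (V t) (VF F)) (on (VF F) (V t) ∸ g (V t) (VF F)) (potF c (g (V t) (VF F))))))
    where e : ∀ a b x y d → a + b + x + d + y + 0 ≡ b + (a + y + d) + x
          e = solve-∀

  upT-pot : ∀ c s → Pt (upC c) (upS c s) ≤ Pt c s
  upT-pot top s = ≤-refl
  upT-pot (inOne i c) s = close-pot c (one i s)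
  upT-pot (inMore i F c) s = ≤-trans (close-pot c (more i s F))
    (lin 0 (∸-monoˡ-≤ (g (V s) (VF F)) (off≤on (V s) (VF F)))
      (e (P s) (PF F) (off (V s) (VF F) ∸ g (V s) (VF F)) (on (V s) (VF F) ∸ g (V s) (VF F)) (potF c (g (V s) (VF F)))))
    where e : ∀ a b x y d → a + b + x + d + y + 0 ≡ a + (b + y + d) + x
          e = solve-∀

  lastVal : MapT → ℕ
  lastVal leaf = 0
  lastVal (nd w F) = VF F

  upT-drop : ∀ c s → exhT c (V s) ≡ true → exhT (upC c) (V (upS c s)) ≡ false →
    k * Pt (upC c) (upS c s) + lastVal (upS c s) ≤ k * Pt c s
  upT-drop (inOne i c) s e₁ e₂ = close-drop c (one i s) e₁ e₂
  upT-drop (inMore i F c) s e₁ e₂ with over (V s) (VF F) in ov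
  ... | true = begin
      k * Pt (closeC c) (closeT c (more i s F)) + VF (closeL c (more i s F))
        ≤⟨ +-mono-≤ (*-monoʳ-≤ k (close-pot c (more i s F))) (≤-trans (close-val c (more i s F)) (g≤ʳ (V s) (VF F))) ⟩
      k * (P s + PF F + x + d) + VF F
        ≤⟨ lin 0 (over-drop (V s) (VF F) ov) (trans (cong (λ z → k * (P s + PF F + x + d) + VF F + k * z + 0) (sym (m∸n+n≡m (g≤on (V s) (VF F)))))
             (trans (e k (P s) (PF F) x y d (g (V s) (VF F)) (VF F))
               (cong (λ z → k * (P s + (PF F + y + d)) + (k * z + VF F)) (m∸n+n≡m (g≤off (V s) (VF F)))))) ⟩
      k * (P s + (PF F + y + d)) ∎
    where
    open ≤-Reasoning
    x = off (V s) (VF F) ∸ g (V s) (VF F)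
    y = on (V s) (VF F) ∸ g (V s) (VF F)
    d = potF c (g (V s) (VF F))
    e : ∀ k a b x y d g v → k * (a + b + x + d) + v + k * (y + g) + 0 ≡ k * (a + (b + y + d)) + (k * (x + g) + v)
    e = solve-∀
  ... | false = ≤-trans (close-drop c (more i s F) e₁ e₂) (*-monoʳ-≤ k
    (lin 0 (∸-monoˡ-≤ (g (V s) (VF F)) (off≤on (V s) (VF F)))
      (e (P s) (PF F) (off (V s) (VF F) ∸ g (V s) (VF F)) (on (V s) (VF F) ∸ g (V s) (VF F)) (potF c (g (V s) (VF F))))))
    where e : ∀ a b x y d → a + b + x + d + y + 0 ≡ a + (b + y + d) + x
          e = solve-∀

  -- W per move, paid for by the decrease of the potential when the robot turns around, and by the load when
  -- a finished branch is removed.  phase is the part still owed for the descent in progress.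
  cost : ℕ → CtxT → MapT → ℕ
  cost n c s = W * n + 2 * k * Pt c s + 5 * W * loadT k (plugT c s)

  phase : CtxT → MapT → ℕ
  phase c s = if exhT c (V s) then 2 * k * W else W * greedyT s

  phase≤ : ∀ c s x → 2 * k * W ≤ x → W * greedyT s ≤ x → phase c s ≤ x
  phase≤ c s x p q with exhT c (V s)
  ... | true = p
  ... | false = q

  phase-false : ∀ c s → exhT c (V s) ≡ false → phase c s ≡ W * greedyT s
  phase-false c s e rewrite e = refl

  phase-true : ∀ c s → exhT c (V s) ≡ true → phase c s ≡ 2 * k * W
  phase-true c s e rewrite e = refl

  -- The move is paid by the greedy path becoming one edge shorter; potential and load stay the
  -- same.
  down-cost : ∀ n c w F → exhT c (V (nd w F)) ≡ false →
    cost (suc n) (descC (inNd w c) F) (descS (inNd w c) F) + phase (descC (inNd w c) F) (descS (inNd w c) F)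
      ≤ cost n c (nd w F) + phase c (nd w F)
  down-cost n c w F e = ≤-reflexive (begin
    W * suc n + 2 * k * Pt c′ s′ + 5 * W * loadT k (plugT c′ s′) + phase c′ s′
      ≡⟨ cong₂ (λ x y → W * suc n + 2 * k * x + 5 * W * loadT k y + phase c′ s′) (desc-pot (inNd w c) F) (desc-plug (inNd w c) F) ⟩
    W * suc n + 2 * k * Pt c (nd w F) + 5 * W * loadT k (plugT c (nd w F)) + phase c′ s′
      ≡⟨ cong (W * suc n + 2 * k * Pt c (nd w F) + 5 * W * loadT k (plugT c (nd w F)) +_) (phase-false c′ s′ (desc-ex (inNd w c) F e)) ⟩
    W * suc n + 2 * k * Pt c (nd w F) + 5 * W * loadT k (plugT c (nd w F)) + W * greedyT s′
      ≡⟨ eq W n (2 * k * Pt c (nd w F)) (5 * W * loadT k (plugT c (nd w F))) (greedyT s′) ⟩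
    W * n + 2 * k * Pt c (nd w F) + 5 * W * loadT k (plugT c (nd w F)) + W * suc (greedyT s′)
      ≡⟨ cong (λ z → cost n c (nd w F) + W * z) (sym (desc-lam (inNd w c) F)) ⟩
    cost n c (nd w F) + W * greedyF F
      ≡⟨ cong (cost n c (nd w F) +_) (sym (phase-false c (nd w F) e)) ⟩
    cost n c (nd w F) + phase c (nd w F) ∎)
    where
    open ≡-Reasoning
    c′ = descC (inNd w c) F
    s′ = descS (inNd w c) F
    eq : ∀ w n a b l → w * suc n + a + b + w * l ≡ w * n + a + b + w * suc l
    eq = solve-∀

  up-free : ∀ n c s → cost n (upC c) (upS c s) ≤ cost n c s
  up-free n c s = +-mono-≤ (+-monoʳ-≤ (W * n) (*-monoʳ-≤ (2 * k) (upT-pot c s))) (≤-reflexive (cong (λ z → 5 * W * loadT k z) (plug-up c s)))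

  -- If the robot may descend again, the `2 * k * W` owed so far and twice the drop in `upT-drop`
  -- cover the new greedy path. Hence the factor `2 * k` of `Pt` in `cost`.
  up-cost : ∀ n c s → exhT c (V s) ≡ true → W * greedyT (upS c s) ≤ 2 * lastVal (upS c s) + 2 * k * W →
    cost n (upC c) (upS c s) + phase (upC c) (upS c s) ≤ cost n c s + phase c s
  up-cost n c s e lb with exhT (upC c) (V (upS c s)) in e′
  ... | true = +-mono-≤ (up-free n c s) (≤-reflexive (sym (phase-true c s e)))
  ... | false = begin
    W * n + 2 * k * p′ + Q′ + W * greedyT (upS c s)       ≤⟨ +-monoʳ-≤ _ lb ⟩
    W * n + 2 * k * p′ + Q′ + (2 * l + 2 * k * W)      ≤⟨ lin 0 (+-mono-≤ (upT-drop c s e e′) (upT-drop c s e e′)) (eq (W * n) k p′ Q′ l (2 * k * W) p)  ⟩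
    W * n + 2 * k * p + Q′ + 2 * k * W                 ≡⟨ cong₂ (λ x y → W * n + 2 * k * p + 5 * W * loadT k x + y) (plug-up c s) (sym (phase-true c s e)) ⟩
    cost n c s + phase c s ∎
    where
    open ≤-Reasoning
    p′ = Pt (upC c) (upS c s)
    p = Pt c s
    l = lastVal (upS c s)
    Q′ = 5 * W * loadT k (plugT (upC c) (upS c s))
    eq : ∀ a k p′ q l x p → a + 2 * k * p′ + q + (2 * l + x) + (k * p + k * p) + 0 ≡ a + 2 * k * p + q + x + ((k * p′ + l) + (k * p′ + l))
    eq = solve-∀

  -- With `d` edges in `F′`, the potential part rises by at most `4 * W * d + 2 * k * W`, and the
  -- new phase is worth at most `W * d + 2 * k * W`. The load falls by at least `d + k`, hence its
  -- factor `5 * W`.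
  rem-cost : ∀ n c w {F i F′} → Removal F i F′ → cost n c (nd w F′) + phase c (nd w F′) ≤ cost n c (nd w F)
  rem-cost n c w {F} {i} {F′} r = begin
    W * n + 2 * k * p′ + 5 * W * q′ + phase c (nd w F′)
      ≤⟨ +-monoʳ-≤ (W * n + 2 * k * p′ + 5 * W * q′) (phase≤ c (nd w F′) (2 * k * W + W * d) (m≤m+n _ _) (≤-trans (*-monoʳ-≤ W (lam≤edF F′)) (m≤n+m _ _))) ⟩
    W * n + 2 * k * p′ + 5 * W * q′ + (2 * k * W + W * d)
      ≤⟨ lin (k * W) (+-mono-≤ (*-monoʳ-≤ 2 (Pt-Rem c w r)) (*-monoʳ-≤ (5 * W) Q≤)) (e W n k p p′ q q′ d) ⟩
    W * n + 2 * k * p + 5 * W * q ∎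
    where
    open ≤-Reasoning
    p = Pt c (nd w F)
    p′ = Pt c (nd w F′)
    q = loadT k (plugT c (nd w F))
    q′ = loadT k (plugT c (nd w F′))
    d = edgesF F′
    m = k + sibT c
    Q≤ : q′ + d + k ≤ q
    Q≤ = lin 0 Qm (e′ q q′ (loadT m (nd w F)) (loadT m (nd w F′)) d k (QdT-diff k c (nd w F) (nd w F′)))
      where
      Qm : loadT m (nd w F′) + d + k ≤ loadT m (nd w F)
      Qm = begin
        loadF (m + forks F′) F′ + d + k ≤⟨ +-monoʳ-≤ (loadF (m + forks F′) F′ + d) (≤-trans (m≤m+n k (sibT c)) (m≤m+n m (forks F′))) ⟩
        loadF (m + forks F′) F′ + d + (m + forks F′) ≤⟨ QF-Rem (m + forks F′) r ⟩
        loadF (suc (m + forks F′)) F ≡⟨ cong (λ z → loadF z F) (trans (sym (+-suc m (forks F′))) (cong (m +_) (sym (fk-Rem r)))) ⟩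
        loadF (m + forks F) F ∎
      e′ : ∀ q q′ x x′ d k → q + x′ ≡ q′ + x → q′ + d + k + x + 0 ≡ q + (x′ + d + k)
      e′ q q′ x x′ d k h = trans (e₁ q′ d k x) (trans (cong (λ z → z + d + k) (sym h)) (e₂ q x′ d k))
        where e₁ : ∀ a b c d → a + b + c + d + 0 ≡ a + d + b + c
              e₁ = solve-∀
              e₂ : ∀ a b c d → a + b + c + d ≡ a + (b + c + d)
              e₂ = solve-∀
    e : ∀ W n k p p′ q q′ d →
      W * n + 2 * k * p′ + 5 * W * q′ + (2 * k * W + W * d) + (2 * (k * p + 2 * W * d + k * W) + 5 * W * q) + k * W ≡
      W * n + 2 * k * p + 5 * W * q + (2 * (k * p′) + 5 * W * (q′ + d + k))
    e = solve-∀

  VF-leaves≤ : ∀ i js → VF (leaves i js) ≤ W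
  VF-leaves≤ i [] = ≤-refl
  VF-leaves≤ i (j ∷ js) = g≤ˡ W (VF (leaves j js))

  PF-leaves≤ : ∀ i js → PF (leaves i js) ≤ length js * W
  PF-leaves≤ i [] = z≤n
  PF-leaves≤ i (j ∷ js) = ≤-trans
    (+-mono-≤ (PF-leaves≤ j js) (≤-trans (m∸n≤m (off W v) (g W v)) (≤-trans (off≤⊔ W v) (⊔-lub ≤-refl (VF-leaves≤ j js)))))
    (≤-reflexive (+-comm (length js * W) W))
    where v = VF (leaves j js)

  -- With this bonus a newly examined node is worth `W + W` whatever the number of its children, so
  -- each expansion gains exactly `W` at the hole.
  fresh : ℕ → List ℕ → MapT
  fresh i js = nd (W ∸ VF (leaves i js)) (leaves i js)

  V-fresh : ∀ i js → V (fresh i js) ≡ W + W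
  V-fresh i js = begin
    W + ((W ∸ v) ⊓ W) + v ≡⟨ cong (λ z → W + z + v) (m≤n⇒m⊓n≡m (m∸n≤m W v)) ⟩
    W + (W ∸ v) + v       ≡⟨ +-assoc W (W ∸ v) v ⟩
    W + (W ∸ v + v)       ≡⟨ cong (W +_) (m∸n+n≡m (VF-leaves≤ i js)) ⟩
    W + W ∎
    where
    open ≡-Reasoning
    v = VF (leaves i js)

  -- With `q` children the potential rises by at most `q * W` and the load by at most `q * (2 * k)`;
  -- together with the phase this gives `12 * k * q + 2 * k + q` times `W`. A linear cost would do
  -- with less credit than `2 ^ q`, but this much is available by `expand-gain`.
  expand-cost : ∀ n c i js → sibT c + suc (suc (length js)) ≤ k →
    cost n c (fresh i js) + phase c (fresh i js) ≤ cost n c leaf + 16 * k * W * 2 ^ suc (length js)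
  expand-cost n c i js cap = begin
    W * n + 2 * k * p′ + 5 * W * q′ + phase c (fresh i js)
      ≤⟨ +-monoʳ-≤ (W * n + 2 * k * p′ + 5 * W * q′) (phase≤ c (fresh i js) (2 * k * W + W * q) (m≤m+n _ _)
           (≤-trans (*-monoʳ-≤ W (≤-trans (lam≤edF (leaves i js)) (≤-reflexive (ed-leaves i js)))) (m≤n+m _ _))) ⟩
    W * n + 2 * k * p′ + 5 * W * q′ + (2 * k * W + W * q)
      ≤⟨ lin 0 (+-mono-≤ (*-monoʳ-≤ (2 * k) p≤) (*-monoʳ-≤ (5 * W) q≤)) (e W n k p p′ q₀ q′ q) ⟩
    W * n + 2 * k * p + 5 * W * q₀ + W * (12 * k * q + 2 * k + q)
      ≤⟨ +-monoʳ-≤ (W * n + 2 * k * p + 5 * W * q₀) (≤-trans (*-monoʳ-≤ W big) (≤-reflexive (e₂ W k (2 ^ q)))) ⟩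
    W * n + 2 * k * p + 5 * W * q₀ + 16 * k * W * 2 ^ q ∎
    where
    open ≤-Reasoning
    q = suc (length js)
    p = Pt c leaf
    p′ = Pt c (fresh i js)
    q₀ = loadT k (plugT c leaf)
    q′ = loadT k (plugT c (fresh i js))
    p≤ : p′ ≤ p + q * W
    p≤ = lin 0 (+-mono-≤ (PF-leaves≤ i js) (subst (λ z → potT c z + W ≤ potT c W + z) (sym (V-fresh i js)) (pot-lip′ c (m≤m+n W W))))
          (trans (cong (λ z → P (fresh i js) + potT c (V (fresh i js)) + (length js * W + (potT c W + z)) + 0) (V-fresh i js))
            (e₁ (PF (leaves i js)) (potT c (V (fresh i js))) (length js) W (potT c W)))
      where e₁ : ∀ a b l w d → a + b + (l * w + (d + (w + w))) + 0 ≡ d + suc l * w + (a + (b + w))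
            e₁ = solve-∀
    q≤ : q′ ≤ q₀ + q * (2 * k)
    q≤ = begin
      q′ ≡⟨ sym (+-identityʳ q′) ⟩
      q′ + 0 ≡⟨ sym (QdT-diff k c leaf (fresh i js)) ⟩
      q₀ + loadF (k + sibT c + forks (leaves i js)) (leaves i js) ≡⟨ cong (q₀ +_) (QF-leaves _ i js) ⟩
      q₀ + q * (k + sibT c + forks (leaves i js)) ≤⟨ +-monoʳ-≤ q₀ (*-monoʳ-≤ q le) ⟩
      q₀ + q * (2 * k) ∎
      where
      le : k + sibT c + forks (leaves i js) ≤ 2 * k
      le = begin
        k + sibT c + forks (leaves i js) ≡⟨ cong (k + sibT c +_) (fk-leaves i js) ⟩
        k + sibT c + length js ≡⟨ +-assoc k (sibT c) _ ⟩
        k + (sibT c + length js) ≤⟨ +-monoʳ-≤ k (≤-trans (+-monoʳ-≤ (sibT c) (≤-trans (n≤1+n _) (n≤1+n _))) cap) ⟩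
        k + k ≡⟨ cong (k +_) (sym (+-identityʳ k)) ⟩
        2 * k ∎
    q≤2^q : q ≤ 2 ^ q
    q≤2^q = ≤-trans (n≤1+n q) (n<2^n q)
    1≤2^q : 1 ≤ 2 ^ q
    1≤2^q = ≤-trans (s≤s z≤n) (n<2^n q)
    big : 12 * k * q + 2 * k + q ≤ 16 * k * 2 ^ q
    big = begin
      12 * k * q + 2 * k + q ≤⟨ +-mono-≤ (+-mono-≤ (*-monoʳ-≤ (12 * k) q≤2^q) (≤-trans (≤-reflexive (sym (*-identityʳ (2 * k)))) (*-monoʳ-≤ (2 * k) 1≤2^q)))
           (≤-trans q≤2^q (≤-trans (≤-reflexive (sym (*-identityˡ (2 ^ q)))) (*-monoˡ-≤ (2 ^ q) 1≤k))) ⟩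
      12 * k * 2 ^ q + 2 * k * 2 ^ q + k * 2 ^ q ≤⟨ lin (k * 2 ^ q) (≤-refl {0}) (e₃ k (2 ^ q)) ⟩
      16 * k * 2 ^ q ∎
      where e₃ : ∀ k x → 12 * k * x + 2 * k * x + k * x + 0 + k * x ≡ 16 * k * x + 0
            e₃ = solve-∀
    e : ∀ W n k p p′ q₀ q′ q →
      W * n + 2 * k * p′ + 5 * W * q′ + (2 * k * W + W * q) + (2 * k * (p + q * W) + 5 * W * (q₀ + q * (2 * k))) + 0 ≡
      W * n + 2 * k * p + 5 * W * q₀ + W * (12 * k * q + 2 * k + q) + (2 * k * p′ + 5 * W * q′)
    e = solve-∀
    e₂ : ∀ W k x → W * (16 * k * x) ≡ 16 * k * W * x
    e₂ = solve-∀

  -- After the open forks at least `k ^ forT c * M ^ z` of the gain is left, and `M ^ z` is at least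
  -- `2 ^ z * k ^ z`. The capacity makes `z` exceed the number of children, so the more forks a node
  -- opens, the more value must have survived above it.
  expand-gain : ∀ c i js → W ≡ M ^ k → exhT c W ≡ false → sibT c + suc (suc (length js)) ≤ k →
    V (plugT c leaf) + 2 * k ^ k * 2 ^ suc (length js) ≤ V (plugT c (fresh i js))
  expand-gain c i js eW nex cap = begin
    V (plugT c leaf) + 2 * k ^ k * 2 ^ q  ≡⟨ cong₂ _+_ (val-plug c leaf) (e (k ^ k) (2 ^ q)) ⟩
    valT c W + k ^ k * 2 ^ suc q          ≤⟨ +-monoʳ-≤ (valT c W) gain ⟩
    valT c W + k ^ forT c * M ^ z         ≤⟨ slopeT c W (W + W) 0 z ez eW nex ≤-refl (≤-reflexive (cong (W +_) (trans (+-identityʳ _) (trans (cong (M ^_) ez) (sym eW))))) ⟩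
    valT c (W + W)                        ≡⟨ cong (valT c) (sym (V-fresh i js)) ⟩
    valT c (V (fresh i js))               ≡⟨ sym (val-plug c (fresh i js)) ⟩
    V (plugT c (fresh i js)) ∎
    where
    open ≤-Reasoning
    q = suc (length js)
    z = k ∸ forT c
    for≤ : forT c + suc q ≤ k
    for≤ = ≤-trans (+-monoˡ-≤ (suc q) (forT≤sib c)) cap
    ez : forT c + z ≡ k
    ez = m+[n∸m]≡n (≤-trans (m≤m+n (forT c) (suc q)) for≤)
    e : ∀ a b → 2 * a * b ≡ a * (2 * b)
    e = solve-∀
    e₁ : ∀ a b c → a * b * c ≡ a * (c * b)
    e₁ = solve-∀
    gain : k ^ k * 2 ^ suc q ≤ k ^ forT c * M ^ z
    gain = begin
      k ^ k * 2 ^ suc q             ≤⟨ *-monoʳ-≤ (k ^ k) (^-monoʳ-≤ 2 (m+n≤o⇒m≤o∸n (suc q) (≤-trans (≤-reflexive (+-comm (suc q) (forT c))) for≤))) ⟩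
      k ^ k * 2 ^ z                 ≡⟨ cong (λ y → k ^ y * 2 ^ z) (sym ez) ⟩
      k ^ (forT c + z) * 2 ^ z      ≡⟨ cong (_* 2 ^ z) (^-distribˡ-+-* k (forT c) z) ⟩
      k ^ forT c * k ^ z * 2 ^ z    ≡⟨ e₁ (k ^ forT c) (k ^ z) (2 ^ z) ⟩
      k ^ forT c * (2 ^ z * k ^ z)  ≡⟨ cong (k ^ forT c *_) (sym (^-distribʳ-* z 2 k)) ⟩
      k ^ forT c * (2 * k) ^ z      ≤⟨ *-monoʳ-≤ (k ^ forT c) (^-monoˡ-≤ z (n≤1+n (2 * k))) ⟩
      k ^ forT c * M ^ z            ∎

  rem-gain : ∀ c w {F i F′} → Removal F i F′ → V (plugT c (nd w F)) ≤ V (plugT c (nd w F′))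
  rem-gain c w {F} {i} {F′} r = subst₂ _≤_ (sym (val-plug c (nd w F))) (sym (val-plug c (nd w F′)))
    (val-mono c (+-monoʳ-≤ (W + (w ⊓ W)) (VF-Rem r)))

  -- Costs are covered by the credit b, each unit of which has raised the value of the map by 2 k^k; the value is bounded by the depth.
  moves-bound : ∀ D n b c s → W ≡ M ^ k → cost n c s ≤ 16 * k * W * b → 2 * k ^ k * b + W ≤ V (plugT c s) →
    V (plugT c s) ≤ W + 2 * W * D → n ≤ 32 * k * 2 ^ k * D
  moves-bound D n b c s eW h₁ h₂ h₃ = begin
    n                    ≤⟨ n≤ ⟩
    16 * k * b           ≤⟨ *-monoʳ-≤ (16 * k) b≤ ⟩
    16 * k * (2 * 2 ^ k * D)  ≡⟨ e k (2 ^ k) D ⟩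
    32 * k * 2 ^ k * D   ∎
    where
    open ≤-Reasoning
    e : ∀ k x d → 16 * k * (2 * x * d) ≡ 32 * k * x * d
    e = solve-∀
    instance _ = >-nonZero (≤-trans (s≤s z≤n) 2≤W)
    instance _ = m^n≢0 k k
    n≤ : n ≤ 16 * k * b
    n≤ = *-cancelˡ-≤ W (begin
      W * n             ≤⟨ m≤m+n (W * n) _ ⟩
      W * n + 2 * k * Pt c s  ≤⟨ m≤m+n _ _ ⟩
      cost n c s        ≤⟨ h₁ ⟩
      16 * k * W * b    ≡⟨ e′ k W b ⟩
      W * (16 * k * b)  ∎)
      where e′ : ∀ k w b → 16 * k * w * b ≡ w * (16 * k * b)
            e′ = solve-∀
    b≤ : b ≤ 2 * 2 ^ k * D
    b≤ = *-cancelˡ-≤ (k ^ k) (*-cancelˡ-≤ 2 (begin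
      2 * (k ^ k * b)            ≡⟨ sym (*-assoc 2 (k ^ k) b) ⟩
      2 * k ^ k * b              ≤⟨ +-cancelʳ-≤ W _ _ (≤-trans h₂ (≤-trans h₃ (≤-reflexive (+-comm W _)))) ⟩
      2 * W * D                  ≡⟨ cong (λ z → 2 * z * D) eW ⟩
      -- Replacing `M` by `2 * k` at the price of a factor 2 lets `k ^ k` cancel and leaves `2 ^ k`.
      2 * M ^ k * D              ≤⟨ *-monoˡ-≤ D (*-monoʳ-≤ 2 (pow-ratio k k ≤-refl)) ⟩
      2 * (2 * (2 * k) ^ k) * D  ≡⟨ cong (λ z → 2 * (2 * z) * D) (^-distribʳ-* k 2 k) ⟩
      2 * (2 * (2 ^ k * k ^ k)) * D ≡⟨ e′ (2 ^ k) (k ^ k) D ⟩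
      2 * (k ^ k * (2 * 2 ^ k * D)) ∎))
      where e′ : ∀ x y d → 2 * (2 * (x * y)) * d ≡ 2 * (y * (2 * x * d))
            e′ = solve-∀

-- Addresses, ports and neighbours.

lastPort : Address → ℕ
lastPort [] = 0
lastPort (x ∷ []) = x
lastPort (x ∷ y ∷ a) = lastPort (y ∷ a)

snoc-view : ∀ a → a ≢ [] → dropLast a ++ [ lastPort a ] ≡ a
snoc-view [] ne = ⊥-elim (ne refl)
snoc-view (x ∷ []) ne = refl
snoc-view (x ∷ y ∷ a) ne = cong (x ∷_) (snoc-view (y ∷ a) λ ())

dropLast-snoc : ∀ a i → dropLast (a ++ [ i ]) ≡ a
dropLast-snoc [] i = refl
dropLast-snoc (x ∷ []) i = refl
dropLast-snoc (x ∷ y ∷ a) i = cong (x ∷_) (dropLast-snoc (y ∷ a) i)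

lastPort-snoc : ∀ a i → lastPort (a ++ [ i ]) ≡ i
lastPort-snoc [] i = refl
lastPort-snoc (x ∷ []) i = refl
lastPort-snoc (x ∷ y ∷ a) i = lastPort-snoc (y ∷ a) i

snoc≢[] : ∀ (a : Address) i → a ++ [ i ] ≢ []
snoc≢[] [] i ()
snoc≢[] (x ∷ a) i ()

length-dropLast : ∀ a → a ≢ [] → suc (length (dropLast a)) ≡ length a
length-dropLast [] ne = ⊥-elim (ne refl)
length-dropLast (x ∷ []) ne = refl
length-dropLast (x ∷ y ∷ a) ne = cong suc (length-dropLast (y ∷ a) λ ())

length-snoc : ∀ (a : Address) i → length (a ++ [ i ]) ≡ suc (length a)
length-snoc [] i = refl
length-snoc (x ∷ a) i = cong suc (length-snoc a i)

pre : Address → Address → Bool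
pre [] b = true
pre (x ∷ a) [] = false
pre (x ∷ a) (y ∷ b) = (x ≡ᵇ y) ∧ pre a b

≡ᵇ-refl : ∀ x → (x ≡ᵇ x) ≡ true
≡ᵇ-refl zero = refl
≡ᵇ-refl (suc x) = ≡ᵇ-refl x

≡ᵇ-true : ∀ x y → (x ≡ᵇ y) ≡ true → x ≡ y
≡ᵇ-true x y e = ≡ᵇ⇒≡ x y (subst T (sym e) tt)

pre-++ : ∀ a b → pre a (a ++ b) ≡ true
pre-++ [] b = refl
pre-++ (x ∷ a) b rewrite ≡ᵇ-refl x = pre-++ a b

pre-split : ∀ a b → pre a b ≡ true → Σ Address λ c → b ≡ a ++ c
pre-split [] b e = b , refl
pre-split (x ∷ a) (y ∷ b) e with x ≡ᵇ y in eq
... | true = let (c , p) = pre-split a b e in c , cong₂ _∷_ (sym (≡ᵇ-true x y eq)) p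

pre-trans : ∀ a b c → pre a b ≡ true → pre b c ≡ true → pre a c ≡ true
pre-trans a b c p q with pre-split a b p | pre-split b c q
... | d , refl | e , refl rewrite ++-assoc a d e = pre-++ a (d ++ e)

pre-snoc : ∀ a i b → pre (a ++ [ i ]) b ≡ true → pre a b ≡ true
pre-snoc a i b = pre-trans a (a ++ [ i ]) b (pre-++ a [ i ])

pre-refl : ∀ a → pre a a ≡ true
pre-refl a = subst (λ z → pre a z ≡ true) (++-identityʳ a) (pre-++ a [])

pre-snoc-unique : ∀ a i j b → pre (a ++ [ i ]) b ≡ true → pre (a ++ [ j ]) b ≡ true → i ≡ j
pre-snoc-unique a i j b p q with pre-split (a ++ [ i ]) b p | pre-split (a ++ [ j ]) b q
... | c , refl | d , e rewrite ++-assoc a [ i ] c | ++-assoc a [ j ] d = ∷-injectiveˡ (++-cancelˡ a (i ∷ c) (j ∷ d) e)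

snoc-pre-self : ∀ a i → pre (a ++ [ i ]) a ≡ false
snoc-pre-self [] i = refl
snoc-pre-self (x ∷ a) i rewrite ≡ᵇ-refl x = snoc-pre-self a i

data Move : Set where
  up   : Move
  down : ℕ → Move

-- Indices out of range fall back on the last neighbour, so the rule is total without a proof that
-- the port exists.
pick : ℕ → (m : ℕ) → Choice m
pick n zero = tt
pick zero (suc m) = zero
pick (suc n) (suc zero) = zero
pick (suc n) (suc (suc m)) = suc (pick n (suc m))

data Nth {A : Set} : List A → ℕ → A → Set where
  nth-z : ∀ {x xs} → Nth (x ∷ xs) 0 x
  nth-s : ∀ {x y xs n} → Nth xs n y → Nth (x ∷ xs) (suc n) y

pick-dest : ∀ xs n y a → Nth xs n y → destination xs (pick n (length xs)) a ≡ y
pick-dest (x ∷ xs) zero y a nth-z = refl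
pick-dest (x ∷ x′ ∷ xs) (suc n) y a (nth-s h) = pick-dest (x′ ∷ xs) n y a h

Nth-map : ∀ {A : Set} (f : ℕ → A) g n i → i < n → Nth (map f (applyUpTo g n)) i (f (g i))
Nth-map f g (suc n) zero lt = nth-z
Nth-map f g (suc n) (suc i) (s≤s lt) = nth-s (Nth-map f (g ∘ suc) n i lt)

-- Away from the root the first neighbour is the parent; `moveIx` shifts ports accordingly.
kids : Address → ℕ → ℕ
kids [] n = n
kids (x ∷ a) n = pred n

kids-neighbours : ∀ T a → kids a (length (neighbours T a)) ≡ numChildren T a
kids-neighbours T [] = trans (length-map _ (upTo (numChildren T []))) (length-upTo _)
kids-neighbours T (x ∷ a) = trans (length-map _ (upTo (numChildren T (x ∷ a)))) (length-upTo _)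

moveIx : Address → Move → ℕ
moveIx a up = 0
moveIx [] (down i) = i
moveIx (x ∷ a) (down i) = suc i

goto : Address → Move → (n : ℕ) → Choice n
goto a m n = pick (moveIx a m) n

goto-up : ∀ T a → a ≢ [] → destination (neighbours T a) (goto a up (length (neighbours T a))) a ≡ dropLast a
goto-up T [] ne = ⊥-elim (ne refl)
goto-up T (x ∷ a) ne = refl

goto-down : ∀ T a i → i < numChildren T a →
  destination (neighbours T a) (goto a (down i) (length (neighbours T a))) a ≡ a ++ [ i ]
goto-down T [] i lt = pick-dest (neighbours T []) i [ i ] [] (Nth-map _ id _ i lt)
goto-down T (x ∷ a) i lt = pick-dest (neighbours T (x ∷ a)) (suc i) _ (x ∷ a) (nth-s (Nth-map _ id _ i lt))

childOf : ∀ ts i → i < length ts → Σ Tree λ u → (∀ a → subtreeL ts i a ≡ subtree u a) × depth u ≤ depthL ts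
childOf (t ∷ ts) zero lt = t , (λ a → refl) , m≤m⊔n (depth t) (depthL ts)
childOf (t ∷ ts) (suc i) (s≤s lt) with childOf ts i lt
... | u , e , d = u , e , ≤-trans d (m≤n⊔m (depth t) (depthL ts))

subtree-snoc : ∀ T a ts i → subtree T a ≡ just (node ts) → i < length ts →
  Σ Tree λ u → subtree T (a ++ [ i ]) ≡ just u × suc (depth u) ≤ depth (node ts)
subtree-snoc-L : ∀ us j a ts i → subtreeL us j a ≡ just (node ts) → i < length ts →
  Σ Tree λ u → subtreeL us j (a ++ [ i ]) ≡ just u × suc (depth u) ≤ depth (node ts)
subtree-snoc (node ts) [] .ts i refl lt with childOf ts i lt
... | u , e , d = u , e [] , le ts d lt
  where le : ∀ ts → depth u ≤ depthL ts → i < length ts → suc (depth u) ≤ depth (node ts)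
        le (t ∷ ts) d lt = s≤s d
subtree-snoc (node us) (j ∷ a) ts i e lt = subtree-snoc-L us j a ts i e lt
subtree-snoc-L (u ∷ us) zero a ts i e lt = subtree-snoc u a ts i e lt
subtree-snoc-L (u ∷ us) (suc j) a ts i e lt = subtree-snoc-L us j a ts i e lt

node-nc : ∀ T a → IsNode T a → Σ (List Tree) λ ts → subtree T a ≡ just (node ts) × numChildren T a ≡ length ts
node-nc T a (node ts , e) rewrite e = ts , refl , refl

IsNode-snoc : ∀ T a i → IsNode T a → i < numChildren T a → IsNode T (a ++ [ i ])
IsNode-snoc T a i isN lt with node-nc T a isN
... | ts , e , ec with subtree-snoc T a ts i e (subst (i <_) ec lt)
... | u , e′ , _ = u , e′

IsNode-init : ∀ T a i → IsNode T (a ++ [ i ]) → IsNode T a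
IsNode-init-L : ∀ us j a i → (∃ λ u → subtreeL us j (a ++ [ i ]) ≡ just u) → ∃ λ u → subtreeL us j a ≡ just u
IsNode-init T [] i h = T , refl
IsNode-init (node us) (j ∷ a) i h = IsNode-init-L us j a i h
IsNode-init-L (u ∷ us) zero a i h = IsNode-init u a i h
IsNode-init-L (u ∷ us) (suc j) a i h = IsNode-init-L us j a i h

IsNode-child : ∀ T a i → IsNode T (a ++ [ i ]) → i < numChildren T a
IsNode-child-L : ∀ us j a i → (∃ λ u → subtreeL us j (a ++ [ i ]) ≡ just u) →
  i < numChildren (node us) (j ∷ a)
IsNode-child (node ts) [] i h = lem ts i h
  where lem : ∀ ts i → (∃ λ u → subtreeL ts i [] ≡ just u) → i < length ts
        lem (t ∷ ts) zero h = s≤s z≤n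
        lem (t ∷ ts) (suc i) h = s≤s (lem ts i h)
IsNode-child (node us) (j ∷ a) i h = IsNode-child-L us j a i h
IsNode-child-L (node us ∷ _) zero a i h = IsNode-child (node us) a i h
IsNode-child-L (u ∷ us) (suc j) a i h = IsNode-child-L us j a i h

snoc-rec : ∀ (Q : Address → Set) → Q [] → (∀ a i → Q a → Q (a ++ [ i ])) → ∀ a → Q a
snoc-rec Q q₀ qs a = go [] a q₀
  where go : ∀ p a → Q p → Q (p ++ a)
        go p [] h = subst Q (sym (++-identityʳ p)) h
        go p (x ∷ a) h = subst Q (++-assoc p [ x ] a) (go (p ++ [ x ]) a (qs p x h))

-- Sums over nodes, robots and groups.

sumT : Tree → (Address → ℕ) → ℕ
sumL : List Tree → ℕ → (Address → ℕ) → ℕ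
sumT (node ts) f = f [] + sumL ts 0 f
sumL [] i f = 0
sumL (t ∷ ts) i f = sumT t (λ a → f (i ∷ a)) + sumL ts (suc i) f

-- Every node except the root is counted once as a child; the summand `G` stands for the root.
sumT-size : ∀ G T f → (∀ a → f a ≤ G * numChildren T a) → sumT T f + G ≤ G * size T
sumL-size : ∀ G ts i f → (∀ j a → f (i + j ∷ a) ≤ G * numChildren (node ts) (j ∷ a)) →
  sumL ts i f + G * length ts ≤ G * sizeL ts
sumT-size G (node ts) f h = begin
  f [] + sumL ts 0 f + G               ≤⟨ +-monoˡ-≤ G (+-monoˡ-≤ (sumL ts 0 f) (h [])) ⟩
  G * length ts + sumL ts 0 f + G      ≡⟨ e₁ G (length ts) (sumL ts 0 f) ⟩
  G + (sumL ts 0 f + G * length ts)    ≤⟨ +-monoʳ-≤ G (sumL-size G ts 0 f (λ j a → h (j ∷ a))) ⟩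
  G + G * sizeL ts                     ≡⟨ sym (*-suc G (sizeL ts)) ⟩
  G * suc (sizeL ts)                   ∎
  where
  open ≤-Reasoning
  e₁ : ∀ g l s → g * l + s + g ≡ g + (s + g * l)
  e₁ = solve-∀
sumL-size G [] i f h = ≤-refl
sumL-size G (node us ∷ ts) i f h = begin
  sumT (node us) f′ + sumL ts (suc i) f + G * suc (length ts)  ≡⟨ e₁ (sumT (node us) f′) (sumL ts (suc i) f) G (length ts) ⟩
  sumT (node us) f′ + G + (sumL ts (suc i) f + G * length ts)  ≤⟨ +-mono-≤
     (sumT-size G (node us) f′ (λ a → subst (λ x → f (x ∷ a) ≤ G * numChildren (node us) a) (+-identityʳ i) (h 0 a)))
     (sumL-size G ts (suc i) f (λ j a → subst (λ x → f (x ∷ a) ≤ G * numChildren (node ts) (j ∷ a)) (+-suc i j) (h (suc j) a))) ⟩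
  G * size (node us) + G * sizeL ts                            ≡⟨ sym (*-distribˡ-+ G (size (node us)) (sizeL ts)) ⟩
  G * (size (node us) + sizeL ts)                              ∎
  where
  open ≤-Reasoning
  f′ = λ a → f (i ∷ a)
  e₁ : ∀ a b g l → a + b + g * suc l ≡ a + g + (b + g * l)
  e₁ = solve-∀

sumT-cong : ∀ T f f′ → (∀ a → f a ≡ f′ a) → sumT T f ≡ sumT T f′
sumL-cong : ∀ ts i f f′ → (∀ j a → i ≤ j → f (j ∷ a) ≡ f′ (j ∷ a)) → sumL ts i f ≡ sumL ts i f′
sumT-cong (node ts) f f′ h = cong₂ _+_ (h []) (sumL-cong ts 0 f f′ (λ j a _ → h (j ∷ a)))
sumL-cong [] i f f′ h = refl
sumL-cong (t ∷ ts) i f f′ h = cong₂ _+_ (sumT-cong t _ _ (λ a → h i a ≤-refl)) (sumL-cong ts (suc i) f f′ (λ j a lt → h j a (<⇒≤ lt)))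

sumT-bump : ∀ T f f′ a₀ → IsNode T a₀ → f′ a₀ ≡ suc (f a₀) → (∀ a → a ≢ a₀ → f′ a ≡ f a) → sumT T f′ ≡ suc (sumT T f)
sumL-bump : ∀ ts i f f′ j a₀ → (∃ λ u → subtreeL ts j a₀ ≡ just u) → f′ (i + j ∷ a₀) ≡ suc (f (i + j ∷ a₀)) →
  (∀ a → a ≢ i + j ∷ a₀ → f′ a ≡ f a) → sumL ts i f′ ≡ suc (sumL ts i f)
sumT-bump (node ts) f f′ [] isN e h = cong₂ _+_ e (sumL-cong ts 0 f′ f (λ j a _ → h (j ∷ a) (λ ())))
sumT-bump (node ts) f f′ (j ∷ a₀) isN e h = trans (cong₂ _+_ (h [] (λ ())) (sumL-bump ts 0 f f′ j a₀ isN e h)) (+-suc (f []) (sumL ts 0 f))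
sumL-bump (t ∷ ts) i f f′ zero a₀ isN e h = cong₂ _+_
  (sumT-bump t _ _ a₀ isN (subst (λ x → f′ (x ∷ a₀) ≡ suc (f (x ∷ a₀))) (+-identityʳ i) e)
    (λ a ne → h (i ∷ a) (λ eq → ne (∷-injectiveʳ eq))))
  (sumL-cong ts (suc i) f′ f (λ j a lt → h (j ∷ a) (λ eq → <⇒≢ lt (trans (sym (+-identityʳ i)) (sym (∷-injectiveˡ eq))))))
sumL-bump (t ∷ ts) i f f′ (suc j) a₀ isN e h = trans (cong₂ _+_
  (sumT-cong t _ _ (λ a → h (i ∷ a) (λ eq → <⇒≢ (≤-trans (s≤s (m≤m+n i j)) (≤-reflexive (sym (+-suc i j)))) (∷-injectiveˡ eq))))
  (sumL-bump ts (suc i) f f′ j a₀ isN (subst (λ x → f′ (x ∷ a₀) ≡ suc (f (x ∷ a₀))) (+-suc i j) e)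
    (λ a ne → h a (λ eq → ne (trans eq (cong (_∷ a₀) (+-suc i j)))))))
  (+-suc _ _)

sumF : ∀ {n} → (Fin n → ℕ) → ℕ
sumF {zero} f = 0
sumF {suc n} f = f zero + sumF (f ∘ suc)

sumF-mono : ∀ {n} (f g : Fin n → ℕ) → (∀ i → f i ≤ g i) → sumF f ≤ sumF g
sumF-mono {zero} f g h = z≤n
sumF-mono {suc n} f g h = +-mono-≤ (h zero) (sumF-mono _ _ (h ∘ suc))

sumF-mono< : ∀ {n} (f g : Fin n → ℕ) i → (∀ i → f i ≤ g i) → f i < g i → suc (sumF f) ≤ sumF g
sumF-mono< {suc n} f g zero h lt = +-mono-≤ lt (sumF-mono _ _ (h ∘ suc))
sumF-mono< {suc n} f g (suc i) h lt = ≤-trans (≤-reflexive (sym (+-suc (f zero) _))) (+-mono-≤ (h zero) (sumF-mono< (f ∘ suc) (g ∘ suc) i (h ∘ suc) lt))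

sumF-+ : ∀ {n} (f g : Fin n → ℕ) → sumF (λ i → f i + g i) ≡ sumF f + sumF g
sumF-+ {zero} f g = refl
sumF-+ {suc n} f g = trans (cong (f zero + g zero +_) (sumF-+ (f ∘ suc) (g ∘ suc))) (e (f zero) (g zero) _ _)
  where e : ∀ a b c d → a + b + (c + d) ≡ a + c + (b + d)
        e = solve-∀

sumF-const : ∀ {n} (f : Fin n → ℕ) c → (∀ i → f i ≤ c) → sumF f ≤ n * c
sumF-const {zero} f c h = z≤n
sumF-const {suc n} f c h = +-mono-≤ (h zero) (sumF-const _ c (h ∘ suc))

sumF-zero : ∀ n → sumF {n} (λ _ → 0) ≡ 0
sumF-zero zero = refl
sumF-zero (suc n) = sumF-zero n

sumF-cong : ∀ {n} (f g : Fin n → ℕ) → (∀ i → f i ≡ g i) → sumF f ≡ sumF g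
sumF-cong {zero} f g h = refl
sumF-cong {suc n} f g h = cong₂ _+_ (h zero) (sumF-cong _ _ (h ∘ suc))

sumF-upd : ∀ {n} (f g : Fin n → ℕ) i → (∀ j → j ≢ i → g j ≡ f j) → sumF g + f i ≡ sumF f + g i
sumF-upd {suc n} f g zero h = trans (cong (λ x → g zero + x + f zero) (sumF-cong _ _ (λ j → h (suc j) λ ()))) (e (g zero) (sumF (f ∘ suc)) (f zero))
  where e : ∀ a b c → a + b + c ≡ c + b + a
        e = solve-∀
sumF-upd {suc n} f g (suc i) h = trans (cong (λ x → x + sumF (g ∘ suc) + f (suc i)) (h zero λ ()))
  (trans (+-assoc (f zero) _ _) (trans (cong (f zero +_) (sumF-upd (f ∘ suc) (g ∘ suc) i (λ j ne → h (suc j) (λ { refl → ne refl })))) (sym (+-assoc (f zero) _ _))))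

sumN : ℕ → (ℕ → ℕ) → ℕ
sumN zero f = 0
sumN (suc n) f = f n + sumN n f

sumN-cong : ∀ n (f g : ℕ → ℕ) → (∀ j → j < n → f j ≡ g j) → sumN n f ≡ sumN n g
sumN-cong zero f g h = refl
sumN-cong (suc n) f g h = cong₂ _+_ (h n ≤-refl) (sumN-cong n f g (λ j lt → h j (≤-trans lt (n≤1+n n))))

sumN-bump : ∀ n (f g : ℕ → ℕ) j₀ → j₀ < n → g j₀ ≡ suc (f j₀) → (∀ j → j ≢ j₀ → g j ≡ f j) → sumN n g ≡ suc (sumN n f)
sumN-bump (suc n) f g j₀ lt e h with n ≟ j₀
... | yes refl = cong₂ _+_ e (sumN-cong n g f (λ j lt → h j (<⇒≢ lt)))
... | no ne = trans (cong₂ _+_ (h n ne) (sumN-bump n f g j₀ (≤∧≢⇒< (s≤s⁻¹ lt) (ne ∘ sym)) e h)) (+-suc (f n) _)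

sumN-const : ∀ n (f : ℕ → ℕ) c → (∀ j → f j ≤ c) → sumN n f ≤ n * c
sumN-const zero f c h = z≤n
sumN-const (suc n) f c h = +-mono-≤ (h n) (sumN-const n f c h)

-- Records on whiteboards and in memories.

-- What a group writes at a node: the ports below expl have been entered, and fin i says that the subtree behind
-- port i is finished.
record Cell : Set where
  constructor cell
  field
    expl : ℕ
    fin  : ℕ → Bool
open Cell public

-- The anchor of a robot is the node at the hole of its zipper (ctx , hole); free says that it climbs towards a
-- finished branch to be removed from its map.  A robot cannot write at its destination, so pend carries
-- the port of a finished child up to its parent.  moves counts the descents along known edges, and bank the
-- credit received; they only serve the analysis.
record Memory : Set where
  constructor memory
  field
    grp   : ℕ
    ctx   : CtxT
    hole  : MapT
    free  : Bool
    pend  : Maybe ℕ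
    moves : ℕ
    bank  : ℕ
open Memory public

clr : Memory → Memory
clr m = record m { pend = nothing }

mark : Maybe ℕ → (ℕ → Bool) → ℕ → Bool
mark nothing f i = f i
mark (just j) f i = (i ≡ᵇ j) ∨ f i

livePorts : (ℕ → Bool) → ℕ → List ℕ
livePorts f zero = []
livePorts f (suc n) = if f n then livePorts f n else n ∷ livePorts f n

live-sound : ∀ f n {i} → i ∈ livePorts f n → i < n × f i ≡ false
live-sound f (suc n) i∈ with f n in e
... | true = let (a , b) = live-sound f n i∈ in ≤-trans a (n≤1+n n) , b
live-sound f (suc n) (here refl) | false = ≤-refl , e
live-sound f (suc n) (there i∈) | false = let (a , b) = live-sound f n i∈ in ≤-trans a (n≤1+n n) , b

live-complete : ∀ f n {i} → i < n → f i ≡ false → i ∈ livePorts f n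
live-complete f (suc n) {i} lt e with i ≟ n
... | yes refl rewrite e = here refl
... | no ne with f n
...   | true = live-complete f n (≤∧≢⇒< (s≤s⁻¹ lt) ne) e
...   | false = there (live-complete f n (≤∧≢⇒< (s≤s⁻¹ lt) ne) e)

live-unique : ∀ f n → Unique (livePorts f n)
live-unique f zero = []
live-unique f (suc n) with f n
... | true = live-unique f n
... | false = All.tabulate (λ i∈ eq → <⇒≢ (proj₁ (live-sound f n i∈)) (sym eq)) ∷ live-unique f n

prune : (ℕ → Bool) → MapF → Maybe MapF
pruneTail : (ℕ → Bool) → ℕ → MapT → MapF → Maybe MapF
prune f (one i t) = nothing
prune f (more i t F) = if f i then just F else pruneTail f i t F
pruneTail f i t (one j s) = if f j then just (one i t) else nothing
pruneTail f i t (more j s F) = Maybe.map (more i t) (prune f (more j s F))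

-- Pruning fails for two reasons: no listed port is finished, or all are, which by `noneFound`
-- happens only for a single branch, as that is never removed.
data PruneSpec (f : ℕ → Bool) (F : MapF) : Maybe MapF → Set where
  found : ∀ {i F′} → Removal F i F′ → f i ≡ true → PruneSpec f F (just F′)
  none  : (∀ {i} → i ∈ ports F → f i ≡ false) ⊎ (∀ {i} → i ∈ ports F → f i ≡ true) → PruneSpec f F nothing

noneFound : ∀ f i j t s F → f i ≡ false →
  (∀ {i} → i ∈ ports (more j s F) → f i ≡ false) ⊎ (∀ {i} → i ∈ ports (more j s F) → f i ≡ true) →
  prune f (more j s F) ≡ nothing → ∀ {k} → k ∈ ports (more i t (more j s F)) → f k ≡ false
noneFound f i j t s F e (inj₁ h) e′ (here refl) = e
noneFound f i j t s F e (inj₁ h) e′ (there k∈) = h k∈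
noneFound f i j t s F e (inj₂ h) e′ k∈ with f j | h (here refl)
noneFound f i j t s F e (inj₂ h) () k∈ | true | refl

prune-spec : ∀ f F → PruneSpec f F (prune f F)
pruneTail-spec : ∀ f i t F → f i ≡ false → PruneSpec f (more i t F) (pruneTail f i t F)
prune-spec f (one i t) with f i in e
... | true = none (inj₂ λ { (here refl) → e })
... | false = none (inj₁ λ { (here refl) → e })
prune-spec f (more i t F) with f i in e
... | true = found hd e
... | false = pruneTail-spec f i t F e
pruneTail-spec f i t (one j s) e with f j in e′
... | true = found last e′
... | false = none (inj₁ λ { (here refl) → e ; (there (here refl)) → e′ })
pruneTail-spec f i t (more j s F) e with prune f (more j s F) in eq | prune-spec f (more j s F)
... | just F′ | found r e′ = found (tl r) e′
... | nothing | none h = none (inj₁ (noneFound f i j t s F e h eq))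

Rem-ports : ∀ {F i F′ j} → Removal F i F′ → j ∈ ports F → j ≢ i → j ∈ ports F′
Rem-ports hd (here refl) ne = ⊥-elim (ne refl)
Rem-ports hd (there j∈) ne = j∈
Rem-ports last (here refl) ne = here refl
Rem-ports last (there (here refl)) ne = ⊥-elim (ne refl)
Rem-ports (tl r) (here refl) ne = here refl
Rem-ports (tl r) (there j∈) ne = there (Rem-ports r j∈ ne)

Rem-All : ∀ {F i F′} {Q : ℕ → Set} → Removal F i F′ → All Q (ports F) → All Q (ports F′)
Rem-All hd (q ∷ qs) = qs
Rem-All last (q ∷ qs) = q ∷ []
Rem-All (tl r) (q ∷ qs) = q ∷ Rem-All r qs

Rem-Unique : ∀ {F i F′} → Removal F i F′ → Unique (ports F) → Unique (ports F′)
Rem-Unique hd (q ∷ qs) = qs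
Rem-Unique last (q ∷ qs) = [] ∷ []
Rem-Unique (tl r) (q ∷ qs) = Rem-All r q ∷ Rem-Unique r qs

2≤M^k : ∀ k .{{_ : NonZero k}} → 2 ≤ suc (2 * k) ^ k
2≤M^k (suc k) = ≤-trans (s≤s (s≤s z≤n)) (≤-trans (≤-reflexive (sym (*-identityʳ (suc (2 * suc k))))) (*-monoʳ-≤ (suc (2 * suc k)) (m^n>0 (suc (2 * suc k)) k)))

-- The rule followed at a node, and the account of a single robot.

module Rule (k : ℕ) .{{_ : NonZero k}} where

  -- Divisible by M at each of up to k nested forks.
  W : ℕ
  W = suc (2 * k) ^ k

  open Steps k W (2≤M^k k) public

  climb : Bool → Memory → MapT → Memory × Move
  climb b m s = record m { ctx = upC (ctx m) ; hole = upS (ctx m) s ; free = b } , up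

  goDown : Memory → ℕ → MapF → Memory × Move
  goDown m w F =
    record m { ctx = descC (inNd w (ctx m)) F ; hole = descS (inNd w (ctx m)) F ; free = false ; moves = suc (moves m) } ,
    down (proj₁ (desc-addr (inNd w (ctx m)) F))

  expand : Memory → ℕ → List ℕ → Memory × Move
  -- The value gained by the expansion may itself make the branch too valuable, in which case the
  -- robot turns around at once.
  expand m q qs = if exhT (ctx m) (V (fresh q qs))
    then climb false m′ (fresh q qs)
    else goDown m′ (W ∸ VF (leaves q qs)) (leaves q qs)
    where m′ = record m { bank = bank m + 2 ^ suc (length qs) }

  descend : Memory → MapT → ℕ → List ℕ → Memory × Move
  descend m (nd w F) q qs = goDown m w F
  -- The two `suc` count the head of the list of live ports and the robot itself. Lack of room shows
  -- that some listed branch has been finished (see `roomy`).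
  descend m leaf q qs = if sibT (ctx m) + suc (suc (length qs)) ≤ᵇ k then expand m q qs else climb true m leaf

  decide : Memory → MapT → ℕ → List ℕ → Memory × Move
  decide m s q qs = if exhT (ctx m) (V s) then climb false m s else descend m s q qs

  seek : Memory → (ℕ → Bool) → MapT → ℕ → List ℕ → Memory × Move
  seek m f leaf q qs = climb true m leaf
  seek m f (nd w F) q qs = maybe (λ F′ → decide m (nd w F′) q qs) (climb true m (nd w F)) (prune f F)

  travel : Memory → (ℕ → Bool) → ℕ → List ℕ → Memory × Move
  travel m f q qs = if free m then seek m f (hole m) q qs else decide m (hole m) q qs

  -- A finished anchor is replaced by its parent, whose entry in the map still lists the finished
  -- child; the robot is free until it removes such a branch.
  leave : Memory → Address → Memory
  leave m a with ≡-dec _≟_ a (addrT (ctx m))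
  ... | yes _ = record m { ctx = upC (ctx m) ; hole = upS (ctx m) (hole m) ; free = true ; pend = just (lastPort a) }
  ... | no _ = record m { pend = just (lastPort a) }

  settle : Memory → (ℕ → Bool) → List ℕ → Address → Memory × Move
  -- The root is finished, so all nodes have been visited and the move no longer matters.
  settle m f [] [] = m , up
  settle m f [] (x ∷ a) = leave m (x ∷ a) , up
  settle m f (q ∷ qs) a with ≡-dec _≟_ a (addrT (ctx m))
  ... | yes _ = travel m f q qs
  -- Below its anchor, with only branches left that others explore, the robot walks back to the
  -- anchor.
  ... | no _ = m , up

  act : Memory → Cell → Address → ℕ → Memory × Cell × Move
  act m (cell e f) a c =
    if e <ᵇ c then (clr m , cell (suc e) f′ , down e)
    else (let (m′ , mv) = settle (clr m) f′ (livePorts f′ c) a in m′ , cell e f′ , mv)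
    where f′ = mark (pend m) f

  data ActView (m : Memory) (e : ℕ) (f : ℕ → Bool) (a : Address) (c : ℕ) : Memory × Cell × Move → Set where
    discover : e < c → ActView m e f a c (clr m , cell (suc e) f , down e)
    allDone : c ≤ e → livePorts f c ≡ [] → a ≡ [] → ActView m e f a c (clr m , cell e f , up)
    finishAnchor : c ≤ e → livePorts f c ≡ [] → a ≢ [] → a ≡ addrT (ctx m) →
      ActView m e f a c (record m { ctx = upC (ctx m) ; hole = upS (ctx m) (hole m) ; free = true ; pend = just (lastPort a) } , cell e f , up)
    finishOff : c ≤ e → livePorts f c ≡ [] → a ≢ [] → a ≢ addrT (ctx m) →
      ActView m e f a c (record m { pend = just (lastPort a) } , cell e f , up)
    back : c ≤ e → ∀ q qs → livePorts f c ≡ q ∷ qs → a ≢ addrT (ctx m) → ActView m e f a c (clr m , cell e f , up)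
    trav : c ≤ e → ∀ q qs → livePorts f c ≡ q ∷ qs → a ≡ addrT (ctx m) →
      ActView m e f a c (proj₁ (travel (clr m) f q qs) , cell e f , proj₂ (travel (clr m) f q qs))

  act-view : ∀ m e f a c → ActView m e (mark (pend m) f) a c (act m (cell e f) a c)
  act-view m e f a c with e <ᵇ c in lt
  ... | true = discover (<ᵇ-true e c lt)
  ... | false with livePorts (mark (pend m) f) c in eq
  act-view m e f [] c | false | [] = allDone (<ᵇ-false e c lt) eq refl
  act-view m e f (x ∷ a) c | false | [] with ≡-dec _≟_ (x ∷ a) (addrT (ctx m))
  ... | yes p = finishAnchor (<ᵇ-false e c lt) eq (λ ()) p
  ... | no p = finishOff (<ᵇ-false e c lt) eq (λ ()) p
  act-view m e f a c | false | q ∷ qs with ≡-dec _≟_ a (addrT (ctx m))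
  ... | yes p = trav (<ᵇ-false e c lt) q qs eq p
  ... | no p = back (<ᵇ-false e c lt) q qs eq p

  module Inv (nc ex : Address → ℕ) (fn : Address → ℕ → Bool) where

    -- Unfinished ports must be listed, but a listed port may be finished meanwhile without the
    -- robot's knowledge. The `suc` in `cap` is the robot itself.
    record N (a : Address) (n : ℕ) (ps : List ℕ) : Set where
      field
        cap  : suc (n + length ps) ≤ k
        full : nc a ≤ ex a
        real : All (_< nc a) ps
        all  : ∀ {i} → i < nc a → fn a i ≡ false → i ∈ ps
        uniq : Unique ps

    open Good N public
    open Lam N (λ h → ≤-trans (n≤1+n _) (N.cap h)) public

    DeadF : Address → MapF → Set
    DeadF a F = Σ ℕ λ i → i ∈ ports F × fn a i ≡ true

    DeadS : Address → MapT → Set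
    DeadS a leaf = ⊥
    DeadS a (nd w F) = DeadF a F

    -- Finished branches that the map still lists beside the path to the hole. As `top` has none, a
    -- robot that climbs towards one is not at the root.
    DeadCT : CtxT → Set
    DeadCF : CtxF → Set
    DeadCT top = ⊥
    DeadCT (inOne i c) = DeadCF c
    DeadCT (inMore i F c) = DeadF (addrF c) F ⊎ DeadCF c
    DeadCF (inNd w c) = DeadCT c
    DeadCF (inTail j t c) = fn (addrF c) j ≡ true ⊎ DeadCF c

    Dead : CtxT → MapT → Set
    Dead c s = DeadS (addrT c) s ⊎ DeadCT c

    dead-close : ∀ c F → DeadF (addrF c) F ⊎ DeadCF c → Dead (closeC c) (closeT c F)
    dead-close (inNd w c) F h = h
    dead-close (inTail j t c) F (inj₁ (i , i∈ , e)) = dead-close c (more j t F) (inj₁ (i , there i∈ , e))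
    dead-close (inTail j t c) F (inj₂ (inj₁ e)) = dead-close c (more j t F) (inj₁ (j , here refl , e))
    dead-close (inTail j t c) F (inj₂ (inj₂ h)) = dead-close c (more j t F) (inj₂ h)

    dead-up : ∀ c s → DeadCT c → Dead (upC c) (upS c s)
    dead-up (inOne i c) s h = dead-close c (one i s) (inj₂ h)
    dead-up (inMore i F c) s (inj₁ (j , j∈ , e)) = dead-close c (more i s F) (inj₁ (j , there j∈ , e))
    dead-up (inMore i F c) s (inj₂ h) = dead-close c (more i s F) (inj₂ h)

    close-ports : ∀ c F {i} → i ∈ ports F → i ∈ ports (closeL c F)
    close-ports (inNd w c) F h = h
    close-ports (inTail j t c) F h = close-ports c (more j t F) (there h)

    portsT : MapT → List ℕ
    portsT leaf = []
    portsT (nd w F) = ports F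

    up-addr : ∀ c s → addrT c ≢ [] → Σ ℕ λ i → addrT c ≡ addrT (upC c) ++ [ i ] × i ∈ portsT (upS c s)
    up-addr top s ne = ⊥-elim (ne refl)
    up-addr (inOne i c) s ne = i , cong (_++ [ i ]) (sym (addr-close c)) , close-ports c (one i s) (here refl)
    up-addr (inMore i F c) s ne = i , cong (_++ [ i ]) (sym (addr-close c)) , close-ports c (more i s F) (here refl)

    up-dropLast : ∀ c s → addrT c ≢ [] → dropLast (addrT c) ≡ addrT (upC c)
    up-dropLast c s ne = let (i , e , _) = up-addr c s ne in trans (cong dropLast e) (dropLast-snoc (addrT (upC c)) i)

    Gd-anti : ∀ t {a n n′} → n′ ≤ n → GoodT a n t → GoodT a n′ t
    GF-anti : ∀ F {a n n′} → n′ ≤ n → GoodF a n F → GoodF a n′ F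
    Gd-anti leaf le h = tt
    Gd-anti (nd w F) {a} {n} {n′} le (h , hF) =
      record { cap = ≤-trans (s≤s (+-monoˡ-≤ (length (ports F)) le)) (N.cap h) ; full = N.full h ; real = N.real h ; all = N.all h ; uniq = N.uniq h } ,
      GF-anti F (+-monoˡ-≤ (forks F) le) hF
    GF-anti (one i t) le h = Gd-anti t le h
    GF-anti (more i t F) le (h , hF) = Gd-anti t le h , GF-anti F le hF

    GF-Rem : ∀ {F i F′ a n} → Removal F i F′ → GoodF a n F → GoodF a n F′
    GF-Rem hd (h , hF) = hF
    GF-Rem last (h , hF) = h
    GF-Rem (tl r) (h , hF) = h , GF-Rem r hF

    Gd-Rem : ∀ {w F i F′ a n} → Removal F i F′ → fn a i ≡ true → GoodT a n (nd w F) → GoodT a n (nd w F′)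
    Gd-Rem {w} {F} {i} {F′} {a} {n} r e (h , hF) =
      record
        { cap = ≤-trans (s≤s (+-monoʳ-≤ n (≤-trans (n≤1+n _) (≤-reflexive (sym len))))) (N.cap h)
        ; full = N.full h
        ; real = Rem-All r (N.real h)
        ; all = λ {j} lt ej → Rem-ports r (N.all h lt ej) (λ { refl → case-bool (trans (sym e) ej) })
        ; uniq = Rem-Unique r (N.uniq h) } ,
      GF-anti F′ (+-monoʳ-≤ n (≤-trans (n≤1+n _) (≤-reflexive (sym (fk-Rem r))))) (GF-Rem r hF)
      where
      case-bool : true ≡ false → ⊥
      case-bool ()
      len : length (ports F) ≡ suc (length (ports F′))
      len = trans (len-ports F) (trans (cong suc (fk-Rem r)) (cong suc (sym (len-ports F′))))

    GF-leaves : ∀ i js a n → GoodF a n (leaves i js)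
    GF-leaves i [] a n = tt
    GF-leaves i (j ∷ js) a n = tt , GF-leaves j js a n

    -- A free robot owes nothing for a descent: the removal that ends its climb pays for the next
    -- one, by `rem-cost`.
    phaseOf : Bool → CtxT → MapT → ℕ
    phaseOf true c s = 0
    phaseOf false c s = phase c s

    record Account (c : CtxT) (s : MapT) (fr : Bool) (n b : ℕ) : Set where
      field
        good : GoodT [] 0 (plugT c s)
        paid : cost n c s + phaseOf fr c s ≤ 16 * k * W * b
        grow : 2 * k ^ k * b + W ≤ V (plugT c s)

    AccountOf : Memory → Set
    AccountOf m = Account (ctx m) (hole m) (free m) (moves m) (bank m)

    -- A child list is worth at most its first branch, so a single path is followed. A level adds at
    -- most `2 * W` because the bonus is cut off at `W`.
    V-depth : ∀ T → (∀ a → numChildren T a ≡ nc a) → ∀ t a n u → subtree T a ≡ just u → GoodT a n t → V t ≤ W + 2 * W * depth u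
    V-depth T enc leaf a n u e h = m≤m+n W _
    V-depth T enc (nd w F) a n (node ts) e (h , hF) = first F (N.real h) hF
      where
      len : nc a ≡ length ts
      len rewrite sym (enc a) | e = refl
      child : ∀ v i t n → v ≤ V t → i < nc a → GoodT (a ++ [ i ]) n t → W + (w ⊓ W) + v ≤ W + 2 * W * depth (node ts)
      child v i t n v≤ lt ht with subtree-snoc T a ts i e (subst (i <_) len lt)
      ... | u , eu , du = begin
        W + (w ⊓ W) + v               ≤⟨ +-mono-≤ (+-monoʳ-≤ W (m⊓n≤n w W)) (≤-trans v≤ (V-depth T enc t (a ++ [ i ]) n u eu ht)) ⟩
        W + W + (W + 2 * W * depth u) ≡⟨ eq W (depth u) ⟩
        W + 2 * W * suc (depth u)     ≤⟨ +-monoʳ-≤ W (*-monoʳ-≤ (2 * W) du) ⟩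
        W + 2 * W * depth (node ts)   ∎
        where
        open ≤-Reasoning
        eq : ∀ w d → w + w + (w + 2 * w * d) ≡ w + 2 * w * suc d
        eq = solve-∀
      first : ∀ F {n} → All (_< nc a) (ports F) → GoodF a n F → W + (w ⊓ W) + VF F ≤ W + 2 * W * depth (node ts)
      first (one i t) (lt ∷ _) ht = child (V t) i t _ ≤-refl lt ht
      first (more i t F) (lt ∷ _) (ht , _) = child (g (V t) (VF F)) i t _ (g≤ˡ (V t) (VF F)) lt ht

    data Out (m : Memory) (a : Address) : Memory × Move → Set where
      went-up : ∀ {m′} → AccountOf m′ → (free m′ ≡ true → Dead (ctx m′) (hole m′)) → grp m′ ≡ grp m → pend m′ ≡ pend m →
        moves m′ ≡ moves m → a ≢ [] → dropLast a ≡ addrT (ctx m′) → Out m a (m′ , up)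
      went-down : ∀ {m′ i} → AccountOf m′ → free m′ ≡ false → grp m′ ≡ grp m → pend m′ ≡ pend m →
        moves m′ ≡ suc (moves m) → i < nc a → addrT (ctx m′) ≡ a ++ [ i ] → Out m a (m′ , down i)

    PI-up-free : ∀ {c s fr n b} → Account c s fr n b → Account (upC c) (upS c s) true n b
    PI-up-free {c} {s} {fr} {n} {b} pi = record
      { good = subst (GoodT [] 0) (sym (plug-up c s)) (Account.good pi)
      ; paid = ≤-trans (+-monoˡ-≤ 0 (up-free n c s)) (≤-trans (+-monoʳ-≤ (cost n c s) z≤n) (Account.paid pi))
      ; grow = subst (λ t → 2 * k ^ k * b + W ≤ V t) (sym (plug-up c s)) (Account.grow pi) }

    up-nd : ∀ c s → c ≢ top → Σ ℕ λ w → Σ MapF λ F → upS c s ≡ nd w F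
    up-nd top s ne = ⊥-elim (ne refl)
    up-nd (inOne i c) s ne = _ , _ , refl
    up-nd (inMore i F c) s ne = _ , _ , refl

    ex⇒≢top : ∀ c v → exhT c v ≡ true → c ≢ top
    ex⇒≢top top v () refl

    PI-up : ∀ c s {n b} → exhT c (V s) ≡ true → Account c s false n b → Account (upC c) (upS c s) false n b
    PI-up c s {n} {b} e pi with upS c s in eq | up-nd c s (ex⇒≢top c (V s) e)
    ... | _ | w , F , refl = record
      { good = gd′
      ; paid = ≤-trans (subst (λ z → cost n (upC c) z + phase (upC c) z ≤ cost n c s + phase c s) eq
                 (up-cost n c s e (subst (λ z → W * greedyT z ≤ 2 * lastVal z + 2 * k * W) (sym eq)
                   (lam-bound w F (addrT (upC c)) (sibT (upC c)) (Gd-in (upC c) (nd w F) gd′))))) (Account.paid pi)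
      ; grow = subst (λ t → 2 * k ^ k * b + W ≤ V t) (sym pl) (Account.grow pi) }
      where
      pl : plugT (upC c) (nd w F) ≡ plugT c s
      pl = trans (cong (plugT (upC c)) (sym eq)) (plug-up c s)
      gd′ : GoodT [] 0 (plugT (upC c) (nd w F))
      gd′ = subst (GoodT [] 0) (sym pl) (Account.good pi)

    PI-down : ∀ c w F {n b} → exhT c (V (nd w F)) ≡ false → Account c (nd w F) false n b →
      Account (descC (inNd w c) F) (descS (inNd w c) F) false (suc n) b
    PI-down c w F {n} {b} e pi = record
      { good = subst (GoodT [] 0) (sym pl) (Account.good pi)
      ; paid = ≤-trans (down-cost n c w F e) (Account.paid pi)
      ; grow = subst (λ t → 2 * k ^ k * b + W ≤ V t) (sym pl) (Account.grow pi) }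
      where pl = desc-plug (inNd w c) F

    PI-prune : ∀ c w {F i F′ n b} → Removal F i F′ → fn (addrT c) i ≡ true → Account c (nd w F) true n b → Account c (nd w F′) false n b
    PI-prune c w {F} {i} {F′} {n} {b} r e pi = record
      { good = Gd-re c (nd w F) (nd w F′) (Account.good pi) (Gd-Rem {w = w} r e (Gd-in c (nd w F) (Account.good pi)))
      ; paid = ≤-trans (rem-cost n c w r) (≤-trans (m≤m+n _ 0) (Account.paid pi))
      ; grow = ≤-trans (Account.grow pi) (rem-gain c w r) }

    PI-expand : ∀ c q qs {n b} → exhT c W ≡ false → sibT c + suc (suc (length qs)) ≤ k →
      nc (addrT c) ≤ ex (addrT c) → livePorts (fn (addrT c)) (nc (addrT c)) ≡ q ∷ qs →
      Account c leaf false n b → Account c (fresh q qs) false n (b + 2 ^ suc (length qs))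
    PI-expand c q qs {n} {b} e cap full lv pi = record
      { good = Gd-re c leaf (fresh q qs) (Account.good pi) (nn , GF-leaves q qs _ _)
      ; paid = ≤-trans (expand-cost n c q qs cap) (≤-trans (+-monoˡ-≤ X (≤-trans (m≤m+n _ _) (Account.paid pi))) (≤-reflexive (sym (*-distribˡ-+ (16 * k * W) b (2 ^ suc (length qs))))))
      ; grow = ≤-trans (≤-reflexive (eq (2 * k ^ k) b (2 ^ suc (length qs)) W)) (≤-trans (+-monoˡ-≤ (2 * k ^ k * 2 ^ suc (length qs)) (Account.grow pi)) (expand-gain c q qs refl e cap)) }
      where
      X = 16 * k * W * 2 ^ suc (length qs)
      eq : ∀ a b x w → a * (b + x) + w ≡ a * b + w + a * x
      eq = solve-∀
      a = addrT c
      f = fn a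
      nn : N a (sibT c) (ports (leaves q qs))
      nn rewrite ports-leaves q qs = record
        { cap = ≤-trans (≤-reflexive (sym (+-suc (sibT c) (suc (length qs))))) cap
        ; full = full
        ; real = All.tabulate (λ {i} i∈ → proj₁ (live-sound f (nc a) (subst (i ∈_) (sym lv) i∈)))
        ; all = λ {i} lt ef → subst (i ∈_) lv (live-complete f (nc a) lt ef)
        ; uniq = subst Unique lv (live-unique f (nc a)) }

    up-out : ∀ m s b → let m′ = record m { ctx = upC (ctx m) ; hole = upS (ctx m) s ; free = b } in
      AccountOf m′ → (b ≡ true → Dead (upC (ctx m)) (upS (ctx m) s)) → ctx m ≢ top → Out m (addrT (ctx m)) (climb b m s)
    up-out m s b pi dd ne = went-up pi dd refl refl refl ne′ (up-dropLast (ctx m) s ne′)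
      where
      nonroot : ∀ c → c ≢ top → addrT c ≢ []
      nonroot top h = ⊥-elim (h refl)
      nonroot (inOne i c) h = snoc≢[] (addrF c) i
      nonroot (inMore i F c) h = snoc≢[] (addrF c) i
      ne′ = nonroot (ctx m) ne

    down-out : ∀ m w F → exhT (ctx m) (V (nd w F)) ≡ false → Account (ctx m) (nd w F) false (moves m) (bank m) →
      Out m (addrT (ctx m)) (goDown m w F)
    down-out m w F e pi = went-down (PI-down (ctx m) w F e pi) refl refl refl refl
      (All.lookup (N.real (proj₁ (Gd-in (ctx m) (nd w F) (Account.good pi)))) (proj₁ (proj₂ da))) (proj₂ (proj₂ da))
      where da = desc-addr (inNd w (ctx m)) F

    Out-bank : ∀ {m a r} b → Out (record m { bank = b }) a r → Out m a r
    Out-bank b (went-up p d g′ e mv ne dl) = went-up p d g′ e mv ne dl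
    Out-bank b (went-down p fr g′ e mv lt ad) = went-down p fr g′ e mv lt ad

    module Decide (m : Memory) (q : ℕ) (qs : List ℕ) (full : nc (addrT (ctx m)) ≤ ex (addrT (ctx m)))
                  (lv : livePorts (fn (addrT (ctx m))) (nc (addrT (ctx m))) ≡ q ∷ qs)
                  (room : DeadCT (ctx m) ⊎ sibT (ctx m) + suc (suc (length qs)) ≤ k) where

      dead≢top : ∀ c → DeadCT c → c ≢ top
      dead≢top top () refl

      expand-out : exhT (ctx m) W ≡ false → sibT (ctx m) + suc (suc (length qs)) ≤ k →
        Account (ctx m) leaf false (moves m) (bank m) → Out m (addrT (ctx m)) (expand m q qs)
      expand-out e cap pi with exhT (ctx m) (V (fresh q qs)) in e′
      ... | true = Out-bank (bank m + 2 ^ suc (length qs)) (up-out m′ (fresh q qs) false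
                     (PI-up (ctx m) (fresh q qs) e′ (PI-expand (ctx m) q qs e cap full lv pi)) (λ ()) (ex⇒≢top (ctx m) _ e′))
        where m′ = record m { bank = bank m + 2 ^ suc (length qs) }
      ... | false = Out-bank (bank m + 2 ^ suc (length qs)) (down-out m′ (W ∸ VF (leaves q qs)) (leaves q qs) e′ (PI-expand (ctx m) q qs e cap full lv pi))
        where m′ = record m { bank = bank m + 2 ^ suc (length qs) }

      -- When the test fails, the alternative offered by `room` is a finished branch beside the
      -- path, so the free climb has a goal.
      crowded : (sibT (ctx m) + suc (suc (length qs)) ≤ᵇ k) ≡ false →
        DeadCT (ctx m) ⊎ sibT (ctx m) + suc (suc (length qs)) ≤ k →
        Account (ctx m) leaf false (moves m) (bank m) → Out m (addrT (ctx m)) (climb true m leaf)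
      crowded cap (inj₁ d) pi = up-out m leaf true (PI-up-free pi) (λ _ → dead-up (ctx m) leaf d) (dead≢top (ctx m) d)
      crowded cap (inj₂ r) pi = ⊥-elim (subst T cap (≤⇒≤ᵇ r))

      decide-out : ∀ s → Account (ctx m) s false (moves m) (bank m) → Out m (addrT (ctx m)) (decide m s q qs)
      decide-out s pi with exhT (ctx m) (V s) in e
      ... | true = up-out m s false (PI-up (ctx m) s e pi) (λ ()) (ex⇒≢top (ctx m) _ e)
      decide-out (nd w F) pi | false = down-out m w F e pi
      decide-out leaf pi | false with sibT (ctx m) + suc (suc (length qs)) ≤ᵇ k in cap
      ... | true = expand-out e (≤ᵇ-true _ _ cap) pi
      ... | false = crowded cap room pi

      travel-out : AccountOf m → (free m ≡ true → Dead (ctx m) (hole m)) → Out m (addrT (ctx m)) (travel m (fn (addrT (ctx m))) q qs)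
      travel-out pi dd with free m in ef | hole m in eh
      ... | false | s = decide-out s pi
      ... | true | leaf with dd refl
      ...   | inj₂ d = up-out m leaf true (PI-up-free pi) (λ _ → dead-up (ctx m) leaf d) (dead≢top (ctx m) d)
      travel-out pi dd | true | nd w F with prune (fn (addrT (ctx m))) F | prune-spec (fn (addrT (ctx m))) F
      ... | just F′ | found r e = decide-out (nd w F′) (PI-prune (ctx m) w r e pi)
      ... | nothing | none h with h | dd refl
      ...   | _ | inj₂ d = up-out m (nd w F) true (PI-up-free pi) (λ _ → dead-up (ctx m) (nd w F) d) (dead≢top (ctx m) d)
      ...   | inj₁ allF | inj₁ (i , i∈ , e) with trans (sym e) (allF i∈)
      ...     | ()
      -- Not all listed ports can be finished: the live port `q` is among them by `N.all`.
      travel-out pi dd | true | nd w F | nothing | none h | inj₂ allT | inj₁ _ with live-sound (fn (addrT (ctx m))) (nc (addrT (ctx m))) (subst (q ∈_) (sym lv) (here refl))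
      ...   | lt , ef′ with trans (sym (allT (N.all (proj₁ (Gd-in (ctx m) (nd w F) (Account.good pi))) lt ef′))) ef′
      ...     | ()

-- Which robots are where, and why local knowledge stays valid.

true≢false : true ≢ false
true≢false ()

¬true⇒false : ∀ {b} → b ≢ true → b ≡ false
¬true⇒false {true} h = ⊥-elim (h refl)
¬true⇒false {false} h = refl

mark-keep : ∀ p f i → f i ≡ true → mark p f i ≡ true
mark-keep nothing f i e = e
mark-keep (just j) f i e with i ≡ᵇ j
... | true = refl
... | false = e

mark-old : ∀ p f i → mark p f i ≡ false → f i ≡ false
mark-old p f i e = ¬true⇒false λ t → true≢false (trans (sym (mark-keep p f i t)) e)

mark-self : ∀ f j → mark (just j) f j ≡ true
mark-self f j rewrite ≡ᵇ-refl j = refl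

mark-new : ∀ p f i → mark p f i ≡ true → f i ≡ true ⊎ p ≡ just i
mark-new nothing f i e = inj₁ e
mark-new (just j) f i e with i ≡ᵇ j in eq
... | true = inj₂ (cong just (sym (≡ᵇ-true i j eq)))
... | false = inj₁ e

-- A finished subtree counts as occupied until the robot has recorded that in its parent.
reach : Memory → Address → Address
reach m p = p ++ maybe [_] [] (pend m)

pre-reach : ∀ m p → pre p (reach m p) ≡ true
pre-reach m p = pre-++ p _

pre-last : ∀ x i a p → pre (x ++ [ i ]) (a ++ [ p ]) ≡ true → pre (x ++ [ i ]) a ≡ true ⊎ (x ≡ a × i ≡ p)
pre-last [] i [] p e with i ≡ᵇ p in eq
... | true = inj₂ (refl , ≡ᵇ-true i p eq)
pre-last [] i (y ∷ a) p e = inj₁ e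
pre-last (x ∷ xs) i [] p e with x ≡ᵇ p | xs
... | true | [] = ⊥-elim (true≢false (sym e))
... | true | _ ∷ _ = ⊥-elim (true≢false (sym e))
pre-last (x ∷ xs) i (y ∷ a) p e with x ≡ᵇ y in eq
... | true with pre-last xs i a p e
...   | inj₁ h = inj₁ h
...   | inj₂ (h , h′) = inj₂ (cong₂ _∷_ (≡ᵇ-true x y eq) h , h′)

pre-reach-last : ∀ m x i a → pre (x ++ [ i ]) (reach m a) ≡ true → pre (x ++ [ i ]) a ≡ true ⊎ (x ≡ a × pend m ≡ just i)
pre-reach-last m x i a e with pend m
... | nothing rewrite ++-identityʳ a = inj₁ e
... | just p with pre-last x i a p e
...   | inj₁ h = inj₁ h
...   | inj₂ (h , refl) = inj₂ (h , refl)

sumP : List ℕ → (ℕ → ℕ) → ℕ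
sumP [] f = 0
sumP (p ∷ ps) f = f p + sumP ps f

sumP-zero : ∀ ps → sumP ps (λ _ → 0) ≡ 0
sumP-zero [] = refl
sumP-zero (_ ∷ ps) = sumP-zero ps

sumP-length : ∀ ps (f : ℕ → ℕ) → All (λ p → 1 ≤ f p) ps → length ps ≤ sumP ps f
sumP-length [] f [] = z≤n
sumP-length (p ∷ ps) f (h ∷ hs) = +-mono-≤ h (sumP-length ps f hs)

sumP-F : ∀ {n} ps (f : ℕ → Fin n → ℕ) → sumP ps (λ p → sumF (f p)) ≡ sumF (λ r → sumP ps (λ p → f p r))
sumP-F {n} [] f = sym (sumF-zero n)
sumP-F (p ∷ ps) f = trans (cong (sumF (f p) +_) (sumP-F ps f)) (sym (sumF-+ (f p) (λ r → sumP ps (λ q → f q r))))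

b2n : Bool → ℕ
b2n true = 1
b2n false = 0

-- The subtrees of distinct children are disjoint, and all lie below `a`.
sumP-pre : ∀ a x ps → Unique ps → sumP ps (λ p → b2n (pre (a ++ [ p ]) x)) ≤ b2n (pre a x)
sumP-pre a x [] u = z≤n
sumP-pre a x (p ∷ ps) (u ∷ us) with pre (a ++ [ p ]) x in e
... | false = sumP-pre a x ps us
... | true rewrite pre-snoc a p x e = ≤-reflexive (cong suc (zero-sum ps u))
  where
  zero-sum : ∀ ps → All (p ≢_) ps → sumP ps (λ q → b2n (pre (a ++ [ q ]) x)) ≡ 0
  zero-sum [] [] = refl
  zero-sum (q ∷ qs) (ne ∷ nes) with pre (a ++ [ q ]) x in e′
  ... | true = ⊥-elim (ne (pre-snoc-unique a p q x e e′))
  ... | false = zero-sum qs nes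

tok : Maybe Memory → Address → ℕ → Address → ℕ
tok nothing p j a = 0
tok (just m) p j a = if grp m ≡ᵇ j then b2n (pre a (reach m p)) else 0

sumP-tok : ∀ μ p j a ps → Unique ps → sumP ps (λ q → tok μ p j (a ++ [ q ])) ≤ tok μ p j a
sumP-tok nothing p j a ps u = ≤-reflexive (sumP-zero ps)
sumP-tok (just m) p j a ps u with grp m ≡ᵇ j
... | true = sumP-pre a (reach m p) ps u
... | false = ≤-reflexive (sumP-zero ps)

-- Other robots alter the records of the group behind a robot's back, but only by adding to them,
-- and all that a map claims survives additions.
module Mono (k : ℕ) .{{_ : NonZero k}} (nc ex ex′ : Address → ℕ) (fn fn′ : Address → ℕ → Bool)
            (ex≤ : ∀ a → ex a ≤ ex′ a) (fn≤ : ∀ a i → fn a i ≡ true → fn′ a i ≡ true) where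
  open Rule k
  module A = Inv nc ex fn
  module B = Inv nc ex′ fn′

  Gd-mono : ∀ t {a n} → A.GoodT a n t → B.GoodT a n t
  GF-mono : ∀ F {a n} → A.GoodF a n F → B.GoodF a n F
  Gd-mono leaf h = tt
  Gd-mono (nd w F) {a} (h , hF) = record
    { cap = A.N.cap h ; full = ≤-trans (A.N.full h) (ex≤ a) ; real = A.N.real h
    ; all = λ {i} lt e → A.N.all h lt (¬true⇒false λ t → true≢false (trans (sym (fn≤ a i t)) e))
    ; uniq = A.N.uniq h } , GF-mono F hF
  GF-mono (one i t) h = Gd-mono t h
  GF-mono (more i t F) (h , hF) = Gd-mono t h , GF-mono F hF

  PI-mono : ∀ {c s fr n b} → A.Account c s fr n b → B.Account c s fr n b
  PI-mono {c} {s} {true} pi = record { good = Gd-mono (plugT c s) (A.Account.good pi) ; paid = A.Account.paid pi ; grow = A.Account.grow pi }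
  PI-mono {c} {s} {false} pi = record { good = Gd-mono (plugT c s) (A.Account.good pi) ; paid = A.Account.paid pi ; grow = A.Account.grow pi }

  DeadF-mono : ∀ {a F} → A.DeadF a F → B.DeadF a F
  DeadF-mono {a} (i , i∈ , e) = i , i∈ , fn≤ a i e

  DeadCT-mono : ∀ c → A.DeadCT c → B.DeadCT c
  DeadCF-mono : ∀ c → A.DeadCF c → B.DeadCF c
  DeadCT-mono (inOne i c) h = DeadCF-mono c h
  DeadCT-mono (inMore i F c) (inj₁ h) = inj₁ (DeadF-mono {addrF c} {F} h)
  DeadCT-mono (inMore i F c) (inj₂ h) = inj₂ (DeadCF-mono c h)
  DeadCF-mono (inNd w c) h = DeadCT-mono c h
  DeadCF-mono (inTail j t c) (inj₁ h) = inj₁ (fn≤ (addrF c) j h)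
  DeadCF-mono (inTail j t c) (inj₂ h) = inj₂ (DeadCF-mono c h)

  Dead-mono : ∀ c s → A.Dead c s → B.Dead c s
  Dead-mono c (nd w F) (inj₁ h) = inj₁ (DeadF-mono {addrT c} {F} h)
  Dead-mono c s (inj₂ h) = inj₂ (DeadCT-mono c h)

-- Every branch off the path of the anchor that is not finished contains a robot, and branches are disjoint, so
-- there are fewer open forks than robots unless some branch is finished.
module Count (k : ℕ) .{{_ : NonZero k}} (nc ex : Address → ℕ) (fn : Address → ℕ → Bool) (cnt : Address → ℕ)
             (split : ∀ a ps → Unique ps → sumP ps (λ p → cnt (a ++ [ p ])) ≤ cnt a)
             (occ : ∀ a i → i < ex a → fn a i ≡ false → 1 ≤ cnt (a ++ [ i ])) where
  open Rule k
  open Inv nc ex fn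

  deadF? : ∀ a F → DeadF a F ⊎ All (λ i → fn a i ≡ false) (ports F)
  deadF? a (one i t) with fn a i in e
  ... | true = inj₁ (i , here refl , e)
  ... | false = inj₂ (e ∷ [])
  deadF? a (more i t F) with fn a i in e
  ... | true = inj₁ (i , here refl , e)
  ... | false with deadF? a F
  ...   | inj₁ (j , j∈ , e′) = inj₁ (j , there j∈ , e′)
  ...   | inj₂ h = inj₂ (e ∷ h)

  occs : ∀ a ps → nc a ≤ ex a → All (_< nc a) ps → All (λ i → fn a i ≡ false) ps → All (λ p → 1 ≤ cnt (a ++ [ p ])) ps
  occs a [] full [] [] = []
  occs a (p ∷ ps) full (lt ∷ lts) (e ∷ es) = occ a p (≤-trans lt full) e ∷ occs a ps full lts es

  nodeOf : ∀ c F → GoodT [] 0 (plugF c F) → nc (addrF c) ≤ ex (addrF c) × All (_< nc (addrF c)) (ports F)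
  nodeOf (inNd w c) F h = let h′ = proj₁ (Gd-in c (nd w F) h) in N.full h′ , N.real h′
  nodeOf (inTail j t c) F h = let (a , b) = nodeOf c (more j t F) h in a , All.tail b

  countT : ∀ c s → GoodT [] 0 (plugT c s) → DeadCT c ⊎ (sibT c + cnt (addrT c) ≤ cnt [])
  -- Here `x` stands for the robots in the branch that contains the hole, and `forks F` for one
  -- robot in each other branch met so far at this node.
  countF : ∀ c F x → GoodT [] 0 (plugF c F) → forks F + x ≤ sumP (ports F) (λ p → cnt (addrF c ++ [ p ])) →
    DeadCF c ⊎ (sibF c (forks F) + x ≤ cnt [])
  countT top s h = inj₂ ≤-refl
  countT (inOne i c) s h = countF c (one i s) (cnt (addrF c ++ [ i ])) h (m≤m+n _ 0)
  countT (inMore i F c) s h with deadF? (addrF c) F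
  ... | inj₁ d = inj₁ (inj₁ d)
  ... | inj₂ al with countF c (more i s F) (cnt (addrF c ++ [ i ])) h sum≤
    where
    nn = nodeOf c (more i s F) h
    sum≤ : suc (forks F) + cnt (addrF c ++ [ i ]) ≤ cnt (addrF c ++ [ i ]) + sumP (ports F) (λ p → cnt (addrF c ++ [ p ]))
    sum≤ = ≤-trans (≤-reflexive (+-comm (suc (forks F)) _)) (+-monoʳ-≤ (cnt (addrF c ++ [ i ]))
      (≤-trans (≤-reflexive (sym (len-ports F))) (sumP-length (ports F) _ (occs (addrF c) (ports F) (proj₁ nn) (All.tail (proj₂ nn)) al))))
  ...   | inj₁ d = inj₁ (inj₂ d)
  ...   | inj₂ r = inj₂ r
  countF (inNd w c) F x h le with countT c (nd w F) h
  ... | inj₁ d = inj₁ d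
  ... | inj₂ r = inj₂ (≤-trans (≤-reflexive (+-assoc (sibT c) (forks F) x)) (≤-trans (+-monoʳ-≤ (sibT c) (≤-trans le
          (split (addrT c) (ports F) (N.uniq (proj₁ (Gd-in c (nd w F) h)))))) r))
  countF (inTail j t c) F x h le with fn (addrF c) j in e
  ... | true = inj₁ (inj₁ refl)
  ... | false with countF c (more j t F) x h (+-mono-≤ (occ (addrF c) j (≤-trans (All.head (proj₂ nn)) (proj₁ nn)) e) le)
    where nn = nodeOf c (more j t F) h
  ...   | inj₁ d = inj₁ (inj₂ d)
  ...   | inj₂ r = inj₂ r

-- The invariant of the whole system and its preservation.

movesOf : Maybe Memory → ℕ
movesOf nothing = 0
movesOf (just m) = moves m

seated : Maybe Memory → ℕ
seated nothing = 0
seated (just m) = 1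

tok-[] : ∀ μ p p′ j → tok μ p j [] ≡ tok μ p′ j []
tok-[] nothing p p′ j = refl
tok-[] (just m) p p′ j = refl

tok-self : ∀ m p x → tok (just m) p (grp m) x ≡ b2n (pre x (reach m p))
tok-self m p x rewrite ≡ᵇ-refl (grp m) = refl

record State (K : ℕ) : Set where
  field
    ps : Fin K → Address
    ms : Fin K → Maybe Memory
    ce : ℕ → Address → Cell
    sl : ℕ × ℕ
open State public

module System (κ : ℕ) .{{_ : NonZero κ}} (K G : ℕ) (T : Tree) where

  open Rule κ public

  nc : Address → ℕ
  nc = numChildren T

  module I (ce : ℕ → Address → Cell) (j : ℕ) = Inv nc (λ a → expl (ce j a)) (λ a → fin (ce j a))

  -- Speaks of one node only; that everything below it has been visited follows by descending with
  -- `clos`, as in `closed-all`.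
  record Closed (Vis : Address → Set) (ce : ℕ → Address → Cell) (j : ℕ) (x : Address) : Set where
    field
      whole : nc x ≤ expl (ce j x)
      ended : ∀ i → i < nc x → fin (ce j x) i ≡ true
      seen  : Vis x

  record Within (S : State K) (j : ℕ) (x : Address) (r : Fin K) : Set where
    constructor within
    field
      {mm} : Memory
      hasM : ms S r ≡ just mm
      hasG : grp mm ≡ j
      isIn : pre x (reach mm (ps S r)) ≡ true

  record RobotInv (Vis : Address → Set) (ce : ℕ → Address → Cell) (p : Address) (m : Memory) : Set where
    field
      pers : I.AccountOf ce (grp m) m
      near : pre (addrT (ctx m)) p ≡ true
      -- The first alternative is the moment after finishing an anchor: the branch becomes dead only
      -- when the port carried along is written at the new anchor.
      dead : free m ≡ true → (p ≡ addrT (ctx m) × Σ ℕ λ i → pend m ≡ just i × i ∈ I.portsT ce (grp m) (hole m))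
                             ⊎ I.Dead ce (grp m) (ctx m) (hole m)
      pnd  : ∀ i → pend m ≡ just i → i < nc p × Closed Vis ce (grp m) (p ++ [ i ])
      grpG : grp m < G

  cnt : State K → ℕ → Address → ℕ
  cnt S j a = sumF (λ r → tok (ms S r) (ps S r) j a)

  record Invariant (Vis : Address → Set) (t : ℕ) (S : State K) : Set where
    field
      home   : ∀ r → ms S r ≡ nothing → ps S r ≡ []
      isnode : ∀ r → IsNode T (ps S r)
      small  : ∀ j a → expl (ce S j a) ≤ nc a
      -- A branch entered and not recorded as finished is always occupied by its group; the count of
      -- open forks rests on this.
      wit    : ∀ j a i → i < expl (ce S j a) → fin (ce S j a) i ≡ false → Σ (Fin K) (Within S j (a ++ [ i ]))
      clos   : ∀ j a i → i < nc a → fin (ce S j a) i ≡ true → Closed Vis (ce S) j (a ++ [ i ])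
      robs   : ∀ r m → ms S r ≡ just m → RobotInv Vis (ce S) (ps S r) m
      seat<  : ∀ j → j < proj₁ (sl S) → cnt S j [] ≤ κ
      seat≡  : cnt S (proj₁ (sl S)) [] ≤ proj₂ (sl S)
      seat>  : ∀ j → proj₁ (sl S) < j → cnt S j [] ≡ 0
      rem<   : proj₂ (sl S) < κ
      -- Keeps group numbers below `G`: a new group is opened only after `κ` enrolments in the
      -- previous one.
      used   : proj₁ (sl S) * κ + proj₂ (sl S) ≤ sumF (λ r → seated (ms S r))
      -- Each downward move prepays its return: it adds 2 on the right and deepens one robot by 1,
      -- and an upward move spends that 1.
      time   : t + sumF (λ r → length (ps S r)) ≤ 2 * sumT T (λ a → sumN G (λ j → expl (ce S j a))) + 2 * sumF (λ r → movesOf (ms S r))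

  seat≤ : ∀ {Vis t S} → Invariant Vis t S → ∀ j → cnt S j [] ≤ κ
  seat≤ {S = S} inv j with <-cmp j (proj₁ (sl S))
  ... | tri< lt _ _ = Invariant.seat< inv j lt
  ... | tri≈ _ refl _ = ≤-trans (Invariant.seat≡ inv) (<⇒≤ (Invariant.rem< inv))
  ... | tri> _ _ gt = ≤-trans (≤-reflexive (Invariant.seat> inv j gt)) z≤n

  closed-all : ∀ {Vis ce j} → (∀ a i → i < nc a → fin (ce j a) i ≡ true → Closed Vis ce j (a ++ [ i ])) →
    Closed Vis ce j [] → ∀ a → IsNode T a → Closed Vis ce j a
  closed-all {Vis} {ce} {j} cl root = snoc-rec (λ a → IsNode T a → Closed Vis ce j a) (λ _ → root)
    (λ a i ih isN → cl a i (IsNode-child T a i isN) (Closed.ended (ih (IsNode-init T a i isN)) i (IsNode-child T a i isN)))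

  Closed-mono : ∀ {Vis Vis′ ce ce′ j x} → (∀ x → Vis x → Vis′ x) → expl (ce j x) ≤ expl (ce′ j x) →
    (∀ i → fin (ce j x) i ≡ true → fin (ce′ j x) i ≡ true) → Closed Vis ce j x → Closed Vis′ ce′ j x
  Closed-mono {x = x} v e f c = record { whole = ≤-trans (Closed.whole c) e ; ended = λ i lt → f i (Closed.ended c i lt) ; seen = v x (Closed.seen c) }

  within⇒tok : ∀ S j x r → Within S j x r → tok (ms S r) (ps S r) j x ≡ 1
  within⇒tok S j x r (within {m} e refl p) rewrite e | ≡ᵇ-refl (grp m) | p = refl

  sumF-1 : ∀ {n} (f : Fin n → ℕ) r → f r ≡ 1 → 1 ≤ sumF f
  sumF-1 f zero e = ≤-trans (≤-reflexive (sym e)) (m≤m+n (f zero) _)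
  sumF-1 f (suc r) e = ≤-trans (sumF-1 (f ∘ suc) r e) (m≤n+m _ (f zero))

  cnt-split : ∀ S j a ps → Unique ps → sumP ps (λ p → cnt S j (a ++ [ p ])) ≤ cnt S j a
  cnt-split S j a qs u = ≤-trans (≤-reflexive (sumP-F qs (λ q r → tok (ms S r) (ps S r) j (a ++ [ q ]))))
    (sumF-mono _ _ (λ r → sumP-tok (ms S r) (ps S r) j a qs u))

  module Step (Vis Vis′ : Address → Set) (t : ℕ) (S S′ : State K) (inv : Invariant Vis t S) (r : Fin K) (m : Memory) (em : ms S r ≡ just m)
              (vmono : ∀ x → Vis x → Vis′ x) (vhere : Vis′ (ps S r)) where

    a : Address
    a = ps S r
    j₀ : ℕ
    j₀ = grp m
    e : ℕ
    e = expl (ce S j₀ a)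
    f′ : ℕ → Bool
    f′ = mark (pend m) (fin (ce S j₀ a))
    res : Memory × Cell × Move
    res = act m (ce S j₀ a) a (nc a)

    rob : RobotInv Vis (ce S) a m
    rob = Invariant.robs inv r m em

    -- The effect of one activation, stated apart from `Execution`, so that a first activation can
    -- be treated as an enrolment followed by an ordinary step.
    record Next (m′ : Memory) (c′ : Cell) (x′ : Address) : Set where
      field
        slN  : sl S′ ≡ sl S
        ceH  : ce S′ j₀ a ≡ c′
        ceE  : ∀ j x → j ≢ j₀ ⊎ x ≢ a → ce S′ j x ≡ ce S j x
        msH  : ms S′ r ≡ just m′
        msE  : ∀ r′ → r′ ≢ r → ms S′ r′ ≡ ms S r′
        psH  : ps S′ r ≡ x′
        psE  : ∀ r′ → r′ ≢ r → ps S′ r′ ≡ ps S r′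

    module Common (m′ : Memory) (e′ : ℕ) (x′ : Address) (nx : Next m′ (cell e′ f′) x′) (e≤ : e ≤ e′) (gm : grp m′ ≡ j₀) where
      open Next nx

      same? : ∀ j x → (j ≡ j₀ × x ≡ a) ⊎ (j ≢ j₀ ⊎ x ≢ a)
      same? j x with j ≟ j₀ | ≡-dec _≟_ x a
      ... | yes p | yes q = inj₁ (p , q)
      ... | no p | _ = inj₂ (inj₁ p)
      ... | yes _ | no q = inj₂ (inj₂ q)

      ex≤ : ∀ j x → expl (ce S j x) ≤ expl (ce S′ j x)
      ex≤ j x with same? j x
      ... | inj₁ (refl , refl) rewrite ceH = e≤
      ... | inj₂ ne rewrite ceE j x ne = ≤-refl

      fn≤ : ∀ j x i → fin (ce S j x) i ≡ true → fin (ce S′ j x) i ≡ true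
      fn≤ j x i h with same? j x
      ... | inj₁ (refl , refl) rewrite ceH = mark-keep (pend m) _ i h
      ... | inj₂ ne rewrite ceE j x ne = h

      closedM : ∀ {j x} → Closed Vis (ce S) j x → Closed Vis′ (ce S′) j x
      closedM {j} {x} = Closed-mono {ce = ce S} {ce′ = ce S′} vmono (ex≤ j x) (fn≤ j x)

      module Mo (j : ℕ) = Mono κ nc (λ a → expl (ce S j a)) (λ a → expl (ce S′ j a)) (λ a → fin (ce S j a)) (λ a → fin (ce S′ j a)) (ex≤ j) (fn≤ j)

      persM : I.AccountOf (ce S′) j₀ m
      persM = Mo.PI-mono j₀ (RobotInv.pers rob)

      robM : ∀ {p μ} → RobotInv Vis (ce S) p μ → RobotInv Vis′ (ce S′) p μ
      robM {p} {μ} h = record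
        { pers = Mo.PI-mono (grp μ) (RobotInv.pers h)
        ; near = RobotInv.near h
        ; dead = λ fr → deadM (RobotInv.dead h fr)
        ; pnd = λ i ei → proj₁ (RobotInv.pnd h i ei) , closedM (proj₂ (RobotInv.pnd h i ei))
        ; grpG = RobotInv.grpG h }
        where
        pT : ∀ s {i} → i ∈ I.portsT (ce S) (grp μ) s → i ∈ I.portsT (ce S′) (grp μ) s
        pT (nd w F) h = h
        deadM : _ → _
        deadM (inj₁ (x , i , y , z)) = inj₁ (x , i , y , pT (hole μ) z)
        deadM (inj₂ d) = inj₂ (Mo.Dead-mono (grp μ) (ctx μ) (hole μ) d)

      closM : ∀ j x i → i < nc x → fin (ce S′ j x) i ≡ true → Closed Vis′ (ce S′) j (x ++ [ i ])
      closM j x i lt h with same? j x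
      ... | inj₂ ne = closedM (Invariant.clos inv j x i lt (trans (cong (λ z → fin z i) (sym (ceE j x ne))) h))
      ... | inj₁ (refl , refl) with mark-new (pend m) (fin (ce S j₀ a)) i (trans (cong (λ z → fin z i) (sym ceH)) h)
      ...   | inj₁ o = closedM (Invariant.clos inv j₀ a i lt o)
      ...   | inj₂ p = closedM (proj₂ (RobotInv.pnd rob i p))

      withinM : ∀ {j x r′} → r′ ≢ r → Within S j x r′ → Within S′ j x r′
      withinM {j} {x} {r′} ne (within {μ} h₁ h₂ h₃) = within (trans (msE r′ ne) h₁) h₂ (trans (cong (λ z → pre x (reach μ z)) (psE r′ ne)) h₃)

      -- The active robot stands at `a` itself, and a port that it carries has just been marked, so
      -- it cannot be the witness behind an unmarked port.
      other : ∀ i → i < e → f′ i ≡ false → Σ (Fin K) λ r′ → r′ ≢ r × Within S j₀ (a ++ [ i ]) r′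
      other i lt h with Invariant.wit inv j₀ a i lt (mark-old (pend m) _ i h)
      ... | r′ , w@(within {μ} h₁ h₂ h₃) = r′ , ne , w
        where
        ne : r′ ≢ r
        ne refl with just-injective (trans (sym h₁) em)
        ... | refl with pre-reach-last m a i a h₃
        ...   | inj₁ p = true≢false (trans (sym p) (snoc-pre-self a i))
        ...   | inj₂ (_ , p) = true≢false (trans (sym (subst (λ z → mark z (fin (ce S j₀ a)) i ≡ true) (sym p) (mark-self (fin (ce S j₀ a)) i))) h)

      -- Only the active robot can cease to be a witness, and only for branches containing `a`;
      -- these are the first premise, newly entered ports the second.
      witM : (∀ x i → pre (x ++ [ i ]) a ≡ true → Σ (Fin K) (Within S′ j₀ (x ++ [ i ]))) →
             (∀ i → e ≤ i → i < e′ → Σ (Fin K) (Within S′ j₀ (a ++ [ i ]))) →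
             ∀ j x i → i < expl (ce S′ j x) → fin (ce S′ j x) i ≡ false → Σ (Fin K) (Within S′ j (x ++ [ i ]))
      witM above fresh′ j x i lt h with same? j x
      ... | inj₁ (refl , refl) with i <? e
      ...   | yes i<e = let (r′ , ne , w) = other i i<e (trans (cong (λ z → fin z i) (sym ceH)) h) in r′ , withinM ne w
      ...   | no i≮e = fresh′ i (≮⇒≥ i≮e) (subst (λ z → i < expl z) ceH lt)
      witM above fresh′ j x i lt h | inj₂ ne
        with Invariant.wit inv j x i (subst (λ z → i < expl z) (ceE j x ne) lt) (trans (cong (λ z → fin z i) (sym (ceE j x ne))) h)
      ... | r′ , w with r′ ≟F r
      ...   | no ne′ = r′ , withinM ne′ w
      ...   | yes refl with w
      ...     | within {μ} h₁ h₂ h₃ with just-injective (trans (sym h₁) em)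
      ...       | refl with h₂ | pre-reach-last m x i a h₃
      ...         | refl | inj₁ p = above x i p
      ...         | refl | inj₂ (refl , _) with ne
      ...           | inj₁ q = ⊥-elim (q refl)
      ...           | inj₂ q = ⊥-elim (q refl)

      seatM : ∀ j → cnt S′ j [] ≡ cnt S j []
      seatM j = sumF-cong _ _ pt
        where
        pt : ∀ r′ → tok (ms S′ r′) (ps S′ r′) j [] ≡ tok (ms S r′) (ps S r′) j []
        pt r′ with r′ ≟F r
        ... | no ne rewrite msE r′ ne = tok-[] (ms S r′) (ps S′ r′) (ps S r′) j
        ... | yes refl = trans (cong (λ z → tok z (ps S′ r) j []) msH) (trans (cong (λ z → if z ≡ᵇ j then 1 else 0) gm) (sym (cong (λ z → tok z (ps S r) j []) em)))

      usedM : sumF (λ r → seated (ms S′ r)) ≡ sumF (λ r → seated (ms S r))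
      usedM = sumF-cong _ _ pt
        where
        pt : ∀ r′ → seated (ms S′ r′) ≡ seated (ms S r′)
        pt r′ with r′ ≟F r
        ... | no ne rewrite msE r′ ne = refl
        ... | yes refl = trans (cong seated msH) (sym (cong seated em))

      lenM : sumF (λ r → length (ps S′ r)) + length a ≡ sumF (λ r → length (ps S r)) + length x′
      lenM = trans (sumF-upd (λ r → length (ps S r)) (λ r → length (ps S′ r)) r (λ r′ ne → cong length (psE r′ ne)))
               (cong (λ z → sumF (λ r → length (ps S r)) + length z) psH)

      movM : sumF (λ r → movesOf (ms S′ r)) + moves m ≡ sumF (λ r → movesOf (ms S r)) + moves m′
      movM = trans (cong (sumF (λ r → movesOf (ms S′ r)) +_) (sym (cong movesOf em)))
               (trans (sumF-upd (λ r → movesOf (ms S r)) (λ r → movesOf (ms S′ r)) r (λ r′ ne → cong movesOf (msE r′ ne)))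
                 (cong (sumF (λ r → movesOf (ms S r)) +_) (cong movesOf msH)))

      build : IsNode T x′ → e′ ≤ nc a → RobotInv Vis′ (ce S′) x′ m′ →
        (∀ x i → pre (x ++ [ i ]) a ≡ true → Σ (Fin K) (Within S′ j₀ (x ++ [ i ]))) →
        (∀ i → e ≤ i → i < e′ → Σ (Fin K) (Within S′ j₀ (a ++ [ i ]))) →
        suc t + sumF (λ r → length (ps S′ r)) ≤ 2 * sumT T (λ a → sumN G (λ j → expl (ce S′ j a))) + 2 * sumF (λ r → movesOf (ms S′ r)) →
        Invariant Vis′ (suc t) S′
      build isn e′≤ rb above fresh′ tm = record
        { home = homeM
        ; isnode = nodeM
        ; small = smallM
        ; wit = witM above fresh′
        ; clos = closM
        ; robs = robsM
        ; seat< = λ j lt → subst (_≤ κ) (sym (seatM j)) (Invariant.seat< inv j (subst (λ z → j < proj₁ z) slN lt))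
        ; seat≡ = subst₂ (λ y z → y ≤ proj₂ z) (sym (trans (cong (λ z → cnt S′ (proj₁ z) []) slN) (seatM (proj₁ (sl S))))) (sym slN) (Invariant.seat≡ inv)
        ; seat> = λ j lt → trans (seatM j) (Invariant.seat> inv j (subst (λ z → proj₁ z < j) slN lt))
        ; rem< = subst (λ z → proj₂ z < κ) (sym slN) (Invariant.rem< inv)
        ; used = subst₂ (λ z y → proj₁ z * κ + proj₂ z ≤ y) (sym slN) (sym usedM) (Invariant.used inv)
        ; time = tm }
        where
        homeM : ∀ r′ → ms S′ r′ ≡ nothing → ps S′ r′ ≡ []
        homeM r′ h with r′ ≟F r
        ... | no ne = trans (psE r′ ne) (Invariant.home inv r′ (trans (sym (msE r′ ne)) h))
        ... | yes refl with trans (sym msH) h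
        ...   | ()
        nodeM : ∀ r′ → IsNode T (ps S′ r′)
        nodeM r′ with r′ ≟F r
        ... | no ne = subst (IsNode T) (sym (psE r′ ne)) (Invariant.isnode inv r′)
        ... | yes refl = subst (IsNode T) (sym psH) isn
        smallM : ∀ j x → expl (ce S′ j x) ≤ nc x
        smallM j x with same? j x
        ... | inj₁ (refl , refl) rewrite ceH = e′≤
        ... | inj₂ ne rewrite ceE j x ne = Invariant.small inv j x
        robsM : ∀ r′ μ → ms S′ r′ ≡ just μ → RobotInv Vis′ (ce S′) (ps S′ r′) μ
        robsM r′ μ h with r′ ≟F r
        ... | no ne = subst (λ p → RobotInv Vis′ (ce S′) p μ) (sym (psE r′ ne)) (robM (Invariant.robs inv r′ μ (trans (sym (msE r′ ne)) h)))
        ... | yes refl with just-injective (trans (sym msH) h)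
        ...   | refl = subst (λ p → RobotInv Vis′ (ce S′) p m′) (sym psH) rb

    tgt : Move → Address
    tgt mv = destination (neighbours T a) (goto a mv (length (neighbours T a))) a

    Done : Set
    Done = ∀ x → IsNode T x → Vis′ x

    e≤nc : e ≤ nc a
    e≤nc = Invariant.small inv j₀ a

    pre-init : ∀ b → pre b a ≡ true → a ≢ b → a ≢ [] → pre b (dropLast a) ≡ true
    pre-init b h ne ne′ = go (subst (λ z → pre b z ≡ true) (sym (snoc-view a ne′)) h) (λ q → ne (trans (sym (snoc-view a ne′)) q))
      where
      go : ∀ {p i} → pre b (p ++ [ i ]) ≡ true → p ++ [ i ] ≢ b → pre b p ≡ true
      go {p} {i} = loop b p i
        where
        loop : ∀ b p i → pre b (p ++ [ i ]) ≡ true → p ++ [ i ] ≢ b → pre b p ≡ true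
        loop [] p i h ne = refl
        loop (x ∷ b) [] i h ne with x ≡ᵇ i in eq
        loop (x ∷ []) [] i h ne | true = ⊥-elim (ne (cong (_∷ []) (sym (≡ᵇ-true x i eq))))
        loop (x ∷ b) (y ∷ p) i h ne with x ≡ᵇ y in eq
        ... | true = loop b p i h (λ q → ne (cong₂ _∷_ (sym (≡ᵇ-true x y eq)) q))

    module Up (m′ : Memory) (ne : a ≢ []) (gm : grp m′ ≡ j₀) (mm : moves m′ ≡ moves m) (nx : Next m′ (cell e f′) (tgt up)) where
      open Common m′ e (tgt up) nx ≤-refl gm public
      open Next nx

      tgt≡ : tgt up ≡ dropLast a
      tgt≡ = goto-up T a ne

      isnode′ : IsNode T (tgt up)
      isnode′ = subst (IsNode T) (sym tgt≡) (IsNode-init T (dropLast a) (lastPort a) (subst (IsNode T) (sym (snoc-view a ne)) (Invariant.isnode inv r)))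

      exSame : ∀ j x → expl (ce S′ j x) ≡ expl (ce S j x)
      exSame j x with same? j x
      ... | inj₁ (refl , refl) = cong expl ceH
      ... | inj₂ q = cong expl (ceE j x q)

      time′ : suc t + sumF (λ r → length (ps S′ r)) ≤ 2 * sumT T (λ a → sumN G (λ j → expl (ce S′ j a))) + 2 * sumF (λ r → movesOf (ms S′ r))
      time′ = begin
        suc t + L′          ≡⟨ sym (+-suc t L′) ⟩
        t + suc L′          ≡⟨ cong (t +_) eqL ⟩
        t + L               ≤⟨ Invariant.time inv ⟩
        2 * X + 2 * Q       ≡⟨ cong₂ (λ x y → 2 * x + 2 * y) (sumT-cong T _ _ (λ x → sumN-cong G _ _ (λ j _ → sym (exSame j x)))) (+-cancelʳ-≡ (moves m) _ _ (trans (cong (Q +_) (sym mm)) (sym movM))) ⟩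
        2 * sumT T (λ a → sumN G (λ j → expl (ce S′ j a))) + 2 * sumF (λ r → movesOf (ms S′ r)) ∎
        where
        open ≤-Reasoning
        L′ = sumF (λ r → length (ps S′ r))
        L = sumF (λ r → length (ps S r))
        X = sumT T (λ a → sumN G (λ j → expl (ce S j a)))
        Q = sumF (λ r → movesOf (ms S r))
        eqL : suc L′ ≡ L
        eqL = +-cancelʳ-≡ (length (tgt up)) _ _ (trans (sym (+-suc L′ _)) (trans (cong (L′ +_) (trans (cong (suc ∘ length) tgt≡) (length-dropLast a ne))) lenM))

      finishUp : RobotInv Vis′ (ce S′) (tgt up) m′ →
        (∀ x i → pre (x ++ [ i ]) a ≡ true → Σ (Fin K) (Within S′ j₀ (x ++ [ i ]))) → Invariant Vis′ (suc t) S′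
      finishUp rb above = build isnode′ e≤nc rb above (λ i le lt → ⊥-elim (<⇒≱ lt le)) time′

      -- The robot behind the live port `q` takes over as witness for every branch containing `a`.
      watched : ∀ q qs → livePorts f′ (nc a) ≡ q ∷ qs → nc a ≤ e →
        ∀ x i → pre (x ++ [ i ]) a ≡ true → Σ (Fin K) (Within S′ j₀ (x ++ [ i ]))
      watched q qs lv full x i h with live-sound f′ (nc a) (subst (q ∈_) (sym lv) (here refl))
      ... | lt , fq with other q (≤-trans lt full) fq
      ...   | r′ , ne′ , w with withinM ne′ w
      ...     | within {μ} h₁ h₂ h₃ = r′ , within h₁ h₂ (pre-trans (x ++ [ i ]) a _ h (pre-snoc a q _ h₃))

    closedHere : ∀ {ce′ : ℕ → Address → Cell} → ce′ j₀ a ≡ cell e f′ → livePorts f′ (nc a) ≡ [] → nc a ≤ e → Closed Vis′ ce′ j₀ a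
    closedHere {ce′} eq lv full = record
      { whole = subst (λ z → nc a ≤ expl z) (sym eq) full
      ; ended = λ i lt → trans (cong (λ z → fin z i) eq) (ended′ i lt)
      ; seen = vhere }
      where
      ended′ : ∀ i → i < nc a → f′ i ≡ true
      ended′ i lt with f′ i in h
      ... | true = refl
      ... | false with subst (i ∈_) lv (live-complete f′ (nc a) lt h)
      ...   | ()

    do-done : nc a ≤ e → livePorts f′ (nc a) ≡ [] → a ≡ [] → Next (clr m) (cell e f′) (tgt up) → Done
    do-done full lv root nx x xn = Closed.seen (closed-all {ce = ce S′} (closM j₀) (subst (Closed Vis′ (ce S′) j₀) root (closedHere (Next.ceH nx) lv full)) x xn)
      where open Common (clr m) e (tgt up) nx ≤-refl refl

    deadOff : a ≢ addrT (ctx m) → free m ≡ true → I.Dead (ce S) j₀ (ctx m) (hole m)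
    deadOff ne fr with RobotInv.dead rob fr
    ... | inj₁ (p , _) = ⊥-elim (ne p)
    ... | inj₂ d = d

    do-back : nc a ≤ e → ∀ q qs → livePorts f′ (nc a) ≡ q ∷ qs → a ≢ addrT (ctx m) → Next (clr m) (cell e f′) (tgt up) → Invariant Vis′ (suc t) S′
    do-back full q qs lv off nx = finishUp rb (watched q qs lv full)
      where
      ne : a ≢ []
      ne h = off (trans h (sym (empty (addrT (ctx m)) (subst (λ z → pre (addrT (ctx m)) z ≡ true) h (RobotInv.near rob)))))
        where empty : ∀ b → pre b [] ≡ true → b ≡ []
              empty [] _ = refl
      open Up (clr m) ne refl refl nx
      rb : RobotInv Vis′ (ce S′) (tgt up) (clr m)
      rb = record
        { pers = persM
        ; near = subst (λ z → pre (addrT (ctx m)) z ≡ true) (sym tgt≡) (pre-init (addrT (ctx m)) (RobotInv.near rob) off ne)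
        ; dead = λ fr → inj₂ (Mo.Dead-mono j₀ (ctx m) (hole m) (deadOff off fr))
        ; pnd = λ i ()
        ; grpG = RobotInv.grpG rob }

    lastLt : a ≢ [] → lastPort a < nc (dropLast a)
    lastLt ne = IsNode-child T (dropLast a) (lastPort a) (subst (IsNode T) (sym (snoc-view a ne)) (Invariant.isnode inv r))

    do-finishOff : nc a ≤ e → livePorts f′ (nc a) ≡ [] → a ≢ [] → a ≢ addrT (ctx m) →
      Next (record m { pend = just (lastPort a) }) (cell e f′) (tgt up) → Invariant Vis′ (suc t) S′
    do-finishOff full lv ne off nx = finishUp rb
      -- With the port of `a` pending, the `reach` of the robot is still `a`, so it remains the
      -- witness itself.
      (λ x i h → r , within (Next.msH nx) refl (trans (cong (pre (x ++ [ i ])) (trans (cong (_++ [ lastPort a ]) (trans (Next.psH nx) tgt≡)) (snoc-view a ne))) h))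
      where
      m′ : Memory
      m′ = record m { pend = just (lastPort a) }
      open Up m′ ne refl refl nx
      rb : RobotInv Vis′ (ce S′) (tgt up) m′
      rb = record
        { pers = persM
        ; near = subst (λ z → pre (addrT (ctx m)) z ≡ true) (sym tgt≡) (pre-init (addrT (ctx m)) (RobotInv.near rob) off ne)
        ; dead = λ fr → inj₂ (Mo.Dead-mono j₀ (ctx m) (hole m) (deadOff off fr))
        ; pnd = λ { i refl → subst (λ z → lastPort a < nc z) (sym tgt≡) (lastLt ne) ,
                    subst (Closed Vis′ (ce S′) j₀) (sym (trans (cong (_++ [ lastPort a ]) tgt≡) (snoc-view a ne))) (closedHere (Next.ceH nx) lv full) }
        ; grpG = RobotInv.grpG rob }

    do-finishAnchor : nc a ≤ e → livePorts f′ (nc a) ≡ [] → a ≢ [] → a ≡ addrT (ctx m) →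
      Next (record m { ctx = upC (ctx m) ; hole = upS (ctx m) (hole m) ; free = true ; pend = just (lastPort a) }) (cell e f′) (tgt up) → Invariant Vis′ (suc t) S′
    do-finishAnchor full lv ne at nx = finishUp rb
      (λ x i h → r , within (Next.msH nx) refl (trans (cong (pre (x ++ [ i ])) (trans (cong (_++ [ lastPort a ]) (trans (Next.psH nx) tgt≡)) (snoc-view a ne))) h))
      where
      m′ : Memory
      m′ = record m { ctx = upC (ctx m) ; hole = upS (ctx m) (hole m) ; free = true ; pend = just (lastPort a) }
      open Up m′ ne refl refl nx
      ua = I.up-addr (ce S′) j₀ (ctx m) (hole m) (λ h → ne (trans at h))
      dl : dropLast a ≡ addrT (upC (ctx m))
      dl = trans (cong dropLast (trans at (proj₁ (proj₂ ua)))) (dropLast-snoc _ (proj₁ ua))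
      lst : lastPort a ≡ proj₁ ua
      lst = trans (cong lastPort (trans at (proj₁ (proj₂ ua)))) (lastPort-snoc (addrT (upC (ctx m))) (proj₁ ua))
      rb : RobotInv Vis′ (ce S′) (tgt up) m′
      rb = record
        { pers = I.PI-up-free (ce S′) j₀ {fr = free m} persM
        ; near = subst (λ z → pre (addrT (upC (ctx m))) z ≡ true) (sym (trans tgt≡ dl)) (pre-refl (addrT (upC (ctx m))))
        ; dead = λ _ → inj₁ (trans tgt≡ dl , lastPort a , refl , subst (_∈ I.portsT (ce S′) j₀ (upS (ctx m) (hole m))) (sym lst) (proj₂ (proj₂ ua)))
        ; pnd = λ { i refl → subst (λ z → lastPort a < nc z) (sym tgt≡) (lastLt ne) ,
                    subst (Closed Vis′ (ce S′) j₀) (sym (trans (cong (_++ [ lastPort a ]) tgt≡) (snoc-view a ne))) (closedHere (Next.ceH nx) lv full) }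
        ; grpG = RobotInv.grpG rob }

    module Down (m′ : Memory) (e′ : ℕ) (i₀ : ℕ) (lt₀ : i₀ < nc a) (e≤ : e ≤ e′) (gm : grp m′ ≡ j₀) (pm : pend m′ ≡ nothing)
                (nx : Next m′ (cell e′ f′) (tgt (down i₀))) where
      open Common m′ e′ (tgt (down i₀)) nx e≤ gm public
      open Next nx

      tgt≡ : tgt (down i₀) ≡ a ++ [ i₀ ]
      tgt≡ = goto-down T a i₀ lt₀

      lp≡ : reach m′ (ps S′ r) ≡ a ++ [ i₀ ]
      lp≡ rewrite pm = trans (++-identityʳ _) (trans psH tgt≡)

      self : ∀ x → pre x (a ++ [ i₀ ]) ≡ true → Within S′ j₀ x r
      self x h = within msH gm (trans (cong (pre x) lp≡) h)

      above : ∀ x i → pre (x ++ [ i ]) a ≡ true → Σ (Fin K) (Within S′ j₀ (x ++ [ i ]))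
      above x i h = r , self (x ++ [ i ]) (pre-trans (x ++ [ i ]) a _ h (pre-++ a [ i₀ ]))

      isnode′ : IsNode T (tgt (down i₀))
      isnode′ = subst (IsNode T) (sym tgt≡) (IsNode-snoc T a i₀ (Invariant.isnode inv r) lt₀)

      lenD : sumF (λ r → length (ps S′ r)) ≡ suc (sumF (λ r → length (ps S r)))
      lenD = +-cancelʳ-≡ (length a) _ _ (trans lenM (trans (cong (sumF (λ r → length (ps S r)) +_) (trans (cong length tgt≡) (length-snoc a i₀))) (+-suc _ (length a))))

    do-discover : e < nc a → Next (clr m) (cell (suc e) f′) (tgt (down e)) → Invariant Vis′ (suc t) S′
    do-discover lt nx = build isnode′ lt rb above
      (λ i le lt′ → r , self (a ++ [ i ]) (subst (λ z → pre (a ++ [ i ]) (a ++ [ z ]) ≡ true) (≤-antisym (s≤s⁻¹ lt′) le) (pre-refl (a ++ [ i ])))) tm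
      where
      open Down (clr m) (suc e) e lt (n≤1+n e) refl refl nx
      deadD : free m ≡ true → I.Dead (ce S′) j₀ (ctx m) (hole m)
      deadD fr with RobotInv.dead rob fr
      ... | inj₂ d = Mo.Dead-mono j₀ (ctx m) (hole m) d
      -- A node whose children are in the map has all its ports entered, so it offers nothing to
      -- discover.
      ... | inj₁ (at , i , _ , i∈) = ⊥-elim (<⇒≱ lt (subst (λ z → nc z ≤ expl (ce S j₀ z)) (sym at) (fullAt (hole m) i∈ (I.Gd-in (ce S) j₀ (ctx m) (hole m) (I.Account.good {ce S} {j₀} (RobotInv.pers rob))))))
        where
        fullAt : ∀ s {i x n} → i ∈ I.portsT (ce S) j₀ s → I.GoodT (ce S) j₀ x n s → nc x ≤ expl (ce S j₀ x)
        fullAt (nd w F) i∈ (h , _) = I.N.full {ce S} {j₀} h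
      rb : RobotInv Vis′ (ce S′) (tgt (down e)) (clr m)
      rb = record
        { pers = persM
        ; near = subst (λ z → pre (addrT (ctx m)) z ≡ true) (sym tgt≡) (pre-trans (addrT (ctx m)) a _ (RobotInv.near rob) (pre-++ a [ e ]))
        ; dead = λ fr → inj₂ (deadD fr)
        ; pnd = λ i ()
        ; grpG = RobotInv.grpG rob }
      bump : sumT T (λ a → sumN G (λ j → expl (ce S′ j a))) ≡ suc (sumT T (λ a → sumN G (λ j → expl (ce S j a))))
      bump = sumT-bump T _ _ a (Invariant.isnode inv r)
        (sumN-bump G _ _ j₀ (RobotInv.grpG rob) (cong expl (Next.ceH nx)) (λ j ne → cong expl (Next.ceE nx j a (inj₁ ne))))
        (λ x ne → sumN-cong G _ _ (λ j _ → cong expl (Next.ceE nx j x (inj₂ ne))))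
      tm : suc t + sumF (λ r → length (ps S′ r)) ≤ 2 * sumT T (λ a → sumN G (λ j → expl (ce S′ j a))) + 2 * sumF (λ r → movesOf (ms S′ r))
      tm = subst₂ (λ x y → suc t + x ≤ 2 * y + 2 * sumF (λ r → movesOf (ms S′ r))) (sym lenD) (sym bump)
        (subst (λ z → suc t + suc L ≤ 2 * suc X + 2 * z) (sym (+-cancelʳ-≡ (moves m) _ _ movM)) (lin 0 (Invariant.time inv) (eq t L X Q)))
        where
        L = sumF (λ r → length (ps S r))
        X = sumT T (λ a → sumN G (λ j → expl (ce S j a)))
        Q = sumF (λ r → movesOf (ms S r))
        eq : ∀ t l x q → suc t + suc l + (2 * x + 2 * q) + 0 ≡ 2 * suc x + 2 * q + (t + l)
        eq = solve-∀

    -- Below `a` there are one robot per live child and the active robot. Unless a listed branch is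
    -- finished, `countT` adds one robot per open fork, and the group has at most κ members.
    roomy : ∀ q qs → livePorts f′ (nc a) ≡ q ∷ qs → nc a ≤ e → a ≡ addrT (ctx m) →
      I.DeadCT (ce S) j₀ (ctx m) ⊎ sibT (ctx m) + suc (suc (length qs)) ≤ κ
    roomy q qs lv full at with Count.countT κ nc (λ a → expl (ce S j₀ a)) (λ a → fin (ce S j₀ a)) (cnt S j₀) (cnt-split S j₀) occ (ctx m) (hole m) (I.Account.good {ce S} {j₀} (RobotInv.pers rob))
      where
      occ : ∀ x i → i < expl (ce S j₀ x) → fin (ce S j₀ x) i ≡ false → 1 ≤ cnt S j₀ (x ++ [ i ])
      occ x i lt h = let (r′ , w) = Invariant.wit inv j₀ x i lt h in sumF-1 _ r′ (within⇒tok S j₀ (x ++ [ i ]) r′ w)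
    ... | inj₁ d = inj₁ d
    ... | inj₂ le = inj₂ (≤-trans (+-monoʳ-≤ (sibT (ctx m)) (subst (λ z → suc (suc (length qs)) ≤ cnt S j₀ z) at here≥)) (≤-trans le (seat≤ inv j₀)))
      where
      live = q ∷ qs
      sound : ∀ {i} → i ∈ live → i < nc a × f′ i ≡ false
      sound {i} i∈ = live-sound f′ (nc a) (subst (i ∈_) (sym lv) i∈)
      uq : Unique live
      uq = subst Unique lv (live-unique f′ (nc a))
      each : All (λ p → 1 ≤ cnt S j₀ (a ++ [ p ])) live
      each = All.tabulate (λ {i} i∈ → let (lt , h) = sound i∈
                                          (r′ , w) = Invariant.wit inv j₀ a i (≤-trans lt full) (mark-old (pend m) _ i h)
                                      in sumF-1 _ r′ (within⇒tok S j₀ (a ++ [ i ]) r′ w))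
      apart : ∀ {i} → i ∈ live → pre (a ++ [ i ]) (reach m a) ≡ false
      apart {i} i∈ = ¬true⇒false λ h → bad (pre-reach-last m a i a h)
        where
        bad : pre (a ++ [ i ]) a ≡ true ⊎ (a ≡ a × pend m ≡ just i) → ⊥
        bad (inj₁ p) = true≢false (trans (sym p) (snoc-pre-self a i))
        bad (inj₂ (_ , p)) = true≢false (trans (sym (subst (λ z → mark z (fin (ce S j₀ a)) i ≡ true) (sym p) (mark-self (fin (ce S j₀ a)) i))) (proj₂ (sound i∈)))
      zeros : ∀ ps → (∀ {i} → i ∈ ps → pre (a ++ [ i ]) (reach m a) ≡ false) → sumP ps (λ p → tok (just m) a j₀ (a ++ [ p ])) ≡ 0
      zeros [] h = refl
      zeros (p ∷ ps) h = cong₂ _+_ (trans (tok-self m a (a ++ [ p ])) (cong b2n (h (here refl)))) (zeros ps (h ∘ there))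
      -- The active robot counts at `a` but in none of the live children, which gives the extra one.
      strict : sumP live (λ p → tok (ms S r) a j₀ (a ++ [ p ])) < tok (ms S r) a j₀ a
      strict = subst (λ μ → sumP live (λ p → tok μ a j₀ (a ++ [ p ])) < tok μ a j₀ a) (sym em)
        (≤-trans (s≤s (≤-reflexive (zeros live apart))) (≤-reflexive (sym one′)))
        where
        one′ : tok (just m) a j₀ a ≡ 1
        one′ = trans (tok-self m a a) (cong b2n (pre-reach m a))
      here≥ : suc (suc (length qs)) ≤ cnt S j₀ a
      here≥ = ≤-trans (s≤s (≤-trans (sumP-length live _ each) (≤-reflexive (sumP-F live (λ p r → tok (ms S r) (ps S r) j₀ (a ++ [ p ]))))))
        (sumF-mono< _ _ r (λ r′ → sumP-tok (ms S r′) (ps S r′) j₀ a live uq) strict)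

    do-travel : nc a ≤ e → ∀ q qs → livePorts f′ (nc a) ≡ q ∷ qs → a ≡ addrT (ctx m) →
      Next (proj₁ (travel (clr m) f′ q qs)) (cell e f′) (tgt (proj₂ (travel (clr m) f′ q qs))) → Invariant Vis′ (suc t) S′
    do-travel full q qs lv at nx = conclude (travel (clr m) f′ q qs) out nx
      where
      ceH = Next.ceH nx
      same : ∀ j x → (j ≡ j₀ × x ≡ a) ⊎ (j ≢ j₀ ⊎ x ≢ a)
      same j x with j ≟ j₀ | ≡-dec _≟_ x a
      ... | yes p | yes q = inj₁ (p , q)
      ... | no p | _ = inj₂ (inj₁ p)
      ... | yes _ | no q = inj₂ (inj₂ q)
      ex≤ : ∀ x → expl (ce S j₀ x) ≤ expl (ce S′ j₀ x)
      ex≤ x with same j₀ x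
      ... | inj₁ (refl , refl) rewrite ceH = ≤-refl
      ... | inj₂ ne rewrite Next.ceE nx j₀ x ne = ≤-refl
      fn≤ : ∀ x i → fin (ce S j₀ x) i ≡ true → fin (ce S′ j₀ x) i ≡ true
      fn≤ x i h with same j₀ x
      ... | inj₁ (refl , refl) rewrite ceH = mark-keep (pend m) _ i h
      ... | inj₂ ne rewrite Next.ceE nx j₀ x ne = h
      module Mo = Mono κ nc (λ a → expl (ce S j₀ a)) (λ a → expl (ce S′ j₀ a)) (λ a → fin (ce S j₀ a)) (λ a → fin (ce S′ j₀ a)) ex≤ fn≤
      finA : fin (ce S′ j₀ (addrT (ctx m))) ≡ f′
      finA = trans (cong (λ z → fin (ce S′ j₀ z)) (sym at)) (cong fin ceH)
      full′ : nc (addrT (ctx m)) ≤ expl (ce S′ j₀ (addrT (ctx m)))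
      full′ = subst (λ z → nc z ≤ expl (ce S′ j₀ z)) at (subst (λ z → nc a ≤ expl z) (sym ceH) full)
      lv′ : livePorts (fin (ce S′ j₀ (addrT (ctx m)))) (nc (addrT (ctx m))) ≡ q ∷ qs
      lv′ = trans (cong₂ livePorts finA (cong nc (sym at))) lv
      room : I.DeadCT (ce S′) j₀ (ctx m) ⊎ sibT (ctx m) + suc (suc (length qs)) ≤ κ
      room with roomy q qs lv full at
      ... | inj₁ d = inj₁ (Mo.DeadCT-mono (ctx m) d)
      ... | inj₂ le = inj₂ le
      deadT : free m ≡ true → I.Dead (ce S′) j₀ (ctx m) (hole m)
      deadT fr with RobotInv.dead rob fr
      ... | inj₂ d = Mo.Dead-mono (ctx m) (hole m) d
      ... | inj₁ (_ , i , pe , i∈) = inj₁ (portDead (hole m) i∈ (trans (cong (λ z → z i) finA) (subst (λ z → mark z (fin (ce S j₀ a)) i ≡ true) (sym pe) (mark-self (fin (ce S j₀ a)) i))))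
        where
        portDead : ∀ s {i x} → i ∈ I.portsT (ce S) j₀ s → fin (ce S′ j₀ x) i ≡ true → I.DeadS (ce S′) j₀ x s
        portDead (nd w F) {i} i∈ h = i , i∈ , h
      out : I.Out (ce S′) j₀ (clr m) (addrT (ctx m)) (travel (clr m) f′ q qs)
      out = subst (λ h → I.Out (ce S′) j₀ (clr m) (addrT (ctx m)) (travel (clr m) h q qs)) finA
        (I.Decide.travel-out (ce S′) j₀ (clr m) q qs full′ lv′ room (Mo.PI-mono (RobotInv.pers rob)) deadT)
      conclude : ∀ rs → I.Out (ce S′) j₀ (clr m) (addrT (ctx m)) rs → Next (proj₁ rs) (cell e f′) (tgt (proj₂ rs)) → Invariant Vis′ (suc t) S′
      conclude (m′ , up) (I.went-up pi dd gm pm mm ne dl) nx′ = finishUp rb (watched q qs lv full)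
        where
        ne′ : a ≢ []
        ne′ h = ne (trans (sym at) h)
        open Up m′ ne′ gm mm nx′
        ad : tgt up ≡ addrT (ctx m′)
        ad = trans tgt≡ (trans (cong dropLast at) dl)
        rb : RobotInv Vis′ (ce S′) (tgt up) m′
        rb = record
          { pers = subst (λ j → I.AccountOf (ce S′) j m′) (sym gm) pi
          ; near = subst (λ z → pre (addrT (ctx m′)) z ≡ true) (sym ad) (pre-refl (addrT (ctx m′)))
          ; dead = λ fr → inj₂ (subst (λ j → I.Dead (ce S′) j (ctx m′) (hole m′)) (sym gm) (dd fr))
          ; pnd = λ i pe → ⊥-elim (nope (trans (sym pm) pe))
          ; grpG = subst (_< G) (sym gm) (RobotInv.grpG rob) }
          where nope : ∀ {i : ℕ} → nothing ≡ just i → ⊥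
                nope ()
      conclude (m′ , down i) (I.went-down pi fr gm pm mm lt ad) nx′ = build isnode′ e≤nc rb above (λ i le lt → ⊥-elim (<⇒≱ lt le)) tm
        where
        lt′ : i < nc a
        lt′ = subst (λ z → i < nc z) (sym at) lt
        open Down m′ e i lt′ ≤-refl gm pm nx′
        ad′ : tgt (down i) ≡ addrT (ctx m′)
        ad′ = trans tgt≡ (trans (cong (_++ [ i ]) at) (sym ad))
        rb : RobotInv Vis′ (ce S′) (tgt (down i)) m′
        rb = record
          { pers = subst (λ j → I.AccountOf (ce S′) j m′) (sym gm) pi
          ; near = subst (λ z → pre (addrT (ctx m′)) z ≡ true) (sym ad′) (pre-refl (addrT (ctx m′)))
          ; dead = λ fr′ → ⊥-elim (true≢false (trans (sym fr′) fr))
          ; pnd = λ i pe → ⊥-elim (nope (trans (sym pm) pe))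
          ; grpG = subst (_< G) (sym gm) (RobotInv.grpG rob) }
          where nope : ∀ {i : ℕ} → nothing ≡ just i → ⊥
                nope ()
        exSame : ∀ j x → expl (ce S′ j x) ≡ expl (ce S j x)
        exSame j x with same? j x
        ... | inj₁ (refl , refl) = cong expl (Next.ceH nx′)
        ... | inj₂ q = cong expl (Next.ceE nx′ j x q)
        movD : sumF (λ r → movesOf (ms S′ r)) ≡ suc (sumF (λ r → movesOf (ms S r)))
        movD = +-cancelʳ-≡ (moves m) _ _ (trans movM (trans (cong (sumF (λ r → movesOf (ms S r)) +_) mm) (+-suc _ (moves m))))
        tm : suc t + sumF (λ r → length (ps S′ r)) ≤ 2 * sumT T (λ a → sumN G (λ j → expl (ce S′ j a))) + 2 * sumF (λ r → movesOf (ms S′ r))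
        tm = subst₂ (λ x y → suc t + x ≤ 2 * sumT T (λ a → sumN G (λ j → expl (ce S′ j a))) + 2 * y) (sym lenD) (sym movD)
          (subst (λ z → suc t + suc L ≤ 2 * z + 2 * suc Q) (sumT-cong T _ _ (λ x → sumN-cong G _ _ (λ j _ → sym (exSame j x)))) (lin 0 (Invariant.time inv) (eq t L X Q)))
          where
          L = sumF (λ r → length (ps S r))
          X = sumT T (λ a → sumN G (λ j → expl (ce S j a)))
          Q = sumF (λ r → movesOf (ms S r))
          eq : ∀ t l x q → suc t + suc l + (2 * x + 2 * q) + 0 ≡ 2 * x + 2 * suc q + (t + l)
          eq = solve-∀

    step-inv : Next (proj₁ res) (proj₁ (proj₂ res)) (tgt (proj₂ (proj₂ res))) → Done ⊎ Invariant Vis′ (suc t) S′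
    step-inv nx = go res (act-view m e (fin (ce S j₀ a)) a (nc a)) nx
      where
      go : ∀ rs → ActView m e f′ a (nc a) rs → Next (proj₁ rs) (proj₁ (proj₂ rs)) (tgt (proj₂ (proj₂ rs))) → Done ⊎ Invariant Vis′ (suc t) S′
      go _ (discover lt) nx = inj₂ (do-discover lt nx)
      go _ (allDone full lv root) nx = inj₁ (do-done full lv root nx)
      go _ (finishAnchor full lv ne at) nx = inj₂ (do-finishAnchor full lv ne at nx)
      go _ (finishOff full lv ne off) nx = inj₂ (do-finishOff full lv ne off nx)
      go _ (back full q qs lv off) nx = inj₂ (do-back full q qs lv off nx)
      go _ (trav full q qs lv at) nx = inj₂ (do-travel full q qs lv at nx)

-- The algorithm, enrolment, and the bound for one choice of groups.

-- slots holds the group now filling up and the number of its members; it is only used at the root.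
record Board : Set where
  constructor board
  field
    slots  : ℕ × ℕ
    cellOf : ℕ → Cell
open Board

start : ℕ → Memory
start g = memory g top leaf false nothing 0 0

nextSlot : ℕ → ℕ × ℕ → ℕ × ℕ
nextSlot κ (g , n) = if suc n <ᵇ κ then (g , suc n) else (suc g , 0)

-- A robot without memory is still at the root, by `home`, so the slots it reads are those of the
-- root.
enrol : ℕ → ℕ × ℕ → Maybe Memory → Memory × (ℕ × ℕ)
enrol κ s (just m) = m , s
enrol κ s nothing = start (proj₁ s) , nextSlot κ s

updC : (ℕ → Cell) → ℕ → Cell → ℕ → Cell
updC f j c i = if i ≡ᵇ j then c else f i

updC-same : ∀ f j c → updC f j c j ≡ c
updC-same f j c rewrite ≡ᵇ-refl j = refl

updC-other : ∀ f j c i → i ≢ j → updC f j c i ≡ f i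
updC-other f j c i ne with i ≡ᵇ j in eq
... | true = ⊥-elim (ne (≡ᵇ-true i j eq))
... | false = refl

groupAlg : (κ : ℕ) .{{_ : NonZero κ}} → Algorithm
groupAlg κ = record
  { Mem = Maybe Memory
  ; WB = Board
  ; mem₀ = nothing
  ; wb₀ = board (0 , 0) (λ _ → cell 0 (λ _ → false))
  ; step = λ μ b a nbrs →
      let (m , s) = enrol κ (slots b) μ
          (m′ , c′ , mv) = Rule.act κ m (cellOf b (grp m)) a (kids a (length nbrs))
      in just m′ , board s (updC (cellOf b) (grp m) c′) , goto a mv (length nbrs) }

module Run (κ : ℕ) .{{_ : NonZero κ}} (K G : ℕ) (fits : K ≤ G * κ) (1≤G : 1 ≤ G) (T : Tree) where

  open System κ K G T
  open Execution (groupAlg κ) K T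

  updR-same : ∀ {X : Set} (f : Fin K → X) r x → updR f r x r ≡ x
  updR-same f r x with r ≟F r
  ... | yes _ = refl
  ... | no ne = ⊥-elim (ne refl)

  updR-other : ∀ {X : Set} (f : Fin K → X) r x r′ → r′ ≢ r → updR f r x r′ ≡ f r′
  updR-other f r x r′ ne with r′ ≟F r
  ... | yes e = ⊥-elim (ne e)
  ... | no _ = refl

  updA-same : ∀ {X : Set} (f : Address → X) a x → updA f a x a ≡ x
  updA-same f a x with ≡-dec _≟_ a a
  ... | yes _ = refl
  ... | no ne = ⊥-elim (ne refl)

  st : Config → State K
  st c = record { ps = pos c ; ms = mem c ; ce = λ j x → cellOf (wb c x) j ; sl = slots (wb c []) }

  module Enrol (Vis : Address → Set) (t : ℕ) (S : State K) (inv : Invariant Vis t S) (r : Fin K) (em : ms S r ≡ nothing)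
               (ms₁ : Fin K → Maybe Memory) (msH : ms₁ r ≡ just (start (proj₁ (sl S)))) (msE : ∀ r′ → r′ ≢ r → ms₁ r′ ≡ ms S r′) where

    g₀ n₀ : ℕ
    g₀ = proj₁ (sl S)
    n₀ = proj₂ (sl S)

    S₁ : ℕ × ℕ → State K
    S₁ s = record { ps = ps S ; ms = ms₁ ; ce = ce S ; sl = s }

    seatedS : sumF (λ r → seated (ms₁ r)) ≡ suc (sumF (λ r → seated (ms S r)))
    seatedS = trans (sym (+-identityʳ _)) (trans (subst₂ (λ x y → sumF (λ r → seated (ms₁ r)) + seated x ≡ sumF (λ r → seated (ms S r)) + seated y) em msH
      (sumF-upd (λ r → seated (ms S r)) (λ r → seated (ms₁ r)) r (λ j ne → cong seated (msE j ne)))) (+-comm _ 1))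

    seated≤1 : ∀ μ → seated μ ≤ 1
    seated≤1 nothing = z≤n
    seated≤1 (just _) = ≤-refl

    -- At least `g₀ * κ` robots were enrolled before this one, and there are at most `G * κ` in all.
    room : g₀ < G
    room = *-cancelʳ-< κ g₀ G (≤-trans (s≤s (≤-trans (m≤m+n _ n₀) (Invariant.used inv)))
      (≤-trans (≤-reflexive (sym seatedS)) (≤-trans (sumF-const _ 1 (λ r → seated≤1 (ms₁ r))) (≤-trans (≤-reflexive (*-identityʳ K)) fits))))

    tok₁ : ∀ j → ℕ
    tok₁ j = if g₀ ≡ᵇ j then 1 else 0

    cnt₁ : ∀ s j → cnt (S₁ s) j [] ≡ cnt S j [] + tok₁ j
    cnt₁ s j = trans (sym (+-identityʳ _)) (subst₂ (λ x y → cnt (S₁ s) j [] + tok x (ps S r) j [] ≡ cnt S j [] + tok y (ps S r) j []) em msH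
      (sumF-upd (λ r → tok (ms S r) (ps S r) j []) (λ r → tok (ms₁ r) (ps S r) j []) r (λ i ne → cong (λ z → tok z (ps S i) j []) (msE i ne))))

    cnt-other : ∀ s j → g₀ ≢ j → cnt (S₁ s) j [] ≡ cnt S j []
    cnt-other s j ne with g₀ ≡ᵇ j in eq | cnt₁ s j
    ... | true | _ = ⊥-elim (ne (≡ᵇ-true g₀ j eq))
    ... | false | h = trans h (+-identityʳ _)

    cnt-here : ∀ s → cnt (S₁ s) g₀ [] ≡ suc (cnt S g₀ [])
    cnt-here s with g₀ ≡ᵇ g₀ | ≡ᵇ-refl g₀ | cnt₁ s g₀
    ... | true | refl | h = trans h (+-comm _ 1)

    no-mem : ∀ {m : Memory} → ms S r ≡ just m → ⊥
    no-mem h with trans (sym em) h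
    ... | ()

    newRob : ∀ p → p ≡ [] → RobotInv Vis (ce S) p (start g₀)
    newRob p refl = record
      { pers = record
          { good = tt
          ; paid = ≤-reflexive (eq W κ)
          ; grow = ≤-reflexive (cong (_+ W) (*-zeroʳ (2 * κ ^ κ))) }
      ; near = refl
      ; dead = λ ()
      ; pnd = λ i ()
      ; grpG = room }
      where
      eq : ∀ w k → w * 0 + 2 * k * 0 + 5 * w * 0 + w * 0 ≡ 16 * k * w * 0
      eq = solve-∀

    base : ∀ s → (∀ j → j < proj₁ s → cnt (S₁ s) j [] ≤ κ) → cnt (S₁ s) (proj₁ s) [] ≤ proj₂ s → (∀ j → proj₁ s < j → cnt (S₁ s) j [] ≡ 0) →
      proj₂ s < κ → proj₁ s * κ + proj₂ s ≤ suc (sumF (λ r → seated (ms S r))) → Invariant Vis t (S₁ s)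
    base s h< h≡ h> hr hu = record
      { home = home₁
      ; isnode = Invariant.isnode inv
      ; small = Invariant.small inv
      ; wit = λ j x i lt h → wit₁ (Invariant.wit inv j x i lt h)
      ; clos = Invariant.clos inv
      ; robs = robs₁
      ; seat< = h< ; seat≡ = h≡ ; seat> = h> ; rem< = hr
      ; used = ≤-trans hu (≤-reflexive (sym seatedS))
      ; time = subst (λ z → t + sumF (λ r → length (ps S r)) ≤ 2 * sumT T (λ a → sumN G (λ j → expl (ce S j a))) + 2 * z) (sumF-cong _ _ moves₁) (Invariant.time inv) }
      where
      home₁ : ∀ r′ → ms₁ r′ ≡ nothing → ps S r′ ≡ []
      home₁ r′ h with r′ ≟F r
      ... | yes refl = Invariant.home inv r em
      ... | no ne = Invariant.home inv r′ (trans (sym (msE r′ ne)) h)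
      moves₁ : ∀ r′ → movesOf (ms S r′) ≡ movesOf (ms₁ r′)
      moves₁ r′ with r′ ≟F r
      ... | yes refl rewrite em | msH = refl
      ... | no ne = cong movesOf (sym (msE r′ ne))
      wit₁ : ∀ {j x} → Σ (Fin K) (Within S j x) → Σ (Fin K) (Within (S₁ s) j x)
      wit₁ (r′ , within h₁ h₂ h₃) with r′ ≟F r
      ... | yes refl = ⊥-elim (no-mem h₁)
      ... | no ne = r′ , within (trans (msE r′ ne) h₁) h₂ h₃
      robs₁ : ∀ r′ m → ms₁ r′ ≡ just m → RobotInv Vis (ce S) (ps S r′) m
      robs₁ r′ m h with r′ ≟F r
      ... | no ne = Invariant.robs inv r′ m (trans (sym (msE r′ ne)) h)
      ... | yes refl with trans (sym msH) h
      ...   | refl = newRob (ps S r) (Invariant.home inv r em)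

    enrolled : Invariant Vis t (S₁ (nextSlot κ (sl S)))
    enrolled with suc n₀ <ᵇ κ in eq
    ... | true = base (g₀ , suc n₀)
      (λ j lt → ≤-trans (≤-reflexive (cnt-other (g₀ , suc n₀) j (>⇒≢ lt))) (Invariant.seat< inv j lt))
      (≤-trans (≤-reflexive (cnt-here (g₀ , suc n₀))) (s≤s (Invariant.seat≡ inv)))
      (λ j lt → trans (cnt-other (g₀ , suc n₀) j (<⇒≢ lt)) (Invariant.seat> inv j lt))
      (<ᵇ-true (suc n₀) κ eq)
      (≤-trans (≤-reflexive (+-suc (g₀ * κ) n₀)) (s≤s (Invariant.used inv)))
    ... | false = base (suc g₀ , 0) lower
      (≤-reflexive (trans (cnt-other (suc g₀ , 0) (suc g₀) (<⇒≢ ≤-refl)) (Invariant.seat> inv (suc g₀) ≤-refl)))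
      (λ j lt → trans (cnt-other (suc g₀ , 0) j (<⇒≢ (<-trans ≤-refl lt))) (Invariant.seat> inv j (<-trans ≤-refl lt)))
      (≤-trans (s≤s z≤n) (Invariant.rem< inv))
      (begin
        κ + g₀ * κ + 0      ≡⟨ trans (+-identityʳ _) (+-comm κ (g₀ * κ)) ⟩
        g₀ * κ + κ          ≤⟨ +-monoʳ-≤ (g₀ * κ) (<ᵇ-false (suc n₀) κ eq) ⟩
        g₀ * κ + suc n₀     ≡⟨ +-suc (g₀ * κ) n₀ ⟩
        suc (g₀ * κ + n₀)   ≤⟨ s≤s (Invariant.used inv) ⟩
        suc (sumF (λ r → seated (ms S r))) ∎)
      where
      open ≤-Reasoning
      lower : ∀ j → j < suc g₀ → cnt (S₁ (suc g₀ , 0)) j [] ≤ κ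
      lower j lt with j ≟ g₀
      ... | yes refl = ≤-trans (≤-reflexive (cnt-here (suc g₀ , 0))) (≤-trans (s≤s (Invariant.seat≡ inv)) (Invariant.rem< inv))
      ... | no ne = ≤-trans (≤-reflexive (cnt-other (suc g₀ , 0) j (≢-sym ne))) (Invariant.seat< inv j (≤∧≢⇒< (s≤s⁻¹ lt) ne))

  module Act (Vis Vis′ : Address → Set) (t : ℕ) (c : Config) (r : Fin K)
             (vmono : ∀ x → Vis x → Vis′ x) (vhere : Vis′ (pos c r)) where

    here-wb : Board
    here-wb = wb c (pos c r)
    self : Memory
    self = proj₁ (enrol κ (slots here-wb) (mem c r))
    slot : ℕ × ℕ
    slot = proj₂ (enrol κ (slots here-wb) (mem c r))
    All′ : Set
    All′ = ∀ x → IsNode T x → Vis′ x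

    after : ∀ ms₁ s → Invariant Vis t (record { ps = pos c ; ms = ms₁ ; ce = ce (st c) ; sl = s }) → ms₁ r ≡ just self →
      (∀ r′ → r′ ≢ r → ms₁ r′ ≡ mem c r′) → slots (wb (activate c r) []) ≡ s → All′ ⊎ Invariant Vis′ (suc t) (st (activate c r))
    after ms₁ s inv e₁ e₂ es = step-inv (subst N′ (kids-neighbours T a) record
      { slN = es
      ; ceH = trans (cong (λ z → cellOf z (grp self)) (updA-same (wb c) a _)) (updC-same (cellOf here-wb) (grp self) _)
      ; ceE = other
      ; msH = updR-same (mem c) r _
      ; msE = λ r′ ne → trans (updR-other (mem c) r _ r′ ne) (sym (e₂ r′ ne))
      ; psH = updR-same (pos c) r _
      ; psE = λ r′ ne → updR-other (pos c) r _ r′ ne })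
      where
      S₁ : State K
      S₁ = record { ps = pos c ; ms = ms₁ ; ce = ce (st c) ; sl = s }
      open Step Vis Vis′ t S₁ (st (activate c r)) inv r self e₁ vmono vhere
      N′ : ℕ → Set
      N′ z = let (m′ , c′ , mv) = act self (ce S₁ j₀ a) a z in Next m′ c′ (tgt mv)
      other : ∀ j x → j ≢ j₀ ⊎ x ≢ a → cellOf (wb (activate c r) x) j ≡ cellOf (wb c x) j
      other j x h with ≡-dec _≟_ x a
      other j x h | no ne = refl
      other j x (inj₂ ne) | yes e = ⊥-elim (ne e)
      other j x (inj₁ ne) | yes refl = updC-other (cellOf here-wb) (grp self) _ j ne

    slots-root : pos c r ≡ [] → slots (wb (activate c r) []) ≡ slot
    slots-root e with ≡-dec _≟_ [] (pos c r)
    ... | yes _ = refl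
    ... | no ne = ⊥-elim (ne (sym e))

    slots-old : slot ≡ slots here-wb → slots (wb (activate c r) []) ≡ slots (wb c [])
    slots-old e with ≡-dec _≟_ [] (pos c r)
    ... | yes p = trans e (cong (λ z → slots (wb c z)) (sym p))
    ... | no _ = refl

    round : Invariant Vis t (st c) → All′ ⊎ Invariant Vis′ (suc t) (st (activate c r))
    round inv = go (mem c r) refl
      where
      go : ∀ μ → mem c r ≡ μ → All′ ⊎ Invariant Vis′ (suc t) (st (activate c r))
      go (just m) e = after (mem c) (slots (wb c [])) inv
        (trans e (cong just (sym (cong (λ z → proj₁ (enrol κ (slots here-wb) z)) e)))) (λ _ _ → refl)
        (slots-old (cong (λ z → proj₂ (enrol κ (slots here-wb) z)) e))
      go nothing e = after ms₁ (nextSlot κ (slots (wb c []))) (Enrol.enrolled Vis t (st c) inv r e ms₁ (updR-same (mem c) r _) (updR-other (mem c) r _))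
        (trans (updR-same (mem c) r _) (cong just (sym self≡))) (updR-other (mem c) r _)
        (trans (slots-root root) (trans (cong (λ z → proj₂ (enrol κ (slots here-wb) z)) e) (cong (λ z → nextSlot κ (slots (wb c z))) root)))
        where
        root : pos c r ≡ []
        root = Invariant.home inv r e
        ms₁ : Fin K → Maybe Memory
        ms₁ = updR (mem c) r (just (start (proj₁ (slots (wb c [])))))
        self≡ : self ≡ start (proj₁ (slots (wb c [])))
        self≡ = trans (cong (λ z → proj₁ (enrol κ (slots here-wb) z)) e) (cong (λ z → start (proj₁ (slots (wb c z)))) root)

  initial-inv : ∀ {Vis} → Invariant Vis 0 (st initial)
  initial-inv = record
    { home = λ _ _ → refl
    ; isnode = λ _ → T , refl
    ; small = λ _ _ → z≤n
    ; wit = λ _ _ _ ()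
    ; clos = λ _ _ _ _ ()
    ; robs = λ _ _ ()
    ; seat< = λ _ ()
    ; seat≡ = ≤-reflexive (sumF-zero K)
    ; seat> = λ _ _ → sumF-zero K
    ; rem< = >-nonZero⁻¹ κ
    ; used = z≤n
    ; time = ≤-trans (≤-reflexive (sumF-zero K)) z≤n }

  moveBound : ℕ
  moveBound = 32 * κ * 2 ^ κ * depth T

  robot-bound : ∀ {Vis t S} → Invariant Vis t S → ∀ r → movesOf (ms S r) ≤ moveBound
  robot-bound {S = S} inv r = go (ms S r) refl
    where
    go : ∀ μ → ms S r ≡ μ → movesOf μ ≤ moveBound
    go nothing e = z≤n
    go (just m) e = moves-bound (depth T) (moves m) (bank m) (ctx m) (hole m) refl
      (≤-trans (m≤m+n _ _) (I.Account.paid {ce S} {grp m} pi)) (I.Account.grow {ce S} {grp m} pi)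
      (I.V-depth (ce S) (grp m) T (λ _ → refl) (plugT (ctx m) (hole m)) [] 0 T refl (I.Account.good {ce S} {grp m} pi))
      where pi = RobotInv.pers (Invariant.robs inv r m e)

  budget : ℕ
  budget = 2 * (G * size T) + 2 * (K * moveBound)

  -- The inequality is strict because `sumT-size` leaves a surplus `G` for the root, and `1 ≤ G`.
  time-bound : ∀ {Vis t S} → Invariant Vis t S → t < budget
  time-bound {t = t} {S} inv = begin-strict
    t                                     ≤⟨ ≤-trans (m≤m+n t _) (Invariant.time inv) ⟩
    2 * X + 2 * Q                         <⟨ +-mono-<-≤ (*-monoʳ-< 2 (≤-trans (≤-trans (≤-reflexive (+-comm 1 X)) (+-monoʳ-≤ X 1≤G)) X≤))
                                                        (*-monoʳ-≤ 2 (sumF-const _ moveBound (robot-bound inv))) ⟩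
    budget ∎
    where
    open ≤-Reasoning
    X = sumT T (λ a → sumN G (λ j → expl (ce S j a)))
    Q = sumF (λ r → movesOf (ms S r))
    X≤ : X + G ≤ G * size T
    X≤ = sumT-size G T _ (λ a → sumN-const G _ (nc a) (λ j → Invariant.small inv j a))

  -- The invariant holds until every node has been visited and bounds the time while it holds, so it
  -- cannot last for `budget` rounds.
  explores : ExploresIn (groupAlg κ) K T budget
  explores σ = result (history budget)
    where
    Vis : ℕ → Address → Set
    Vis t x = Σ ℕ λ u → u < t × visitedAt σ u ≡ x
    later : ∀ t x → Vis t x → Vis (suc t) x
    later t x (u , lt , e) = u , m≤n⇒m≤1+n lt , e
    history : ∀ t → (∀ x → IsNode T x → Vis t x) ⊎ Invariant (Vis t) t (st (config σ t))
    history zero = inj₂ initial-inv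
    history (suc t) with history t
    ... | inj₁ all = inj₁ (λ x isN → later t x (all x isN))
    ... | inj₂ inv = Act.round (Vis t) (Vis (suc t)) t (config σ t) (σ t) (later t) (t , ≤-refl , refl) inv
    result : (∀ x → IsNode T x → Vis budget x) ⊎ Invariant (Vis budget) budget (st (config σ budget)) → ExploredWithin σ budget
    result (inj₁ all) = all
    result (inj₂ inv) = ⊥-elim (<-irrefl refl (time-bound inv))

-- The choice of the group size and the two bounds.

2^⌊log2⌋≤ : ∀ n (rec : Acc _<_ n) → 1 ≤ n → 2 ^ ⌊log2⌋ n rec ≤ n
2^⌊log2⌋≤ (suc zero) rec 1≤n = ≤-refl
2^⌊log2⌋≤ (suc (suc n)) (acc rs) 1≤n = begin
  2 * 2 ^ ⌊log2⌋ (suc ⌊ n /2⌋) _   ≤⟨ *-monoʳ-≤ 2 (2^⌊log2⌋≤ (suc ⌊ n /2⌋) _ (s≤s z≤n)) ⟩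
  2 * suc ⌊ n /2⌋                  ≡⟨ eq ⌊ n /2⌋ ⟩
  2 + (⌊ n /2⌋ + ⌊ n /2⌋)          ≤⟨ +-monoʳ-≤ 2 (+-monoʳ-≤ ⌊ n /2⌋ (⌊n/2⌋≤⌈n/2⌉ n)) ⟩
  2 + (⌊ n /2⌋ + ⌈ n /2⌉)          ≡⟨ cong (2 +_) (⌊n/2⌋+⌈n/2⌉≡n n) ⟩
  suc (suc n) ∎
  where
  open ≤-Reasoning
  eq : ∀ h → 2 * suc h ≡ 2 + (h + h)
  eq = solve-∀

-- A quadratic above `(h + 1)²`, chosen so that its double exceeds its next value; at 0 both sides
-- are 6.
square≤2^ : ∀ h → h * h + 4 * h + 6 ≤ 6 * 2 ^ h
square≤2^ zero = ≤-refl
square≤2^ (suc h) = lin (h * h + 2 * h + 1) (*-monoʳ-≤ 2 (square≤2^ h)) (eq h (2 ^ h))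
  where
  eq : ∀ h p → suc h * suc h + 4 * suc h + 6 + 2 * (6 * p) + (h * h + 2 * h + 1) ≡ 6 * (2 * p) + 2 * (h * h + 4 * h + 6)
  eq = solve-∀

-- With groups of κ = 1 + ⌊log₂ k / 2⌋ robots, κ² 2^κ = O(k) while there are only O(k / log k) groups.
module Split (k : ℕ) (2≤k : 2 ≤ k) where

  ℓ h κ G : ℕ
  ℓ = ⌊log₂ k ⌋
  h = ⌊ ℓ /2⌋
  κ = suc h
  G = suc (k / κ)

  open ≤-Reasoning

  2h≤ℓ : h + h ≤ ℓ
  2h≤ℓ = ≤-trans (+-monoʳ-≤ h (⌊n/2⌋≤⌈n/2⌉ ℓ)) (≤-reflexive (⌊n/2⌋+⌈n/2⌉≡n ℓ))

  ℓ≤2κ : ℓ ≤ 2 * κ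
  ℓ≤2κ = begin
    ℓ                ≡⟨ sym (⌊n/2⌋+⌈n/2⌉≡n ℓ) ⟩
    h + ⌈ ℓ /2⌉      ≤⟨ +-mono-≤ (n≤1+n h) (⌊n/2⌋-mono (n≤1+n (suc ℓ))) ⟩
    κ + κ            ≡⟨ cong (κ +_) (sym (+-identityʳ κ)) ⟩
    2 * κ            ∎

  4^h≤k : 2 ^ h * 2 ^ h ≤ k
  4^h≤k = begin
    2 ^ h * 2 ^ h    ≡⟨ sym (^-distribˡ-+-* 2 h h) ⟩
    2 ^ (h + h)      ≤⟨ ^-monoʳ-≤ 2 2h≤ℓ ⟩
    2 ^ ℓ            ≤⟨ 2^⌊log2⌋≤ k (<-wellFounded k) (≤-trans (n≤1+n 1) 2≤k) ⟩
    k                ∎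

  fits : k ≤ G * κ
  fits = begin
    k                      ≡⟨ m≡m%n+[m/n]*n k κ ⟩
    k % κ + k / κ * κ      ≤⟨ +-monoˡ-≤ (k / κ * κ) (<⇒≤ (m%n<n k κ)) ⟩
    κ + k / κ * κ          ∎

  groups : G * ℓ ≤ 4 * k
  groups = begin
    G * ℓ                  ≤⟨ *-monoʳ-≤ G ℓ≤2κ ⟩
    G * (2 * κ)            ≡⟨ eq (k / κ) κ ⟩
    2 * (κ + k / κ * κ)    ≤⟨ *-monoʳ-≤ 2 (+-mono-≤ κ≤k (m/n*n≤m k κ)) ⟩
    2 * (k + k)            ≡⟨ eq′ k ⟩
    4 * k                  ∎
    where
    eq : ∀ q c → suc q * (2 * c) ≡ 2 * (c + q * c)
    eq = solve-∀
    eq′ : ∀ k → 2 * (k + k) ≡ 4 * k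
    eq′ = solve-∀
    κ≤k : κ ≤ k
    κ≤k = begin
      suc h             ≤⟨ n<2^n h ⟩
      2 ^ h             ≤⟨ m≤m*n (2 ^ h) (2 ^ h) {{>-nonZero (m^n>0 2 h)}} ⟩
      2 ^ h * 2 ^ h     ≤⟨ 4^h≤k ⟩
      k                 ∎

  -- Halving the logarithm makes `2 ^ κ` of order the square root of `k`, and `κ * ℓ` is quadratic
  -- in `h`, hence also at most of order `2 ^ h`; their product stays below `4 ^ h ≤ k` up to a
  -- constant.
  weight : κ * 2 ^ κ * ℓ ≤ 24 * k
  weight = begin
    κ * 2 ^ κ * ℓ                        ≤⟨ *-monoʳ-≤ (κ * 2 ^ κ) ℓ≤2κ ⟩
    κ * (2 * 2 ^ h) * (2 * κ)            ≡⟨ eq κ (2 ^ h) ⟩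
    4 * (κ * κ) * 2 ^ h                  ≤⟨ *-monoˡ-≤ (2 ^ h) (*-monoʳ-≤ 4 κ²≤) ⟩
    4 * (6 * 2 ^ h) * 2 ^ h              ≡⟨ eq′ (2 ^ h) ⟩
    24 * (2 ^ h * 2 ^ h)                 ≤⟨ *-monoʳ-≤ 24 4^h≤k ⟩
    24 * k                               ∎
    where
    eq : ∀ c p → c * (2 * p) * (2 * c) ≡ 4 * (c * c) * p
    eq = solve-∀
    eq′ : ∀ p → 4 * (6 * p) * p ≡ 24 * (p * p)
    eq′ = solve-∀
    κ²≤ : κ * κ ≤ 6 * 2 ^ h
    κ²≤ = lin (2 * h + 5) (square≤2^ h) (eq″ h (2 ^ h))
      where
      eq″ : ∀ h p → suc h * suc h + 6 * p + (2 * h + 5) ≡ 6 * p + (h * h + 4 * h + 6)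
      eq″ = solve-∀

  total : ∀ s d → (2 * (G * s) + 2 * (k * (32 * κ * 2 ^ κ * d))) * ℓ ≤ 1536 * k * (s + k * d)
  total s d = begin
    (2 * (G * s) + 2 * (k * (32 * κ * 2 ^ κ * d))) * ℓ   ≡⟨ eq G s k κ (2 ^ κ) d ℓ ⟩
    2 * s * (G * ℓ) + 64 * k * d * (κ * 2 ^ κ * ℓ)      ≤⟨ +-mono-≤ (*-monoʳ-≤ (2 * s) groups) (*-monoʳ-≤ (64 * k * d) weight) ⟩
    -- The padding lifts the coefficient 8 of `k * s` to 1536 = 64 · 24, that of the other term.
    2 * s * (4 * k) + 64 * k * d * (24 * k)              ≤⟨ m≤m+n _ (1528 * (k * s)) ⟩
    2 * s * (4 * k) + 64 * k * d * (24 * k) + 1528 * (k * s)  ≡⟨ eq′ s d k ⟩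
    1536 * k * (s + k * d)                               ∎
    where
    eq : ∀ g s k c p d l → (2 * (g * s) + 2 * (k * (32 * c * p * d))) * l ≡ 2 * s * (g * l) + 64 * k * d * (c * p * l)
    eq = solve-∀
    eq′ : ∀ s d k → 2 * s * (4 * k) + 64 * k * d * (24 * k) + 1528 * (k * s) ≡ 1536 * k * (s + k * d)
    eq′ = solve-∀

theorem3 : (Σ ℕ λ C → ∀ (k : ℕ) → 1 ≤ k → Σ Algorithm λ A → ∀ (T : Tree) →
    ExploresIn A k T (2 * size T + C * (k ^ 2) * (2 ^ k) * depth T))
    × (Σ ℕ λ C → ∀ (k : ℕ) → 2 ≤ k → Σ Algorithm λ A → ∀ (T : Tree) →
    Σ ℕ λ M → ExploresIn A k T M × M * ⌊log₂ k ⌋ ≤ C * k * (size T + k * depth T))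
-- The 64 is the 32 of `moves-bound`, doubled because each descent must be climbed back; 1536
-- multiplies it by the 24 of `weight`.
theorem3 = (64 , single) , (1536 , split)
  where
  single : ∀ k → 1 ≤ k → Σ Algorithm λ A → ∀ T → ExploresIn A k T (2 * size T + 64 * (k ^ 2) * (2 ^ k) * depth T)
  single (suc k) 1≤k = groupAlg (suc k) , λ T →
    subst (ExploresIn (groupAlg (suc k)) (suc k) T) (eq (size T) (suc k) (2 ^ suc k) (depth T))
      (Run.explores (suc k) (suc k) 1 (≤-reflexive (sym (*-identityˡ (suc k)))) ≤-refl T)
    where
    eq : ∀ s k p d → 2 * (1 * s) + 2 * (k * (32 * k * p * d)) ≡ 2 * s + 64 * (k * (k * 1)) * p * d
    eq = solve-∀
  split : ∀ k → 2 ≤ k → Σ Algorithm λ A → ∀ T → Σ ℕ λ M → ExploresIn A k T M × M * ⌊log₂ k ⌋ ≤ 1536 * k * (size T + k * depth T)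
  split k 2≤k = groupAlg κ , λ T →
    Run.budget κ k G fits (s≤s z≤n) T , Run.explores κ k G fits (s≤s z≤n) T , total (size T) (depth T)
    where open Split k 2≤k
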